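{- Let $p$ be a prime number and $R\cong\mathbb Z_p\times\mathbb Z_p\times\mathbb Z_p\times\mathbb Z_p$. Put $$\lambda_1 = (p-1)^2,\qquad \lambda_2 = -p^2+2p-1,$$ $$\lambda_{3,4} = \tfrac12\big(-2p^2+3p-1\pm(p-1)\sqrt{4p-3}\big),$$ $$\lambda_{5,6} = \tfrac12\big(2p^2-p-1\pm\sqrt3\,\sqrt{4p^3-9p^2+6p-1}\big).$$ Then the spectrum (multiset of eigenvalues) of the zero-divisor graph $\Gamma(R)$ is $$\operatorname{spec}(\Gamma(R)) = \big\{\lambda_1^{[5]},\lambda_2^{[1]},\lambda_3^{[3]},\lambda_4^{[3]},\lambda_5^{[1]},\lambda_6^{[1]},0^{[p^4-(p-1)^4-2^4+1]}\big\}.$$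
   Context: $\mathbb Z_p$ denotes the ring of integers modulo $p$. For a finite commutative ring $R$ with $1\ne0$, the zero-divisor graph $\Gamma(R)$ has as vertex set the set of non-zero zero-divisors of $R$, and two (not necessarily distinct) vertices $x,y$ are adjacent iff $xy=0$ (loops are kept). The spectrum of a graph is the multiset of eigenvalues of its adjacency matrix; $\lambda^{[m]}$ means that $\lambda$ occurs with multiplicity $m$ (and $0^{[0]}$ means that $0$ does not occur). -}

module Defs where

open import Level using (Level; 0ℓ; _⊔_) renaming (suc to lsuc)
open import Algebra.Apartness.Bundles using (HeytingField)
open import Algebra.Bundles using (CommutativeRing; RawRing)
import Algebra.Construct.DirectProduct as DirectProduct
import Algebra.Definitions.RawSemiring as RawSemiringDefinitions
open import Algebra.Morphism.Structures using (module RingMorphisms)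
import Algebra.Properties.Ring as RingProperties
open import Data.Bool.Base using (if_then_else_)
open import Data.Fin.Base using (Fin; zero; suc; toℕ; punchIn)
import Data.Fin.Properties as Fin
open import Data.Integer.Base using (ℤ; 0ℤ; 1ℤ)
import Data.Integer.Divisibility.Signed as ℤ∣
import Data.Integer.Properties as ℤₚ
import Data.Integer.Tactic.RingSolver as ℤSolver
open import Data.List.Base using (List; []; _∷_; map; filter; tabulate; lookup; length; foldr)
open import Data.Nat.Base using (ℕ; zero; suc)
open import Data.Product.Base using (Σ-syntax; ∃-syntax; _×_; _,_; proj₁; proj₂)
open import Data.Sum.Base using (_⊎_; inj₁; inj₂)
open import Function.Bundles using (Inverse)
open import Relation.Binary.Core using (Rel)
open import Relation.Binary.Definitions using (Decidable; Symmetric)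
open import Relation.Binary.PropositionalEquality as ≡ using (_≡_; subst)
open import Relation.Binary.Structures using (IsStrictPartialOrder)
open import Relation.Nullary.Decidable using (Dec; does; map′; ¬?; _×-dec_)
open import Relation.Nullary.Negation using (¬_; contradiction)

------------------------------------------------------------------------
-- Ordered fields

-- An ordered field in the constructive sense: the apartness of the
-- Heyting field is x < y ⊎ y < x.  The order need not be decidable, so
-- both the constructive reals and every classical ordered field qualify.

record OrderedField c ℓ₁ ℓ₂ ℓ₃ : Set (lsuc (c ⊔ ℓ₁ ⊔ ℓ₂ ⊔ ℓ₃)) where
  field
    heytingField : HeytingField c ℓ₁ ℓ₂

  open HeytingField heytingField public

  infix 4 _<_ _≤_
  field
    _<_                    : Rel Carrier ℓ₃
    <-isStrictPartialOrder : IsStrictPartialOrder _≈_ _<_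
    #⇒<⊎>                  : ∀ {x y} → x # y → x < y ⊎ y < x
    <⇒#                    : ∀ {x y} → x < y → x # y
    +-monoʳ-<              : ∀ z {x y} → x < y → z + x < z + y
    *-pos                  : ∀ {x y} → 0# < x → 0# < y → 0# < x * y

  _≤_ : Rel Carrier ℓ₃
  x ≤ y = ¬ (y < x)

  commutativeRing : CommutativeRing c ℓ₁
  commutativeRing = record { isCommutativeRing = isCommutativeRing }

  open CommutativeRing commutativeRing public using (rawRing; ring)
  open RawSemiringDefinitions (RawRing.rawSemiring rawRing) public using (_^_)
  open RawSemiringDefinitions (RawRing.rawSemiring rawRing)
    using () renaming (_×_ to _×ℕ_)

  fromℕ : ℕ → Carrier
  fromℕ n = n ×ℕ 1#

  private
    module < = IsStrictPartialOrder <-isStrictPartialOrder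
    open RingProperties ring using (-‿distribˡ-*; -‿distribʳ-*; -‿involutive)

    1-0-invertible : ∃[ y ] (y * (1# - 0#) ≈ 1#) × ((1# - 0#) * y ≈ 1#)
    1-0-invertible = 1# , trans (*-identityˡ _) 1-0≈1 , trans (*-identityʳ _) 1-0≈1
      where
      1-0≈1 : 1# - 0# ≈ 1#
      1-0≈1 = trans (+-congˡ (trans (sym (+-identityˡ (- 0#))) (-‿inverseʳ 0#)))
                    (+-identityʳ 1#)

    0<1 : 0# < 1#
    0<1 with #⇒<⊎> (invertible⇒# 1-0-invertible)
    ... | inj₂ 0<1 = 0<1
    ... | inj₁ 1<0 = contradiction (<.trans 0<1′ 1<0) (<.irrefl refl)
      where
      0<-1 : 0# < - 1#
      0<-1 = <.<-respˡ-≈ (-‿inverseˡ 1#)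
               (<.<-respʳ-≈ (+-identityʳ (- 1#)) (+-monoʳ-< (- 1#) 1<0))

      -1*-1≈1 : (- 1#) * (- 1#) ≈ 1#
      -1*-1≈1 = trans (sym (-‿distribˡ-* 1# (- 1#)))
                  (trans (-‿cong (*-identityˡ (- 1#))) (-‿involutive 1#))

      0<1′ : 0# < 1#
      0<1′ = <.<-respʳ-≈ -1*-1≈1 (*-pos 0<-1 0<-1)

    0<2 : 0# < fromℕ 2
    0<2 = <.trans 0<1
            (<.<-respˡ-≈ (+-identityʳ 1#)
              (+-monoʳ-< 1# (<.<-respʳ-≈ (sym (+-identityʳ 1#)) 0<1)))

  -- The inverse of 2 - 0.
  ½ : Carrier
  ½ = proj₁ (#⇒invertible (#-sym (<⇒# 0<2)))

  -- s = √x.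
  IsSqrt : Carrier → Carrier → Set (ℓ₁ ⊔ ℓ₃)
  IsSqrt x s = 0# ≤ s × s * s ≈ x

------------------------------------------------------------------------
-- Determinants

Matrix : ∀ {a} → Set a → ℕ → Set a
Matrix A n = Fin n → Fin n → A

module Determinant {c ℓ} (R : RawRing c ℓ) where
  open RawRing R
  open RawSemiringDefinitions rawSemiring using (sum; _^_)

  -- Laplace expansion along the first row.
  det : ∀ {n} → Matrix Carrier n → Carrier
  det {zero}  M = 1#
  det {suc n} M =
    sum λ j → (- 1#) ^ toℕ j * M zero j * det (λ i k → M (suc i) (punchIn j k))

------------------------------------------------------------------------
-- Polynomials and spectra of matrices

module Polynomial {c ℓ} (R : RawRing c ℓ) where
  open RawRing R

  -- Coefficients in increasing degree, possibly with trailing zeros;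
  -- equality of polynomials is therefore coefficientwise.
  Poly : Set c
  Poly = List Carrier

  coeff : Poly → ℕ → Carrier
  coeff []      _       = 0#
  coeff (a ∷ f) zero    = a
  coeff (a ∷ f) (suc k) = coeff f k

  infix  4 _≋_
  infixl 6 _⊕_
  infixl 7 _⊛_

  _≋_ : Rel Poly ℓ
  f ≋ g = ∀ k → coeff f k ≈ coeff g k

  _⊕_ : Poly → Poly → Poly
  []      ⊕ g       = g
  (a ∷ f) ⊕ []      = a ∷ f
  (a ∷ f) ⊕ (b ∷ g) = (a + b) ∷ (f ⊕ g)

  _⊛_ : Poly → Poly → Poly
  []      ⊛ g = []
  (a ∷ f) ⊛ g = map (a *_) g ⊕ (0# ∷ (f ⊛ g))

  ⊖_ : Poly → Poly
  ⊖_ = map (-_)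

  constant : Carrier → Poly
  constant a = a ∷ []

  X : Poly
  X = 0# ∷ 1# ∷ []

  polyRawRing : RawRing c ℓ
  polyRawRing = record
    { Carrier = Poly
    ; _≈_     = _≋_
    ; _+_     = _⊕_
    ; _*_     = _⊛_
    ; -_      = ⊖_
    ; 0#      = []
    ; 1#      = constant 1#
    }

  charPoly : ∀ {n} → Matrix Carrier n → Poly
  charPoly A =
    det λ i j → (if does (i Fin.≟ j) then X else []) ⊕ (⊖ constant (A i j))
    where open Determinant polyRawRing

  -- The list λs, up to order, is the multiset of eigenvalues of A with
  -- their algebraic multiplicities.
  IsSpectrum : ∀ {n} → Matrix Carrier n → List Carrier → Set ℓ
  IsSpectrum A λs =
    charPoly A ≋ foldr (λ μ f → (X ⊕ (⊖ constant μ)) ⊛ f) (constant 1#) λs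

------------------------------------------------------------------------
-- Finite undirected graphs, possibly with loops

record Graph ℓ : Set (lsuc ℓ) where
  field
    order   : ℕ
    Adj     : Rel (Fin order) ℓ
    adj?    : Decidable Adj
    adj-sym : Symmetric Adj

module _ {c ℓ₁ ℓ₂ ℓ₃ ℓ} (K : OrderedField c ℓ₁ ℓ₂ ℓ₃) (G : Graph ℓ) where
  open OrderedField K
  open Graph G

  adjacencyMatrix : Matrix Carrier order
  adjacencyMatrix i j = if does (adj? i j) then 1# else 0#

  IsGraphSpectrum : List Carrier → Set ℓ₁
  IsGraphSpectrum = Polynomial.IsSpectrum rawRing adjacencyMatrix

------------------------------------------------------------------------
-- Zero-divisor graphs of finite commutative rings

record FiniteCommutativeRing c ℓ : Set (lsuc (c ⊔ ℓ)) where
  field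
    commutativeRing : CommutativeRing c ℓ

  open CommutativeRing commutativeRing public

  field
    1≉0         : 1# ≉ 0#
    size        : ℕ
    enumeration : Inverse (≡.setoid (Fin size)) setoid

  open Inverse enumeration public
    using ()
    renaming ( to to element; from to index; from-cong to index-cong
             ; strictlyInverseˡ to element-index )

module ZeroDivisorGraph {c ℓ} (R : FiniteCommutativeRing c ℓ) where
  open FiniteCommutativeRing R

  IsNonzeroZeroDivisor : Carrier → Set (c ⊔ ℓ)
  IsNonzeroZeroDivisor x = x ≉ 0# × (∃[ y ] (y ≉ 0# × x * y ≈ 0#))

  infix 4 _≈?_
  _≈?_ : Decidable _≈_
  x ≈? y = map′
    (λ eq → trans (sym (element-index x))
              (trans (reflexive (≡.cong element eq)) (element-index y)))
    index-cong
    (index x Fin.≟ index y)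

  isNonzeroZeroDivisor? : ∀ x → Dec (IsNonzeroZeroDivisor x)
  isNonzeroZeroDivisor? x = ¬? (x ≈? 0#) ×-dec map′
    (λ (i , p) → element i , p)
    (λ (y , y≉0 , xy≈0) → index y
      , (λ eq → y≉0 (trans (sym (element-index y)) eq))
      , trans (*-congˡ (element-index y)) xy≈0)
    (Fin.any? λ i → ¬? (element i ≈? 0#) ×-dec (x * element i ≈? 0#))

  -- Each nonzero zero-divisor occurs exactly once up to _≈_.
  vertices : List Carrier
  vertices = filter isNonzeroZeroDivisor? (tabulate element)

  Γ : Graph ℓ
  Γ = record
    { order   = length vertices
    ; Adj     = λ i j → lookup vertices i * lookup vertices j ≈ 0#
    ; adj?    = λ i j → lookup vertices i * lookup vertices j ≈? 0#
    ; adj-sym = λ {i} {j} → trans (*-comm (lookup vertices j) (lookup vertices i))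
    }

open ZeroDivisorGraph public using (Γ)

------------------------------------------------------------------------
-- Integers modulo n, products, isomorphism

-- The carrier is ℤ, with congruence modulo n as equality.
module _ (n : ℕ) where
  open Data.Integer.Base using (+_; _+_; _*_; _-_; -_)
  open ℤ∣ using (_∣_)

  private
    infix 4 _≈_
    _≈_ : Rel ℤ 0ℓ
    x ≈ y = + n ∣ x - y

    reflexive : ∀ {x y} → x ≡ y → x ≈ y
    reflexive {x} ≡.refl = ℤ∣.divides 0ℤ (ℤₚ.+-inverseʳ x)

    sym : ∀ {x y} → x ≈ y → y ≈ x
    sym {x} {y} x≈y = subst (+ n ∣_) (eq x y) (ℤ∣.∣m⇒∣-m x≈y)
      where
      eq : ∀ x y → - (x - y) ≡ y - x
      eq = ℤSolver.solve-∀

    trans : ∀ {x y z} → x ≈ y → y ≈ z → x ≈ z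
    trans {x} {y} {z} x≈y y≈z = subst (+ n ∣_) (eq x y z) (ℤ∣.∣m∣n⇒∣m+n x≈y y≈z)
      where
      eq : ∀ x y z → (x - y) + (y - z) ≡ x - z
      eq = ℤSolver.solve-∀

    +-cong : ∀ {x y u v} → x ≈ y → u ≈ v → x + u ≈ y + v
    +-cong {x} {y} {u} {v} x≈y u≈v =
      subst (+ n ∣_) (eq x y u v) (ℤ∣.∣m∣n⇒∣m+n x≈y u≈v)
      where
      eq : ∀ x y u v → (x - y) + (u - v) ≡ (x + u) - (y + v)
      eq = ℤSolver.solve-∀

    *-cong : ∀ {x y u v} → x ≈ y → u ≈ v → x * u ≈ y * v
    *-cong {x} {y} {u} {v} x≈y u≈v =
      subst (+ n ∣_) (eq x y u v)
        (ℤ∣.∣m∣n⇒∣m+n (ℤ∣.∣n⇒∣m*n u x≈y) (ℤ∣.∣n⇒∣m*n y u≈v))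
      where
      eq : ∀ x y u v → u * (x - y) + y * (u - v) ≡ x * u - y * v
      eq = ℤSolver.solve-∀

    -‿cong : ∀ {x y} → x ≈ y → - x ≈ - y
    -‿cong {x} {y} x≈y = subst (+ n ∣_) (eq x y) (ℤ∣.∣m⇒∣-m x≈y)
      where
      eq : ∀ x y → - (x - y) ≡ - x - - y
      eq = ℤSolver.solve-∀

  ℤ/ : CommutativeRing 0ℓ 0ℓ
  ℤ/ = record
    { Carrier = ℤ
    ; _≈_     = _≈_
    ; _+_     = _+_
    ; _*_     = _*_
    ; -_      = -_
    ; 0#      = 0ℤ
    ; 1#      = 1ℤ
    ; isCommutativeRing = record
      { isRing = record
        { +-isAbelianGroup = record
          { isGroup = record
            { isMonoid = record
              { isSemigroup = record
                { isMagma = record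
                  { isEquivalence = record
                    { refl  = λ {x} → reflexive {x} ≡.refl
                    ; sym   = λ {x} {y} → sym {x} {y}
                    ; trans = λ {x} {y} {z} → trans {x} {y} {z}
                    }
                  ; ∙-cong = λ {x} {y} {u} {v} → +-cong {x} {y} {u} {v}
                  }
                ; assoc = λ x y z → reflexive (ℤₚ.+-assoc x y z)
                }
              ; identity = (λ x → reflexive (ℤₚ.+-identityˡ x))
                         , (λ x → reflexive (ℤₚ.+-identityʳ x))
              }
            ; inverse = (λ x → reflexive (ℤₚ.+-inverseˡ x))
                      , (λ x → reflexive (ℤₚ.+-inverseʳ x))
            ; ⁻¹-cong = λ {x} {y} → -‿cong {x} {y}
            }
          ; comm = λ x y → reflexive (ℤₚ.+-comm x y)
          }
        ; *-cong     = λ {x} {y} {u} {v} → *-cong {x} {y} {u} {v}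
        ; *-assoc    = λ x y z → reflexive (ℤₚ.*-assoc x y z)
        ; *-identity = (λ x → reflexive (ℤₚ.*-identityˡ x))
                     , (λ x → reflexive (ℤₚ.*-identityʳ x))
        ; distrib    = (λ x y z → reflexive (ℤₚ.*-distribˡ-+ x y z))
                     , (λ x y z → reflexive (ℤₚ.*-distribʳ-+ x y z))
        }
      ; *-comm = λ x y → reflexive (ℤₚ.*-comm x y)
      }
    }

infixr 2 _×ᴿ_
_×ᴿ_ : ∀ {a b ℓ₁ ℓ₂} → CommutativeRing a ℓ₁ → CommutativeRing b ℓ₂ →
       CommutativeRing (a ⊔ b) (ℓ₁ ⊔ ℓ₂)
_×ᴿ_ = DirectProduct.commutativeRing

infix 1 _≅_
_≅_ : ∀ {a b ℓ₁ ℓ₂} → CommutativeRing a ℓ₁ → CommutativeRing b ℓ₂ →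
      Set (a ⊔ b ⊔ ℓ₁ ⊔ ℓ₂)
R ≅ S = Σ[ f ∈ (R.Carrier → S.Carrier) ] IsRingIsomorphism f
  where
  module R = CommutativeRing R
  module S = CommutativeRing S
  open RingMorphisms R.rawRing S.rawRing using (IsRingIsomorphism)

{-# OPTIONS --safe #-}

-- Under R ≅ ℤₚ⁴ a nonzero zero-divisor x is determined up to adjacency by its support T, a
-- proper nonempty subset of {1,2,3,4}: x and y are adjacent iff their supports are disjoint,
-- and (p-1)^|T| elements have support T.  So the adjacency matrix factors as U V through a
-- space of dimension 14, and Sylvester's identity x¹⁴ det(x - U V) = xⁿ det(x - V U) leaves a
-- 14 × 14 determinant.  The factorisation is chosen along the decomposition of the functions
-- on the 14 supports under the symmetric group S₄, so that V U is block triangular with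
-- blocks of size 1, 1, 3, 3, 3, 3, whose characteristic polynomials factor explicitly.

module Submission where

open import Level using (Level; 0ℓ; _⊔_)
open import Algebra.Bundles using (CommutativeMonoid; CommutativeRing; RawMonoid; RawRing)
open import Algebra.Morphism.Structures using (module RingMorphisms)
import Algebra.Properties.CommutativeMonoid.Mult as MonoidMult
import Algebra.Properties.CommutativeMonoid.Sum as MonoidSum
import Algebra.Properties.Ring as RingProperties
import Algebra.Properties.Semiring.Exp as SemiringExp
import Algebra.Properties.Semiring.Mult as SemiringMult
import Algebra.Properties.Semiring.Mult.TCOptimised as SemiringMultTCOptimised
import Algebra.Properties.Semiring.Sum as SemiringSum
import Algebra.Solver.Ring as RingSolver
open import Algebra.Solver.Ring.AlmostCommutativeRing using (fromCommutativeRing; _-Raw-AlmostCommutative⟶_)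
open import Data.Bool.Base as Bool using (Bool; true; false; if_then_else_; not; _∧_)
import Data.Bool.Properties as Boolₚ
open import Data.Fin.Base as Fin using (Fin; zero; suc; toℕ; inject₁; punchIn; punchOut; fromℕ<; _↑ˡ_; _↑ʳ_; splitAt; combine; finToFun; funToFin)
open import Data.Fin.Induction using (<-weakInduction)
open import Data.Fin.Patterns using (0F; 1F; 2F; 3F)
open import Data.Fin.Permutation using (Permutation; permutation)
import Data.Fin.Properties as Finₚ
open import Data.Fin.Subset using (Subset; ∣_∣; ∁)
import Data.Fin.Subset.Properties as Subsetₚ
open import Data.Integer.Base as ℤ using (ℤ; +_; -[1+_])
open import Data.Integer.DivMod using (_%ℕ_; _/ℕ_; n%ℕd<d; a≡a%ℕn+[a/ℕn]*n)
import Data.Integer.Divisibility.Signed as ℤ∣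
import Data.Integer.Properties as ℤₚ
open import Data.List.Base as List using (List; []; _∷_; filter; foldr; replicate; _++_)
open import Data.List.Membership.Propositional.Properties using (∈-lookup)
import Data.List.Relation.Unary.All as All
open import Data.List.Relation.Unary.All.Properties using (all-filter)
open import Data.Maybe.Base using (Maybe; just; nothing)
open import Data.Nat.Base as ℕ using (ℕ; zero; suc; _≡ᵇ_)
import Data.Nat.Divisibility as ℕ∣
open import Data.Nat.Primality using (Prime; euclidsLemma; ¬prime[0]; ¬prime[1])
import Data.Nat.Properties as ℕₚ
open import Data.Nat.Solver using (module +-*-Solver)
open import Data.Product.Base using (∃; ∃₂; _×_; _,_; proj₁; proj₂)
open import Data.Sum.Base as Sum using (_⊎_; inj₁; inj₂; [_,_]′)
open import Data.Vec.Base as Vec using (Vec; []; _∷_; tabulate; lookup)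
open import Data.Vec.Functional using (updateAt; insertAt) renaming (_++_ to _⧺_)
open import Data.Vec.Functional.Properties using (updateAt-updates; updateAt-minimal; insertAt-lookup; insertAt-punchIn; lookup-++ˡ; lookup-++ʳ)
import Data.Vec.Properties as Vecₚ
import Function.Bundles
open import Function.Base using (_∘_; const; flip; id)
open import Relation.Binary.Definitions using (tri<; tri≈; tri>)
open import Relation.Binary.PropositionalEquality as ≡ using (_≡_; _≢_; _≗_)
import Relation.Binary.Reasoning.Setoid as SetoidReasoning
open import Relation.Nullary.Decidable using (Dec; yes; no; does; dec-true; dec-false; from-yes; map′; _×-dec_; _→-dec_)
open import Relation.Nullary.Negation using (contradiction)
open import Relation.Unary using (Pred; Decidable)
open import Defs

-- All determinants live in a commutative ring, at the end the polynomials over `K`: Sylvester's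
-- identity needs no division and `X` is cancelled by shifting coefficients, so the argument works
-- with undecidable equality. Expansion along the first row gives linearity and alternation in the
-- columns only. Rows are reached by characterising `det` among alternating functions, which yields
-- transposition and the product rule alike. The identities between the basis and its dual are
-- decided by evaluation in ℤ, so denominators must be controlled. Splitting the functions on pairs
-- into irreducibles outright would divide by 3. A complement of the trivial part that is invariant
-- only modulo that part costs two off-diagonal entries of `action`, but leaves 8 as the only
-- denominator, and ½ suffices. Hence triangular and not diagonal. The number of elements with
-- support T depends on |T| alone, and every basis function lives on one cardinality. So p enters
-- only as a weight of the columns, and a single integer matrix serves all p.

module IntegerCoefficients {c ℓ : Level} (S : CommutativeRing c ℓ) where
  open CommutativeRing S
  open RingProperties ring
  open SemiringMultTCOptimised semiring renaming (_×_ to _×ₘ_)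
  open SetoidReasoning setoid

  -- The multiple n ×ₘ 1# without trailing zero makes ι 1 reduce to 1#.
  ι : ℤ → Carrier
  ι (+ n)    = n ×ₘ 1#
  ι -[1+ n ] = - (suc n ×ₘ 1#)

  -0≈0 : - 0# ≈ 0#
  -0≈0 = trans (sym (+-identityˡ (- 0#))) (-‿inverseʳ 0#)

  ι-⊖ : ∀ m n → ι (m ℤ.⊖ n) ≈ m ×ₘ 1# - n ×ₘ 1#
  ι-⊖ m       zero    = begin
    ι (m ℤ.⊖ 0)      ≡⟨ ≡.cong ι (ℤₚ.⊖-≥ {m} {0} ℕ.z≤n) ⟩
    m ×ₘ 1#           ≈⟨ +-identityʳ _ ⟨
    m ×ₘ 1# + 0#      ≈⟨ +-congˡ -0≈0 ⟨
    m ×ₘ 1# - 0#      ∎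
  ι-⊖ zero    (suc n) = sym (+-identityˡ _)
  ι-⊖ (suc m) (suc n) = begin
    ι (suc m ℤ.⊖ suc n)                  ≡⟨ ≡.cong ι (ℤₚ.[1+m]⊖[1+n]≡m⊖n m n) ⟩
    ι (m ℤ.⊖ n)                          ≈⟨ ι-⊖ m n ⟩
    x - y                                ≈⟨ +-congʳ (+-identityʳ x) ⟨
    x + 0# - y                           ≈⟨ +-congʳ (+-congˡ (-‿inverseʳ 1#)) ⟨
    x + (1# - 1#) - y                    ≈⟨ +-congʳ (+-assoc x 1# (- 1#)) ⟨
    x + 1# - 1# - y                      ≈⟨ +-congʳ (+-congʳ (+-comm x 1#)) ⟩
    1# + x - 1# - y                      ≈⟨ +-assoc (1# + x) (- 1#) (- y) ⟩
    1# + x + (- 1# - y)                  ≈⟨ +-congˡ (-‿+-comm 1# y) ⟩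
    1# + x - (1# + y)                    ≈⟨ +-cong (1+× m 1#) (-‿cong (1+× n 1#)) ⟨
    suc m ×ₘ 1# - suc n ×ₘ 1#              ∎
    where
    x = m ×ₘ 1#
    y = n ×ₘ 1#

  ι-neg : ∀ i → ι (ℤ.- i) ≈ - ι i
  ι-neg (+ zero)   = sym -0≈0
  ι-neg (+ suc n)  = refl
  ι-neg -[1+ n ]   = sym (-‿involutive _)

  ι-+ : ∀ i j → ι (i ℤ.+ j) ≈ ι i + ι j
  ι-+ (+ m)    (+ n)    = ×-homo-+ 1# m n
  ι-+ (+ m)    -[1+ n ] = ι-⊖ m (suc n)
  ι-+ -[1+ m ] (+ n)    = trans (ι-⊖ n (suc m)) (+-comm _ _)
  ι-+ -[1+ m ] -[1+ n ] = begin
    - (suc (suc (m ℕ.+ n)) ×ₘ 1#)         ≡⟨ ≡.cong (λ k → - (suc k ×ₘ 1#)) (≡.sym (ℕₚ.+-suc m n)) ⟩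
    - ((suc m ℕ.+ suc n) ×ₘ 1#)           ≈⟨ -‿cong (×-homo-+ 1# (suc m) (suc n)) ⟩
    - (suc m ×ₘ 1# + suc n ×ₘ 1#)          ≈⟨ -‿+-comm _ _ ⟨
    - (suc m ×ₘ 1#) - suc n ×ₘ 1#          ∎

  ι-*⁺ : ∀ m n → ι (+ m ℤ.* + n) ≈ ι (+ m) * ι (+ n)
  ι-*⁺ m n = trans (reflexive (≡.cong ι (≡.sym (ℤₚ.pos-* m n)))) (×1-homo-* m n)

  ι-* : ∀ i j → ι (i ℤ.* j) ≈ ι i * ι j
  ι-* (+ m)    (+ n)    = ι-*⁺ m n
  ι-* (+ m)    -[1+ n ] = begin
    ι (+ m ℤ.* -[1+ n ])         ≡⟨ ≡.cong ι (ℤₚ.neg-distribʳ-* (+ m) (+ suc n)) ⟨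
    ι (ℤ.- (+ m ℤ.* + suc n))    ≈⟨ ι-neg (+ m ℤ.* + suc n) ⟩
    - ι (+ m ℤ.* + suc n)        ≈⟨ -‿cong (ι-*⁺ m (suc n)) ⟩
    - (ι (+ m) * ι (+ suc n))    ≈⟨ -‿distribʳ-* _ _ ⟩
    ι (+ m) * ι -[1+ n ]         ∎
  ι-* -[1+ m ] j@(+ n)  = begin
    ι (-[1+ m ] ℤ.* j)           ≡⟨ ≡.cong ι (ℤₚ.neg-distribˡ-* (+ suc m) j) ⟨
    ι (ℤ.- (+ suc m ℤ.* j))      ≈⟨ ι-neg (+ suc m ℤ.* j) ⟩
    - ι (+ suc m ℤ.* j)          ≈⟨ -‿cong (ι-*⁺ (suc m) n) ⟩
    - (ι (+ suc m) * ι j)        ≈⟨ -‿distribˡ-* _ _ ⟩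
    ι -[1+ m ] * ι j             ∎
  ι-* -[1+ m ] -[1+ n ] = begin
    ι (+ suc m ℤ.* + suc n)          ≈⟨ ι-*⁺ (suc m) (suc n) ⟩
    ι (+ suc m) * ι (+ suc n)        ≈⟨ -‿involutive _ ⟨
    - - (ι (+ suc m) * ι (+ suc n))  ≈⟨ -‿cong (-‿distribˡ-* _ _) ⟩
    - (ι -[1+ m ] * ι (+ suc n))     ≈⟨ -‿distribʳ-* _ _ ⟩
    ι -[1+ m ] * ι -[1+ n ]          ∎

  homomorphism : CommutativeRing.rawRing ℤₚ.+-*-commutativeRing -Raw-AlmostCommutative⟶ fromCommutativeRing S
  homomorphism = record
    { ⟦_⟧    = ι
    ; +-homo = ι-+
    ; *-homo = ι-*
    ; -‿homo = ι-neg
    ; 0-homo = refl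
    ; 1-homo = refl
    }

  ι-≟ : ∀ i j → Maybe (ι i ≈ ι j)
  ι-≟ i j with i ℤₚ.≟ j
  ... | yes i≡j = just (reflexive (≡.cong ι i≡j))
  ... | no  _   = nothing

  -- Integer coefficients let the solver cancel opposite terms and read numerals in an arbitrary
  -- commutative ring: two coefficients count as equal when they are the same integer, so no
  -- decision procedure on `Carrier` is involved.
  module Solver = RingSolver
    (CommutativeRing.rawRing ℤₚ.+-*-commutativeRing)
    (fromCommutativeRing S)
    homomorphism
    ι-≟

-- Splitting finite sums.

module FiniteSums {c ℓ : Level} (M : CommutativeMonoid c ℓ) where
  open CommutativeMonoid M renaming (_∙_ to _+_; ∙-congˡ to +-congˡ; assoc to +-assoc; identityˡ to +-identityˡ)
  open MonoidSum M using (sum; sum-syntax)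

  ∑-++ : ∀ m {n} (f : Fin (m ℕ.+ n) → Carrier) → sum f ≈ ∑[ i < m ] f (i ↑ˡ n) + ∑[ j < n ] f (m ↑ʳ j)
  ∑-++ zero    f = sym (+-identityˡ _)
  ∑-++ (suc m) f = trans (+-congˡ (∑-++ m (f ∘ suc))) (sym (+-assoc _ _ _))

  ∑-combine : ∀ m {n} (f : Fin (m ℕ.* n) → Carrier) → sum f ≈ ∑[ i < m ] ∑[ j < n ] f (combine i j)
  ∑-combine zero        f = refl
  ∑-combine (suc m) {n} f = trans (∑-++ n f) (+-congˡ (∑-combine m (f ∘ (n ↑ʳ_))))

-- Determinants

-- The inductive form follows the recursion of `punchIn`, so that statements about deleted columns
-- go by cases instead of by arithmetic on `toℕ`.
data Adjacent : ∀ {n} → Fin n → Fin n → Set where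
  here  : ∀ {n} → Adjacent {suc (suc n)} zero (suc zero)
  there : ∀ {n} {i j : Fin n} → Adjacent i j → Adjacent (suc i) (suc j)

adjacent-inject₁ : ∀ {n} (i : Fin n) → Adjacent (inject₁ i) (suc i)
adjacent-inject₁ zero    = here
adjacent-inject₁ (suc i) = there (adjacent-inject₁ i)

adjacent⇒≢ : ∀ {n} {i j : Fin n} → Adjacent i j → i ≢ j
adjacent⇒≢ (there a) i≡j = adjacent⇒≢ a (Finₚ.suc-injective i≡j)

toℕ-adjacent : ∀ {n} {i j : Fin n} → Adjacent i j → toℕ j ≡ suc (toℕ i)
toℕ-adjacent here    = ≡.refl
toℕ-adjacent (there a) = ≡.cong suc (toℕ-adjacent a)

-- Deleting one or the other of two neighbours leaves the same list of positions, except at the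
-- place where the survivor of the two stands.
punchIn-adjacent : ∀ {n} {i j : Fin (suc n)} → Adjacent i j → ∀ k →
                   punchIn i k ≡ punchIn j k ⊎ (punchIn i k ≡ j × punchIn j k ≡ i)
punchIn-adjacent here    zero    = inj₂ (≡.refl , ≡.refl)
punchIn-adjacent here    (suc k) = inj₁ ≡.refl
punchIn-adjacent (there a) zero    = inj₁ ≡.refl
punchIn-adjacent (there a) (suc k) with punchIn-adjacent a k
... | inj₁ eq        = inj₁ (≡.cong suc eq)
... | inj₂ (eq , eq′) = inj₂ (≡.cong suc eq , ≡.cong suc eq′)

-- Two neighbouring columns stay neighbours in the minor that deletes a third one, which is what an
-- induction on the size needs.
adjacent-punchIn⁻ : ∀ {n} {i j : Fin (suc n)} → Adjacent i j → ∀ k → k ≢ i → k ≢ j →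
                    ∃₂ λ i′ j′ → Adjacent i′ j′ × punchIn k i′ ≡ i × punchIn k j′ ≡ j
adjacent-punchIn⁻ here    zero          k≢i k≢j = contradiction ≡.refl k≢i
adjacent-punchIn⁻ here    (suc zero)    k≢i k≢j = contradiction ≡.refl k≢j
adjacent-punchIn⁻ {suc (suc n)} here (suc (suc k)) k≢i k≢j = zero , suc zero , here , ≡.refl , ≡.refl
adjacent-punchIn⁻ (there a) zero          k≢i k≢j = _ , _ , a , ≡.refl , ≡.refl
adjacent-punchIn⁻ {suc n} (there a) (suc k) k≢i k≢j
  with i′ , j′ , a′ , eq , eq′ ← adjacent-punchIn⁻ a k (k≢i ∘ ≡.cong suc) (k≢j ∘ ≡.cong suc)
  = suc i′ , suc j′ , there a′ , ≡.cong suc eq , ≡.cong suc eq′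

module DeterminantProperties {c ℓ : Level} (S : CommutativeRing c ℓ) where
  open CommutativeRing S hiding (zero)
  open Determinant rawRing public using (det)
  open IntegerCoefficients S using (ι; module Solver)
  open Solver using (solve; _:=_; _:+_; _:*_; :-_; con)
  open RingProperties ring
  open SemiringExp semiring public using (_^_)
  open SemiringSum semiring public
  open SetoidReasoning setoid


  1ₘ : ∀ {n} → Matrix Carrier n
  1ₘ i j = if does (i Finₚ.≟ j) then 1# else 0#

  1ₘ-diagonal : ∀ {n} (i : Fin n) → 1ₘ i i ≡ 1#
  1ₘ-diagonal i = ≡.cong (if_then 1# else 0#) (dec-true (i Finₚ.≟ i) ≡.refl)

  1ₘ-off-diagonal : ∀ {n} {i j : Fin n} → i ≢ j → 1ₘ i j ≡ 0#
  1ₘ-off-diagonal {i = i} {j} i≢j = ≡.cong (if_then 1# else 0#) (dec-false (i Finₚ.≟ j) i≢j)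

  1ₘ-sym : ∀ {n} (i j : Fin n) → 1ₘ i j ≡ 1ₘ j i
  1ₘ-sym i j with i Finₚ.≟ j
  ... | yes ≡.refl = ≡.sym (1ₘ-diagonal i)
  ... | no  i≢j    = ≡.sym (1ₘ-off-diagonal (i≢j ∘ ≡.sym))

  1ₘ-injective : ∀ {m n} {f : Fin m → Fin n} → (∀ {i j} → f i ≡ f j → i ≡ j) → ∀ i j → 1ₘ (f i) (f j) ≡ 1ₘ i j
  1ₘ-injective {f = f} inj i j with i Finₚ.≟ j
  ... | yes ≡.refl = 1ₘ-diagonal (f i)
  ... | no  i≢j    = 1ₘ-off-diagonal (i≢j ∘ inj)

  1ₘ-punchIn : ∀ {n} (k : Fin (suc n)) (i j : Fin n) → 1ₘ (punchIn k i) (punchIn k j) ≡ 1ₘ i j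
  1ₘ-punchIn k = 1ₘ-injective (Finₚ.punchIn-injective k _ _)

  ∑-zero : ∀ {n} {f : Fin n → Carrier} → (∀ i → f i ≈ 0#) → sum f ≈ 0#
  ∑-zero {n} f≈0 = trans (sum-cong-≋ f≈0) (sum-replicate-zero n)

  ∑-1ₘ : ∀ {n} (i : Fin n) (f : Fin n → Carrier) → ∑[ j < n ] (1ₘ i j * f j) ≈ f i
  ∑-1ₘ {suc n} zero f = begin
    1# * f zero + ∑[ j < n ] (0# * f (suc j))  ≈⟨ +-cong (*-identityˡ _) (∑-zero λ j → zeroˡ (f (suc j))) ⟩
    f zero + 0#                                ≈⟨ +-identityʳ _ ⟩
    f zero                                     ∎
  ∑-1ₘ {suc n} (suc i) f = begin
    0# * f zero + ∑[ j < n ] (1ₘ (suc i) (suc j) * f (suc j))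
      ≈⟨ +-cong (zeroˡ _) (sum-cong-≋ λ j → *-congʳ (reflexive (1ₘ-punchIn zero i j))) ⟩
    0# + ∑[ j < n ] (1ₘ i j * f (suc j))       ≈⟨ +-identityˡ _ ⟩
    ∑[ j < n ] (1ₘ i j * f (suc j))            ≈⟨ ∑-1ₘ i (f ∘ suc) ⟩
    f (suc i)                                  ∎

  ∑-adjacent : ∀ {n} {i j : Fin n} → Adjacent i j → (f : Fin n → Carrier) →
               (∀ k → k ≢ i → k ≢ j → f k ≈ 0#) → f i + f j ≈ 0# → sum f ≈ 0#
  ∑-adjacent here f f≈0 eq = begin
    f zero + (f (suc zero) + sum (λ k → f (suc (suc k))))  ≈⟨ +-assoc _ _ _ ⟨
    f zero + f (suc zero) + sum (λ k → f (suc (suc k)))    ≈⟨ +-cong eq (∑-zero λ k → f≈0 (suc (suc k)) (λ ()) (λ ())) ⟩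
    0# + 0#                                        ≈⟨ +-identityʳ 0# ⟩
    0#                                             ∎
  ∑-adjacent (there a) f f≈0 eq = begin
    f zero + sum (f ∘ suc)  ≈⟨ +-cong (f≈0 zero (λ ()) (λ ()))
                                 (∑-adjacent a (f ∘ suc)
                                   (λ k k≢i k≢j → f≈0 (suc k) (k≢i ∘ Finₚ.suc-injective) (k≢j ∘ Finₚ.suc-injective))
                                   eq) ⟩
    0# + 0#                 ≈⟨ +-identityʳ 0# ⟩
    0#                      ∎


  minor : ∀ {n} → Matrix Carrier (suc n) → Fin (suc n) → Matrix Carrier n
  minor M j i k = M (suc i) (punchIn j k)

  sign : ∀ {n} → Fin n → Carrier
  sign j = (- 1#) ^ toℕ j

  det-cong : ∀ {n} {M N : Matrix Carrier n} → (∀ i j → M i j ≈ N i j) → det M ≈ det N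
  det-cong {zero}  M≈N = refl
  det-cong {suc n} M≈N = sum-cong-≋ λ j →
    *-cong (*-congˡ {sign j} (M≈N zero j)) (det-cong λ i k → M≈N (suc i) (punchIn j k))

  -- In the term that deletes column `j` the entry of the first row is linear and the three minors
  -- agree. In any other term the entries agree and the minor is linear by induction, its column
  -- `punchOut k≢j` being the old column `j`.
  det-columnLinear : ∀ {n} j {x} {M A B : Matrix Carrier n} →
    (∀ i → M i j ≈ A i j + x * B i j) →
    (∀ k → k ≢ j → ∀ i → M i k ≈ A i k) →
    (∀ k → k ≢ j → ∀ i → M i k ≈ B i k) →
    det M ≈ det A + x * det B
  det-columnLinear {suc n} j {x} {M} {A} {B} M≈A+xB M≈A M≈B = begin
    ∑[ k < suc n ] term M k                                 ≈⟨ sum-cong-≋ termwise ⟩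
    ∑[ k < suc n ] (term A k + x * term B k)                ≈⟨ ∑-distrib-+ (term A) (λ k → x * term B k) ⟩
    det A + ∑[ k < suc n ] (x * term B k)                   ≈⟨ +-congˡ (*-distribˡ-sum x (term B)) ⟨
    det A + x * det B                                       ∎
    where
    term : Matrix Carrier (suc n) → Fin (suc n) → Carrier
    term N k = sign k * N zero k * det (minor N k)

    termwise : ∀ k → term M k ≈ term A k + x * term B k
    termwise k with k Finₚ.≟ j
    ... | yes ≡.refl = begin
      s * M zero k * det (minor M k)
        ≈⟨ *-congʳ (*-congˡ (M≈A+xB zero)) ⟩
      s * (a + x * b) * det (minor M k)
        ≈⟨ solve 5 (λ s a x b d → s :* (a :+ x :* b) :* d := s :* a :* d :+ x :* (s :* b :* d)) refl s a x b _ ⟩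
      s * a * det (minor M k) + x * (s * b * det (minor M k))
        ≈⟨ +-cong (*-congˡ (det-cong λ i l → M≈A _ (Finₚ.punchInᵢ≢i k l) (suc i)))
             (*-congˡ (*-congˡ (det-cong λ i l → M≈B _ (Finₚ.punchInᵢ≢i k l) (suc i)))) ⟩
      term A k + x * term B k ∎
      where
      s = sign k
      a = A zero k
      b = B zero k
    ... | no k≢j = begin
      s * M zero k * det (minor M k)
        ≈⟨ *-congˡ (det-columnLinear (punchOut k≢j)
             (λ i → at-j (λ l → M (suc i) l ≈ A (suc i) l + x * B (suc i) l) (M≈A+xB (suc i)))
             (λ l l≢j i → M≈A _ (off-j l≢j) (suc i))
             (λ l l≢j i → M≈B _ (off-j l≢j) (suc i))) ⟩
      s * M zero k * (det (minor A k) + x * det (minor B k))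
        ≈⟨ solve 5 (λ s m x a b → s :* m :* (a :+ x :* b) := s :* m :* a :+ x :* (s :* m :* b)) refl s _ x _ _ ⟩
      s * M zero k * det (minor A k) + x * (s * M zero k * det (minor B k))
        ≈⟨ +-cong (*-congʳ (*-congˡ (M≈A k k≢j zero))) (*-congˡ (*-congʳ (*-congˡ (M≈B k k≢j zero)))) ⟩
      term A k + x * term B k ∎
      where
      s = sign k
      at-j : ∀ {p} (P : Fin (suc n) → Set p) → P j → P (punchIn k (punchOut k≢j))
      at-j P = ≡.subst P (≡.sym (Finₚ.punchIn-punchOut k≢j))
      off-j : ∀ {l} → l ≢ punchOut k≢j → punchIn k l ≢ j
      off-j {l} l≢ eq = l≢ (Finₚ.punchIn-injective k l _ (≡.trans eq (≡.sym (Finₚ.punchIn-punchOut k≢j))))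

  sign-adjacent : ∀ {n} {i j : Fin n} → Adjacent i j → sign j ≈ - sign i
  sign-adjacent {i = i} {j} a = begin
    sign j           ≡⟨ ≡.cong ((- 1#) ^_) (toℕ-adjacent a) ⟩
    - 1# * sign i    ≈⟨ -1*x≈-x _ ⟩
    - sign i         ∎

  -- Terms that delete a third column vanish by induction. The two remaining terms have equal
  -- entries, equal minors and opposite signs.
  det-equalAdjacentColumns : ∀ {n} {j k : Fin n} {M : Matrix Carrier n} → Adjacent j k →
                             (∀ i → M i j ≈ M i k) → det M ≈ 0#
  det-equalAdjacentColumns {suc n} {j} {k} {M} a Mj≈Mk = ∑-adjacent a _
    (λ l l≢j l≢k → let _ , _ , a′ , eq , eq′ = adjacent-punchIn⁻ a l l≢j l≢k in
      trans (*-congˡ (det-equalAdjacentColumns a′ λ i →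
              trans (reflexive (≡.cong (M (suc i)) eq))
                (trans (Mj≈Mk (suc i)) (reflexive (≡.cong (M (suc i)) (≡.sym eq′))))))
            (zeroʳ _))
    (begin
      sign j * M zero j * det (minor M j) + sign k * M zero k * det (minor M k)
        ≈⟨ +-congˡ (*-cong (*-cong (sign-adjacent a) (sym (Mj≈Mk zero))) (det-cong minors)) ⟩
      sign j * M zero j * det (minor M j) + - sign j * M zero j * det (minor M j)
        ≈⟨ solve 3 (λ s m d → s :* m :* d :+ :- s :* m :* d := con (+ 0)) refl (sign j) (M zero j) _ ⟩
      0# ∎)
    where
    minors : ∀ i l → minor M k i l ≈ minor M j i l
    minors i l with punchIn-adjacent a l
    ... | inj₁ eq         = reflexive (≡.cong (M (suc i)) (≡.sym eq))
    ... | inj₂ (eq , eq′) = trans (reflexive (≡.cong (M (suc i)) eq′))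
                              (trans (Mj≈Mk (suc i)) (reflexive (≡.cong (M (suc i)) (≡.sym eq))))

-- Alternating multilinear functions of the rows.

module AlternatingMaps {c ℓ : Level} (S : CommutativeRing c ℓ) where
  open CommutativeRing S hiding (zero)
  open DeterminantProperties S
  open IntegerCoefficients S using (ι; module Solver)
  open Solver using (solve; _:=_; _:+_; _:*_; :-_; con)
  open RingProperties ring
  open SetoidReasoning setoid

  -- One axiom covers additivity and homogeneity. The three matrices are related by hypotheses on
  -- their rows instead of being updates of one matrix, so that each use can present them as it
  -- likes.
  record IsMultilinear {n} (f : Matrix Carrier n → Carrier) : Set (c ⊔ ℓ) where
    field
      cong   : ∀ {M N} → (∀ i j → M i j ≈ N i j) → f M ≈ f N
      linear : ∀ i {x M A B} →
               (∀ j → M i j ≈ A i j + x * B i j) →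
               (∀ k → k ≢ i → ∀ j → M k j ≈ A k j) →
               (∀ k → k ≢ i → ∀ j → M k j ≈ B k j) →
               f M ≈ f A + x * f B

    additive : ∀ i {M A B} →
               (∀ j → M i j ≈ A i j + B i j) →
               (∀ k → k ≢ i → ∀ j → M k j ≈ A k j) →
               (∀ k → k ≢ i → ∀ j → M k j ≈ B k j) →
               f M ≈ f A + f B
    additive i M≈A+B M≈A M≈B =
      trans (linear i (λ j → trans (M≈A+B j) (+-congˡ (sym (*-identityˡ _)))) M≈A M≈B)
            (+-congˡ (*-identityˡ _))

    -- A zero row equals itself plus -1 times itself, so linearity gives `f M ≈ f M + - 1# * f M`.
    zero-row : ∀ i {M} → (∀ j → M i j ≈ 0#) → f M ≈ 0#
    zero-row i {M} Mi≈0 = begin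
      f M                  ≈⟨ linear i {x = - 1#} {A = M} {B = M}
                               (λ j → trans (Mi≈0 j) (sym (cancel _))) (λ _ _ _ → refl) (λ _ _ _ → refl) ⟩
      f M + - 1# * f M     ≈⟨ cancel _ ⟩
      0#                   ∎
      where
      cancel : ∀ y → y + - 1# * y ≈ 0#
      cancel y = trans (+-congˡ (-1*x≈-x y)) (-‿inverseʳ y)

    linear-∑ : ∀ i {m} (x : Fin m → Carrier) (A : Fin m → Matrix Carrier n) {M} →
               (∀ j → M i j ≈ ∑[ l < m ] (x l * A l i j)) →
               (∀ l k → k ≢ i → ∀ j → M k j ≈ A l k j) →
               f M ≈ ∑[ l < m ] (x l * f (A l))
    linear-∑ i {zero}  x A Mi≈∑ M≈A = zero-row i Mi≈∑
    linear-∑ i {suc m} x A {M} Mi≈∑ M≈A = begin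
      f M
        ≈⟨ linear i {A = M′} {B = A zero}
             (λ j → trans (Mi≈∑ j) (trans (+-comm _ _) (+-congʳ (sym (at-i j)))))
             (λ k k≢i j → sym (off-i k k≢i j)) (M≈A zero) ⟩
      f M′ + x zero * f (A zero)
        ≈⟨ +-congʳ (linear-∑ i (x ∘ suc) (A ∘ suc) at-i
             (λ l k k≢i j → trans (off-i k k≢i j) (M≈A (suc l) k k≢i j))) ⟩
      ∑[ l < m ] (x (suc l) * f (A (suc l))) + x zero * f (A zero)
        ≈⟨ +-comm _ _ ⟩
      ∑[ l < suc m ] (x l * f (A l)) ∎
      where
      row : Fin n → Carrier
      row j = ∑[ l < m ] (x (suc l) * A (suc l) i j)
      M′ : Matrix Carrier n
      M′ = updateAt M i (const row)
      at-i : ∀ j → M′ i j ≈ row j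
      at-i j = reflexive (≡.cong-app (updateAt-updates i M) j)
      off-i : ∀ k → k ≢ i → ∀ j → M′ k j ≈ M k j
      off-i k k≢i j = reflexive (≡.cong-app (updateAt-minimal k i M k≢i) j)

    -- Expand f(…,u+v,…,u+v,…) ≈ 0.
    swap-rows : ∀ {i j} → i ≢ j → (∀ {M} → (∀ k → M i k ≈ M j k) → f M ≈ 0#) →
                ∀ {M N} → (∀ l → N i l ≈ M j l) → (∀ l → N j l ≈ M i l) →
                (∀ k → k ≢ i → k ≢ j → ∀ l → N k l ≈ M k l) → f N ≈ - f M
    swap-rows {i} {j} i≢j f≈0 {M} {N} Ni≈Mj Nj≈Mi N≈M = begin
      f N                                ≈⟨ cong (agree N Ni≈Mj Nj≈Mi N≈M) ⟩
      f (W v u)                          ≈⟨ solve 2 (λ a b → b := (a :+ b) :+ :- a) refl (f (W u v)) _ ⟩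
      f (W u v) + f (W v u) - f (W u v)  ≈⟨ +-congʳ expand ⟩
      0# - f (W u v)                     ≈⟨ +-identityˡ _ ⟩
      - f (W u v)                        ≈⟨ -‿cong (cong (agree M (λ _ → refl) (λ _ → refl) (λ _ _ _ _ → refl))) ⟨
      - f M                              ∎
      where
      u v : Fin n → Carrier
      u = M i
      v = M j

      W : (r s : Fin n → Carrier) → Matrix Carrier n
      W r s = updateAt (updateAt M j (const s)) i (const r)

      W-i : ∀ r s l → W r s i l ≈ r l
      W-i r s l = reflexive (≡.cong-app (updateAt-updates i (updateAt M j (const s))) l)

      W-off-i : ∀ r s k → k ≢ i → ∀ l → W r s k l ≈ updateAt M j (const s) k l
      W-off-i r s k k≢i l = reflexive (≡.cong-app (updateAt-minimal k i (updateAt M j (const s)) k≢i) l)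

      W-j : ∀ r s l → W r s j l ≈ s l
      W-j r s l = trans (W-off-i r s j (i≢j ∘ ≡.sym) l) (reflexive (≡.cong-app (updateAt-updates j M) l))

      W-off : ∀ r s k → k ≢ i → k ≢ j → ∀ l → W r s k l ≈ M k l
      W-off r s k k≢i k≢j l = trans (W-off-i r s k k≢i l) (reflexive (≡.cong-app (updateAt-minimal k j M k≢j) l))

      agree : ∀ A {r s} → (∀ l → A i l ≈ r l) → (∀ l → A j l ≈ s l) →
              (∀ k → k ≢ i → k ≢ j → ∀ l → A k l ≈ M k l) → ∀ k l → A k l ≈ W r s k l
      agree A {r} {s} Ai≈r Aj≈s A≈M k l with k Finₚ.≟ i | k Finₚ.≟ j
      ... | yes ≡.refl | _          = trans (Ai≈r l) (sym (W-i r s l))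
      ... | no _       | yes ≡.refl = trans (Aj≈s l) (sym (W-j r s l))
      ... | no k≢i     | no k≢j     = trans (A≈M k k≢i k≢j l) (sym (W-off r s k k≢i k≢j l))

      _⊹_ : (r s : Fin n → Carrier) → Fin n → Carrier
      (r ⊹ s) l = r l + s l

      splitˡ : ∀ s → f (W (u ⊹ v) s) ≈ f (W u s) + f (W v s)
      splitˡ s = additive i
        (λ l → trans (W-i _ s l) (+-cong (sym (W-i u s l)) (sym (W-i v s l))))
        (λ k k≢i l → trans (W-off-i _ s k k≢i l) (sym (W-off-i u s k k≢i l)))
        (λ k k≢i l → trans (W-off-i _ s k k≢i l) (sym (W-off-i v s k k≢i l)))

      splitʳ : ∀ r → f (W r (u ⊹ v)) ≈ f (W r u) + f (W r v)
      splitʳ r = additive j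
        (λ l → trans (W-j r _ l) (+-cong (sym (W-j r u l)) (sym (W-j r v l))))
        (λ k k≢j l → sym (off-j u k k≢j l))
        (λ k k≢j l → sym (off-j v k k≢j l))
        where
        off-j : ∀ s k → k ≢ j → ∀ l → W r s k l ≈ W r (u ⊹ v) k l
        off-j s = λ k k≢j l → agree-off k k≢j l
          where
          agree-off : ∀ k → k ≢ j → ∀ l → W r s k l ≈ W r (u ⊹ v) k l
          agree-off k k≢j l with k Finₚ.≟ i
          ... | yes ≡.refl = trans (W-i r s l) (sym (W-i r _ l))
          ... | no  k≢i    = trans (W-off r s k k≢i k≢j l) (sym (W-off r _ k k≢i k≢j l))

      diagonal : ∀ r → f (W r r) ≈ 0#
      diagonal r = f≈0 λ l → trans (W-i r r l) (sym (W-j r r l))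

      expand : f (W u v) + f (W v u) ≈ 0#
      expand = begin
        f (W u v) + f (W v u)
          ≈⟨ +-cong (+-identityˡ _) (+-identityʳ _) ⟨
        (0# + f (W u v)) + (f (W v u) + 0#)
          ≈⟨ +-cong (+-congʳ (diagonal u)) (+-congˡ (diagonal v)) ⟨
        (f (W u u) + f (W u v)) + (f (W v u) + f (W v v))
          ≈⟨ +-cong (splitʳ u) (splitʳ v) ⟨
        f (W u (u ⊹ v)) + f (W v (u ⊹ v))
          ≈⟨ splitˡ (u ⊹ v) ⟨
        f (W (u ⊹ v) (u ⊹ v))
          ≈⟨ diagonal (u ⊹ v) ⟩
        0# ∎

  record IsAlternating {n} (f : Matrix Carrier n → Carrier) : Set (c ⊔ ℓ) where
    field
      isMultilinear : IsMultilinear f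
      alternating   : ∀ {i j} → i ≢ j → ∀ {M} → (∀ k → M i k ≈ M j k) → f M ≈ 0#

    open IsMultilinear isMultilinear public

    -- The rows are cleared one at a time; Q m has its first m rows cleared.
    clear-rows : ∀ r {M M′} (x : Fin n → Carrier) → (∀ l → M r l ≈ M′ r l) →
                 (∀ k → k ≢ r → ∀ l → M k l ≈ M′ k l + x k * M r l) → f M ≈ f M′
    clear-rows r {M} {M′} x Mr≈M′r M≈ = begin
      f M      ≈⟨ cong (λ _ _ → refl) ⟩
      f (Q 0)  ≈⟨ steps n ℕₚ.≤-refl ⟩
      f (Q n)  ≈⟨ cong (λ k l → reflexive (≡.cong (λ b → (if b then M′ k else M k) l)
                    (dec-true (toℕ k ℕₚ.<? n) (Finₚ.toℕ<n k)))) ⟩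
      f M′     ∎
      where
      Q : ℕ → Matrix Carrier n
      Q m k = if does (toℕ k ℕₚ.<? m) then M′ k else M k

      Q-< : ∀ {m k} → toℕ k ℕ.< m → Q m k ≡ M′ k
      Q-< {m} {k} k<m = ≡.cong (if_then M′ k else M k) (dec-true (toℕ k ℕₚ.<? m) k<m)

      Q-≮ : ∀ {m k} → (toℕ k ℕ.≮ m) → Q m k ≡ M k
      Q-≮ {m} {k} k≮m = ≡.cong (if_then M′ k else M k) (dec-false (toℕ k ℕₚ.<? m) k≮m)

      Q-r : ∀ m l → Q m r l ≈ M r l
      Q-r m l with does (toℕ r ℕₚ.<? m)
      ... | Bool.true  = sym (Mr≈M′r l)
      ... | Bool.false = refl

      Q-suc : ∀ m k → toℕ k ≢ m → Q m k ≡ Q (suc m) k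
      Q-suc m k k≢m with toℕ k ℕₚ.<? m
      ... | yes k<m = ≡.trans (Q-< k<m) (≡.sym (Q-< (ℕₚ.m<n⇒m<1+n k<m)))
      ... | no  k≮m = ≡.trans (Q-≮ k≮m) (≡.sym (Q-≮ λ k<1+m → k≮m (ℕₚ.≤∧≢⇒< (ℕₚ.m<1+n⇒m≤n k<1+m) k≢m)))

      step : ∀ k → f (Q (toℕ k)) ≈ f (Q (suc (toℕ k)))
      step k with k Finₚ.≟ r
      ... | yes ≡.refl = cong λ i l → same i l
        where
        same : ∀ i l → Q (toℕ r) i l ≈ Q (suc (toℕ r)) i l
        same i l with i Finₚ.≟ r
        ... | yes ≡.refl = trans (Q-r (toℕ r) l) (sym (Q-r (suc (toℕ r)) l))
        ... | no  i≢r    = reflexive (≡.cong-app (Q-suc (toℕ r) i (i≢r ∘ Finₚ.toℕ-injective)) l)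
      ... | no k≢r = begin
        f (Q (toℕ k))                        ≈⟨ linear k
                                                  (λ l → trans (reflexive (≡.cong-app (Q-≮ (ℕₚ.<-irrefl ≡.refl)) l))
                                                    (trans (M≈ k k≢r l)
                                                      (+-cong (reflexive (≡.sym (≡.cong-app (Q-< ℕₚ.≤-refl) l)))
                                                              (*-congˡ (reflexive (≡.sym (≡.cong-app (updateAt-updates k (Q (toℕ k))) l)))))))
                                                  (λ i i≢k l → reflexive (≡.cong-app (Q-suc (toℕ k) i (i≢k ∘ Finₚ.toℕ-injective)) l))
                                                  (λ i i≢k l → reflexive (≡.sym (≡.cong-app (updateAt-minimal i k (Q (toℕ k)) i≢k) l))) ⟩
        f (Q (suc (toℕ k))) + x k * f B      ≈⟨ +-congˡ (trans (*-congˡ (alternating k≢r λ l →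
                                                   trans (reflexive (≡.cong-app (updateAt-updates k (Q (toℕ k))) l))
                                                     (trans (sym (Q-r (toℕ k) l))
                                                       (reflexive (≡.sym (≡.cong-app (updateAt-minimal r k (Q (toℕ k)) (k≢r ∘ ≡.sym)) l))))))
                                                 (zeroʳ (x k))) ⟩
        f (Q (suc (toℕ k))) + 0#             ≈⟨ +-identityʳ _ ⟩
        f (Q (suc (toℕ k)))                  ∎
        where
        B : Matrix Carrier n
        B = updateAt (Q (toℕ k)) k (const (M r))

      steps : ∀ m → m ℕ.≤ n → f (Q 0) ≈ f (Q m)
      steps zero    _   = refl
      steps (suc m) m<n = trans (steps m (ℕₚ.<⇒≤ m<n))
        (≡.subst (λ k → f (Q k) ≈ f (Q (suc k))) (Finₚ.toℕ-fromℕ< m<n) (step (fromℕ< m<n)))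

  -- Induction on the larger of the two indices: exchanging its row with the one before costs only a
  -- sign, by `swap-rows` for neighbours, and moves the equal rows one step closer until they are
  -- neighbours themselves.
  alternating-fromAdjacent : ∀ {n} {f : Matrix Carrier n → Carrier} → IsMultilinear f →
    (∀ {i j} → Adjacent i j → ∀ {M} → (∀ k → M i k ≈ M j k) → f M ≈ 0#) → IsAlternating f
  alternating-fromAdjacent {zero} isMultilinear f≈0 = record
    { isMultilinear = isMultilinear
    ; alternating   = λ { {()} }
    }
  alternating-fromAdjacent {suc n} {f} isMultilinear f≈0 = record
    { isMultilinear = isMultilinear
    ; alternating   = alternating
    }
    where
    open IsMultilinear isMultilinear

    P : Fin (suc n) → Set _
    P j = ∀ i → i Fin.< j → ∀ M → (∀ k → M i k ≈ M j k) → f M ≈ 0#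

    ordered : ∀ j → P j
    ordered = <-weakInduction P (λ _ ()) step
      where
      step : ∀ j → P (inject₁ j) → P (suc j)
      step j ih i i<1+j M Mi≈Mj with i Finₚ.≟ inject₁ j
      ... | yes ≡.refl = f≈0 (adjacent-inject₁ j) Mi≈Mj
      ... | no  i≢j    = begin
        f M        ≈⟨ swap-rows (adjacent⇒≢ a) (f≈0 a) at-j at-1+j off ⟩
        - f M′     ≈⟨ -‿cong (ih i i<j M′ λ k → trans (sym (off i i≢j i≢1+j k)) (trans (Mi≈Mj k) (at-1+j k))) ⟩
        - 0#       ≈⟨ IntegerCoefficients.-0≈0 S ⟩
        0#         ∎
        where
        a = adjacent-inject₁ j
        i<j : i Fin.< inject₁ j
        i<j = ℕₚ.≤∧≢⇒< (≡.subst (toℕ i ℕ.≤_) (≡.sym (Finₚ.toℕ-inject₁ j)) (ℕₚ.m<1+n⇒m≤n i<1+j))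
                (i≢j ∘ Finₚ.toℕ-injective)
        i≢1+j : i ≢ suc j
        i≢1+j = Finₚ.<⇒≢ i<1+j
        M₁ = updateAt M (inject₁ j) (const (M (suc j)))
        M′ = updateAt M₁ (suc j) (const (M (inject₁ j)))
        at-j : ∀ l → M (inject₁ j) l ≈ M′ (suc j) l
        at-j l = reflexive (≡.sym (≡.cong-app (updateAt-updates (suc j) M₁) l))
        at-1+j : ∀ l → M (suc j) l ≈ M′ (inject₁ j) l
        at-1+j l = reflexive (≡.sym (≡.trans
          (≡.cong-app (updateAt-minimal (inject₁ j) (suc j) M₁ (adjacent⇒≢ a)) l)
          (≡.cong-app (updateAt-updates (inject₁ j) M) l)))
        off : ∀ k → k ≢ inject₁ j → k ≢ suc j → ∀ l → M k l ≈ M′ k l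
        off k k≢j k≢1+j l = reflexive (≡.sym (≡.trans
          (≡.cong-app (updateAt-minimal k (suc j) M₁ k≢1+j) l)
          (≡.cong-app (updateAt-minimal k (inject₁ j) M k≢j) l)))

    alternating : ∀ {i j} → i ≢ j → ∀ {M} → (∀ k → M i k ≈ M j k) → f M ≈ 0#
    alternating {i} {j} i≢j {M} Mi≈Mj with ℕₚ.<-cmp (toℕ i) (toℕ j)
    ... | tri< i<j _ _ = ordered j i i<j M Mi≈Mj
    ... | tri≈ _ i≡j _ = contradiction (Finₚ.toℕ-injective i≡j) i≢j
    ... | tri> _ _ j<i = ordered i j j<i M (sym ∘ Mi≈Mj)

-- Uniqueness of the determinant and its consequences.

punchIn-elim : ∀ {n p} (P : Fin (suc n) → Set p) j → P j → (∀ k → P (punchIn j k)) → ∀ k → P k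
punchIn-elim P j Pj P′ k with j Finₚ.≟ k
... | yes ≡.refl = Pj
... | no  j≢k    = ≡.subst P (Finₚ.punchIn-punchOut j≢k) (P′ (punchOut j≢k))

punchIn-inject₁ : ∀ {n} (i : Fin n) → punchIn (inject₁ i) i ≡ suc i
punchIn-inject₁ zero    = ≡.refl
punchIn-inject₁ (suc i) = ≡.cong suc (punchIn-inject₁ i)

punchIn-suc : ∀ {n} (i : Fin n) → punchIn (suc i) i ≡ inject₁ i
punchIn-suc zero    = ≡.refl
punchIn-suc (suc i) = ≡.cong suc (punchIn-suc i)

punchIn-inject₁≡punchIn-suc : ∀ {n} (i k : Fin n) → k ≢ i → punchIn (inject₁ i) k ≡ punchIn (suc i) k
punchIn-inject₁≡punchIn-suc i k k≢i with punchIn-adjacent (adjacent-inject₁ i) k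
... | inj₁ eq       = eq
... | inj₂ (eq , _) = contradiction
  (Finₚ.punchIn-injective (inject₁ i) k i (≡.trans eq (≡.sym (punchIn-inject₁ i)))) k≢i

punchIn-↑ˡ : ∀ {m} n (i : Fin (suc m)) j → punchIn (i ↑ˡ n) (j ↑ˡ n) ≡ punchIn i j ↑ˡ n
punchIn-↑ˡ n zero    j       = ≡.refl
punchIn-↑ˡ n (suc i) zero    = ≡.refl
punchIn-↑ˡ n (suc i) (suc j) = ≡.cong suc (punchIn-↑ˡ n i j)

punchIn-↑ʳ : ∀ m {n} (i : Fin (suc m)) (j : Fin n) → punchIn (i ↑ˡ n) (m ↑ʳ j) ≡ suc m ↑ʳ j
punchIn-↑ʳ m       zero    j = ≡.refl
punchIn-↑ʳ (suc m) (suc i) j = ≡.cong suc (punchIn-↑ʳ m i j)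

module MultiplicativeDeterminant {c ℓ : Level} (S : CommutativeRing c ℓ) where
  open CommutativeRing S hiding (zero)
  open DeterminantProperties S
  open AlternatingMaps S
  open IntegerCoefficients S using (module Solver)
  open Solver using (solve; _:=_; _:+_; _:*_; :-_; _:-_; con)
  open FiniteSums +-commutativeMonoid public using (∑-++)
  open RingProperties ring
  open SetoidReasoning setoid

  -- The matrix whose first row is a unit vector, whose column `j` vanishes below it, and whose
  -- minor there is `N`: what remains of a Laplace term after column `j` has been cleared.
  border : ∀ {n} → Fin (suc n) → Matrix Carrier n → Matrix Carrier (suc n)
  border j N zero    = 1ₘ j
  border j N (suc i) = insertAt (N i) j 0#

  insertAt-cong : ∀ {n} {u v : Fin n → Carrier} {x} → (∀ k → u k ≈ v k) → ∀ j k → insertAt u j x k ≈ insertAt v j x k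
  insertAt-cong {u = u} {v} {x} u≈v j = punchIn-elim _ j
    (reflexive (≡.trans (insertAt-lookup u j x) (≡.sym (insertAt-lookup v j x))))
    (λ k → trans (reflexive (insertAt-punchIn u j x k)) (trans (u≈v k) (reflexive (≡.sym (insertAt-punchIn v j x k)))))

  insertAt-1ₘ : ∀ {n} (j : Fin (suc n)) i k → insertAt (1ₘ i) j 0# k ≡ 1ₘ (punchIn j i) k
  insertAt-1ₘ j i = punchIn-elim _ j
    (≡.trans (insertAt-lookup (1ₘ i) j 0#) (≡.sym (1ₘ-off-diagonal (Finₚ.punchInᵢ≢i j i))))
    (λ k → ≡.trans (insertAt-punchIn (1ₘ i) j 0# k) (≡.sym (1ₘ-punchIn j i k)))

  border-isAlternating : ∀ {n} {f : Matrix Carrier (suc n) → Carrier} → IsAlternating f →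
                         ∀ j → IsAlternating (f ∘ border j)
  border-isAlternating {f = f} alt j = record
    { isMultilinear = record
      { cong   = λ M≈N → F.cong λ
        { zero    _ → refl
        ; (suc i) k → insertAt-cong (M≈N i) j k
        }
      ; linear = λ i {x} {M} {A} {B} M≈A+xB M≈A M≈B → F.linear (suc i)
        (punchIn-elim _ j
          (begin
            insertAt (M i) j 0# j                              ≡⟨ insertAt-lookup (M i) j 0# ⟩
            0#                                                 ≈⟨ zeroʳ x ⟨
            x * 0#                                             ≈⟨ +-identityˡ _ ⟨
            0# + x * 0#                                        ≡⟨ ≡.cong₂ (λ a b → a + x * b) (insertAt-lookup (A i) j 0#) (insertAt-lookup (B i) j 0#) ⟨
            insertAt (A i) j 0# j + x * insertAt (B i) j 0# j  ∎)
          (λ k → begin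
            insertAt (M i) j 0# (punchIn j k)                  ≡⟨ insertAt-punchIn (M i) j 0# k ⟩
            M i k                                              ≈⟨ M≈A+xB k ⟩
            A i k + x * B i k                                  ≡⟨ ≡.cong₂ (λ a b → a + x * b) (insertAt-punchIn (A i) j 0# k) (insertAt-punchIn (B i) j 0# k) ⟨
            insertAt (A i) j 0# (punchIn j k) + x * insertAt (B i) j 0# (punchIn j k) ∎))
        (λ { zero    _    _ → refl
           ; (suc k) k≢i  l → insertAt-cong (M≈A k (k≢i ∘ ≡.cong suc)) j l })
        (λ { zero    _    _ → refl
           ; (suc k) k≢i  l → insertAt-cong (M≈B k (k≢i ∘ ≡.cong suc)) j l })
      }
    ; alternating = λ i≢k Mi≈Mk → F.alternating (i≢k ∘ Finₚ.suc-injective) (insertAt-cong Mi≈Mk j)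
    }
    where module F = IsAlternating alt

  -- These are permutation matrices. Passing from `inject₁ j` to `suc j` exchanges rows `zero` and
  -- `suc j`, which accounts for one sign per step.
  border-1ₘ : ∀ {n} {f : Matrix Carrier (suc n) → Carrier} → IsAlternating f →
              ∀ j → f (border j 1ₘ) ≈ sign j * f 1ₘ
  border-1ₘ {f = f} alt = <-weakInduction _
    (begin
      f (border zero 1ₘ)  ≈⟨ F.cong (λ { zero    k → refl
                                      ; (suc i) k → reflexive (insertAt-1ₘ zero i k) }) ⟩
      f 1ₘ                ≈⟨ *-identityˡ _ ⟨
      1# * f 1ₘ           ∎)
    λ j ih → begin
      f (border (suc j) 1ₘ)       ≈⟨ F.swap-rows {zero} {suc j} (λ ()) (F.alternating λ ())
                                       (λ l → reflexive (≡.trans (≡.cong (λ i → 1ₘ i l) (≡.sym (punchIn-inject₁ j)))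
                                                         (≡.sym (insertAt-1ₘ (inject₁ j) j l))))
                                       (λ l → reflexive (≡.trans (insertAt-1ₘ (suc j) j l)
                                                         (≡.cong (λ i → 1ₘ i l) (punchIn-suc j))))
                                       (others j) ⟩
      - f (border (inject₁ j) 1ₘ) ≈⟨ -‿cong ih ⟩
      - (sign (inject₁ j) * f 1ₘ) ≈⟨ -‿distribˡ-* _ _ ⟩
      - sign (inject₁ j) * f 1ₘ   ≈⟨ *-congʳ (sign-adjacent (adjacent-inject₁ j)) ⟨
      sign (suc j) * f 1ₘ         ∎
    where
    module F = IsAlternating alt
    others : ∀ j k → k ≢ zero → k ≢ suc j → ∀ l → border (suc j) 1ₘ k l ≈ border (inject₁ j) 1ₘ k l
    others j zero    0≢0 _   l = contradiction ≡.refl 0≢0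
    others j (suc k) _   k≢j l = reflexive (≡.trans (insertAt-1ₘ (suc j) k l) (≡.trans
      (≡.cong (λ i → 1ₘ i l) (≡.sym (punchIn-inject₁≡punchIn-suc j k (k≢j ∘ ≡.cong suc))))
      (≡.sym (insertAt-1ₘ (inject₁ j) k l))))

  -- Linearity splits the top row into unit vectors, and each unit row clears its column below. What
  -- is left is a function of the minor that is alternating again, so induction reproduces the
  -- Laplace expansion term by term.
  det-unique : ∀ {n} {f : Matrix Carrier n → Carrier} → IsAlternating f → ∀ M → f M ≈ det M * f 1ₘ
  det-unique {zero}      alt M = trans (IsAlternating.cong alt λ ()) (sym (*-identityˡ _))
  det-unique {suc n} {f} alt M = begin
    f M
      ≈⟨ F.linear-∑ zero (M zero) topRow
           (λ k → trans (sym (∑-1ₘ k (M zero))) (sum-cong-≋ λ j → trans (*-comm _ (M zero j)) (*-congˡ (reflexive (1ₘ-sym k j)))))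
           (λ { j zero    0≢0 _ → contradiction ≡.refl 0≢0
              ; j (suc k) _   _ → refl }) ⟩
    ∑[ j < suc n ] (M zero j * f (topRow j))
      ≈⟨ sum-cong-≋ (λ j → trans (*-congˡ (expand j))
           (solve 4 (λ m d s e → m :* (d :* (s :* e)) := s :* m :* d :* e) refl (M zero j) _ _ _)) ⟩
    ∑[ j < suc n ] (sign j * M zero j * det (minor M j) * f 1ₘ)
      ≈⟨ *-distribʳ-sum (f 1ₘ) (λ j → sign j * M zero j * det (minor M j)) ⟨
    det M * f 1ₘ ∎
    where
    module F = IsAlternating alt

    topRow : Fin (suc n) → Matrix Carrier (suc n)
    topRow j zero    = 1ₘ j
    topRow j (suc i) = M (suc i)

    clear : ∀ j i l → M (suc i) l ≈ insertAt (minor M j i) j 0# l + M (suc i) j * 1ₘ j l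
    clear j i = punchIn-elim _ j
      (begin
        M (suc i) j                                      ≈⟨ solve 1 (λ m → m := con (+ 0) :+ m :* con (+ 1)) refl _ ⟩
        0# + M (suc i) j * 1#                            ≡⟨ ≡.cong₂ (λ a b → a + M (suc i) j * b) (insertAt-lookup (minor M j i) j 0#) (1ₘ-diagonal j) ⟨
        insertAt (minor M j i) j 0# j + M (suc i) j * 1ₘ j j ∎)
      (λ l → begin
        M (suc i) (punchIn j l)                          ≈⟨ +-identityʳ _ ⟨
        M (suc i) (punchIn j l) + 0#                     ≈⟨ +-congˡ (zeroʳ _) ⟨
        M (suc i) (punchIn j l) + M (suc i) j * 0#       ≡⟨ ≡.cong₂ (λ a b → a + M (suc i) j * b) (insertAt-punchIn (minor M j i) j 0# l)
                                                              (1ₘ-off-diagonal (Finₚ.punchInᵢ≢i j l ∘ ≡.sym)) ⟨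
        insertAt (minor M j i) j 0# (punchIn j l) + M (suc i) j * 1ₘ j (punchIn j l) ∎)

    expand : ∀ j → f (topRow j) ≈ det (minor M j) * (sign j * f 1ₘ)
    expand j = begin
      f (topRow j)                            ≈⟨ F.clear-rows zero (λ { zero → 0# ; (suc i) → M (suc i) j })
                                                   (λ _ → refl)
                                                   (λ { zero    0≢0 → contradiction ≡.refl 0≢0
                                                      ; (suc i) _   → clear j i }) ⟩
      f (border j (minor M j))                ≈⟨ det-unique (border-isAlternating alt j) (minor M j) ⟩
      det (minor M j) * f (border j 1ₘ)       ≈⟨ *-congˡ (border-1ₘ alt j) ⟩
      det (minor M j) * (sign j * f 1ₘ)       ∎


  scalar : ∀ {n} → Carrier → Matrix Carrier n
  scalar x i j = x * 1ₘ i j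

  det-scalar : ∀ n x → det {n} (scalar x) ≈ x ^ n
  det-scalar zero    x = refl
  det-scalar (suc n) x = begin
    1# * (x * 1#) * det (minor (scalar {suc n} x) zero) + ∑[ j < n ] (sign (suc j) * (x * 0#) * det (minor (scalar {suc n} x) (suc j)))
      ≈⟨ +-cong (*-cong (trans (*-identityˡ _) (*-identityʳ x))
                   (trans (det-cong {n} {N = scalar x} λ i k → *-congˡ (reflexive (1ₘ-punchIn zero i k))) (det-scalar n x)))
           (∑-zero {n} λ j → trans (*-congʳ {det (minor (scalar {suc n} x) (suc j))} (trans (*-congˡ {sign (suc j)} (zeroʳ x)) (zeroʳ _))) (zeroˡ _)) ⟩
    x * x ^ n + 0#  ≈⟨ +-identityʳ _ ⟩
    x * x ^ n       ∎

  det-1ₘ : ∀ n → det {n} 1ₘ ≈ 1#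
  det-1ₘ n = trans (det-cong {n} {N = scalar 1#} λ i j → sym (*-identityˡ _)) (trans (det-scalar n 1#) (1^n n))
    where
    1^n : ∀ n → 1# ^ n ≈ 1#
    1^n zero    = refl
    1^n (suc n) = trans (*-identityˡ _) (1^n n)

  transpose-isAlternating : ∀ {n} → IsAlternating {n} (det ∘ flip)
  transpose-isAlternating = alternating-fromAdjacent
    (record
      { cong   = λ M≈N → det-cong λ i j → M≈N j i
      ; linear = λ i {x} {M} {A} {B} → det-columnLinear i {x} {flip M} {flip A} {flip B}
      })
    (λ a {M} → det-equalAdjacentColumns {M = flip M} a)

  -- The column properties proved by expansion say that `det ∘ flip` is alternating in the rows, and
  -- it is 1 at the identity, so uniqueness applies to it.
  det-transpose : ∀ {n} (M : Matrix Carrier n) → det (flip M) ≈ det M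
  det-transpose {n} M = begin
    det (flip M)           ≈⟨ det-unique transpose-isAlternating M ⟩
    det M * det (flip (1ₘ {n}))  ≈⟨ *-congˡ (trans (det-cong {n} {flip (1ₘ {n})} {1ₘ} λ i j → reflexive (1ₘ-sym j i)) (det-1ₘ n)) ⟩
    det M * 1#             ≈⟨ *-identityʳ _ ⟩
    det M                  ∎

  det-isAlternating : ∀ {n} → IsAlternating {n} det
  det-isAlternating = record
    { isMultilinear = record
      { cong   = det-cong
      ; linear = λ i {x} {M} {A} {B} M≈A+xB M≈A M≈B → begin
          det M                            ≈⟨ det-transpose M ⟨
          det (flip M)                     ≈⟨ T.linear i M≈A+xB M≈A M≈B ⟩
          det (flip A) + x * det (flip B)  ≈⟨ +-cong (det-transpose A) (*-congˡ (det-transpose B)) ⟩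
          det A + x * det B                ∎
      }
    ; alternating = λ i≢j {M} Mi≈Mj → trans (sym (det-transpose M)) (T.alternating i≢j Mi≈Mj)
    }
    where module T {n} = IsAlternating (transpose-isAlternating {n})

  infixl 7 _·_
  _·_ : ∀ {l m n} → (Fin l → Fin m → Carrier) → (Fin m → Fin n → Carrier) → Fin l → Fin n → Carrier
  _·_ {m = m} M N i k = ∑[ j < m ] (M i j * N j k)

  -- For fixed `N` the left side is alternating in the rows of `M`, with value `det N` at the
  -- identity.
  det-* : ∀ {n} (M N : Matrix Carrier n) → det (M · N) ≈ det M * det N
  det-* {n} M N = trans (det-unique alt M) (*-congˡ (det-cong λ i j → ∑-1ₘ i (λ k → N k j)))
    where
    module D = IsAlternating (det-isAlternating {n})
    row-cong : ∀ {u v : Fin n → Carrier} → (∀ j → u j ≈ v j) → ∀ k → ∑[ j < n ] (u j * N j k) ≈ ∑[ j < n ] (v j * N j k)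
    row-cong u≈v k = sum-cong-≋ λ j → *-congʳ (u≈v j)
    alt : IsAlternating (λ M → det (M · N))
    alt = record
      { isMultilinear = record
        { cong   = λ M≈M′ → det-cong λ i → row-cong (M≈M′ i)
        ; linear = λ i {x} {M} {A} {B} M≈A+xB M≈A M≈B → D.linear i
            (λ k → begin
              ∑[ j < n ] (M i j * N j k)
                ≈⟨ sum-cong-≋ (λ j → trans (*-congʳ (M≈A+xB j))
                     (solve 4 (λ a x b n → (a :+ x :* b) :* n := a :* n :+ x :* (b :* n)) refl (A i j) x (B i j) (N j k))) ⟩
              ∑[ j < n ] (A i j * N j k + x * (B i j * N j k))
                ≈⟨ ∑-distrib-+ (λ j → A i j * N j k) (λ j → x * (B i j * N j k)) ⟩
              (A · N) i k + ∑[ j < n ] (x * (B i j * N j k))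
                ≈⟨ +-congˡ (*-distribˡ-sum x (λ j → B i j * N j k)) ⟨
              (A · N) i k + x * (B · N) i k ∎)
            (λ l l≢i → row-cong (M≈A l l≢i))
            (λ l l≢i → row-cong (M≈B l l≢i))
        }
      ; alternating = λ i≢j Mi≈Mj → D.alternating i≢j (row-cong Mi≈Mj)
      }


  -- In the expansion along the first row the entries to the right of `A` vanish, and each other
  -- minor is block lower triangular again with the same `D`.
  det-blockLower : ∀ m {n} {M : Matrix Carrier (m ℕ.+ n)} {A : Matrix Carrier m} {D : Matrix Carrier n} →
    (∀ i j → M (i ↑ˡ n) (j ↑ˡ n) ≈ A i j) →
    (∀ i j → M (i ↑ˡ n) (m ↑ʳ j) ≈ 0#) →
    (∀ i j → M (m ↑ʳ i) (m ↑ʳ j) ≈ D i j) →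
    det M ≈ det A * det D
  det-blockLower zero    M≈A M≈0 M≈D = trans (det-cong M≈D) (sym (*-identityˡ _))
  det-blockLower (suc m) {n} {M} {A} {D} M≈A M≈0 M≈D = begin
    det M
      ≈⟨ ∑-++ (suc m) term ⟩
    ∑[ j < suc m ] term (j ↑ˡ n) + ∑[ j < n ] term (suc m ↑ʳ j)
      ≈⟨ +-cong (sum-cong-≋ left) (∑-zero right) ⟩
    ∑[ j < suc m ] (sign j * A zero j * det (minor A j) * det D) + 0#
      ≈⟨ +-identityʳ _ ⟩
    ∑[ j < suc m ] (sign j * A zero j * det (minor A j) * det D)
      ≈⟨ *-distribʳ-sum (det D) (λ j → sign j * A zero j * det (minor A j)) ⟨
    det A * det D ∎
    where
    term : Fin (suc m ℕ.+ n) → Carrier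
    term j = sign j * M zero j * det (minor M j)

    right : ∀ j → term (suc m ↑ʳ j) ≈ 0#
    right j = trans (*-congʳ (trans (*-congˡ {sign (suc m ↑ʳ j)} (M≈0 zero j)) (zeroʳ _))) (zeroˡ _)

    left : ∀ j → term (j ↑ˡ n) ≈ sign j * A zero j * det (minor A j) * det D
    left j = trans
      (*-cong (*-cong (reflexive (≡.cong ((- 1#) ^_) (Finₚ.toℕ-↑ˡ j n))) (M≈A zero j))
        (det-blockLower m
          (λ i k → trans (reflexive (≡.cong (M _) (punchIn-↑ˡ n j k))) (M≈A (suc i) (punchIn j k)))
          (λ i k → trans (reflexive (≡.cong (M _) (punchIn-↑ʳ m j k))) (M≈0 (suc i) k))
          (λ i k → trans (reflexive (≡.cong (M _) (punchIn-↑ʳ m j k))) (M≈D i k))))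
      (sym (*-assoc _ _ _))

  det-blockUpper : ∀ m {n} {M : Matrix Carrier (m ℕ.+ n)} {A : Matrix Carrier m} {D : Matrix Carrier n} →
    (∀ i j → M (i ↑ˡ n) (j ↑ˡ n) ≈ A i j) →
    (∀ i j → M (m ↑ʳ i) (j ↑ˡ n) ≈ 0#) →
    (∀ i j → M (m ↑ʳ i) (m ↑ʳ j) ≈ D i j) →
    det M ≈ det A * det D
  det-blockUpper m {M = M} {A} {D} M≈A M≈0 M≈D = begin
    det M                        ≈⟨ det-transpose M ⟨
    det (flip M)                 ≈⟨ det-blockLower m (flip M≈A) (flip M≈0) (flip M≈D) ⟩
    det (flip A) * det (flip D)  ≈⟨ *-cong (det-transpose A) (det-transpose D) ⟩
    det A * det D                ∎

-- Block matrices and Sylvester's identity.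

module _ {a : Level} {X : Set a} {m n : ℕ} where
  block : Matrix X m → (Fin m → Fin n → X) → (Fin n → Fin m → X) → Matrix X n → Matrix X (m ℕ.+ n)
  block A B C D i j =
    [ (λ i → [ A i , B i ]′ (splitAt m j)) , (λ i → [ C i , D i ]′ (splitAt m j)) ]′ (splitAt m i)

  module _ {A : Matrix X m} {B : Fin m → Fin n → X} {C : Fin n → Fin m → X} {D : Matrix X n} where
    block-ˡˡ : ∀ i j → block A B C D (i ↑ˡ n) (j ↑ˡ n) ≡ A i j
    block-ˡˡ i j rewrite Finₚ.splitAt-↑ˡ m i n | Finₚ.splitAt-↑ˡ m j n = ≡.refl

    block-ˡʳ : ∀ i j → block A B C D (i ↑ˡ n) (m ↑ʳ j) ≡ B i j
    block-ˡʳ i j rewrite Finₚ.splitAt-↑ˡ m i n | Finₚ.splitAt-↑ʳ m n j = ≡.refl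

    block-ʳˡ : ∀ i j → block A B C D (m ↑ʳ i) (j ↑ˡ n) ≡ C i j
    block-ʳˡ i j rewrite Finₚ.splitAt-↑ʳ m n i | Finₚ.splitAt-↑ˡ m j n = ≡.refl

    block-ʳʳ : ∀ i j → block A B C D (m ↑ʳ i) (m ↑ʳ j) ≡ D i j
    block-ʳʳ i j rewrite Finₚ.splitAt-↑ʳ m n i | Finₚ.splitAt-↑ʳ m n j = ≡.refl

module SylvesterIdentity {c ℓ : Level} (S : CommutativeRing c ℓ) where
  open CommutativeRing S hiding (zero)
  open DeterminantProperties S
  open MultiplicativeDeterminant S
  open IntegerCoefficients S using (module Solver)
  open Solver using (solve; _:=_; _:+_; _:*_; :-_; _:-_; con)
  open RingProperties ring
  open SetoidReasoning setoid

  module _ {m n : ℕ} where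
    module _ {A A′ : Matrix Carrier m} {B B′ : Fin m → Fin n → Carrier}
             {C C′ : Fin n → Fin m → Carrier} {D D′ : Matrix Carrier n} where
      private
        MN = block A B C D · block A′ B′ C′ D′

        split : ∀ i j {a : Fin m → Carrier} {b : Fin n → Carrier} →
                (∀ k → block A B C D i (k ↑ˡ n) * block A′ B′ C′ D′ (k ↑ˡ n) j ≈ a k) →
                (∀ k → block A B C D i (m ↑ʳ k) * block A′ B′ C′ D′ (m ↑ʳ k) j ≈ b k) →
                MN i j ≈ sum a + sum b
        split i j eqˡ eqʳ = trans (∑-++ m _) (+-cong (sum-cong-≋ eqˡ) (sum-cong-≋ eqʳ))

      block-·-ˡˡ : ∀ i j → MN (i ↑ˡ n) (j ↑ˡ n) ≈ (A · A′) i j + (B · C′) i j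
      block-·-ˡˡ i j = split _ _
        (λ k → *-cong (reflexive (block-ˡˡ i k)) (reflexive (block-ˡˡ k j)))
        (λ k → *-cong (reflexive (block-ˡʳ i k)) (reflexive (block-ʳˡ k j)))

      block-·-ˡʳ : ∀ i j → MN (i ↑ˡ n) (m ↑ʳ j) ≈ (A · B′) i j + (B · D′) i j
      block-·-ˡʳ i j = split _ _
        (λ k → *-cong (reflexive (block-ˡˡ i k)) (reflexive (block-ˡʳ k j)))
        (λ k → *-cong (reflexive (block-ˡʳ i k)) (reflexive (block-ʳʳ {m = m} {D = D′} k j)))

      block-·-ʳˡ : ∀ i j → MN (m ↑ʳ i) (j ↑ˡ n) ≈ (C · A′) i j + (D · C′) i j
      block-·-ʳˡ i j = split _ _
        (λ k → *-cong (reflexive (block-ʳˡ i k)) (reflexive (block-ˡˡ k j)))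
        (λ k → *-cong (reflexive (block-ʳʳ {m = m} {D = D} i k)) (reflexive (block-ʳˡ k j)))

      block-·-ʳʳ : ∀ i j → MN (m ↑ʳ i) (m ↑ʳ j) ≈ (C · B′) i j + (D · D′) i j
      block-·-ʳʳ i j = split _ _
        (λ k → *-cong (reflexive (block-ʳˡ i k)) (reflexive (block-ˡʳ k j)))
        (λ k → *-cong (reflexive (block-ʳʳ {m = m} {D = D} i k)) (reflexive (block-ʳʳ {m = m} {D = D′} k j)))

  scalar-· : ∀ {m n} x (M : Fin m → Fin n → Carrier) i j → (scalar x · M) i j ≈ x * M i j
  scalar-· {m} x M i j = begin
    ∑[ k < m ] (x * 1ₘ i k * M k j)    ≈⟨ sum-cong-≋ (λ k → *-assoc x (1ₘ i k) (M k j)) ⟩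
    ∑[ k < m ] (x * (1ₘ i k * M k j))  ≈⟨ *-distribˡ-sum x (λ k → 1ₘ i k * M k j) ⟨
    x * ∑[ k < m ] (1ₘ i k * M k j)    ≈⟨ *-congˡ (∑-1ₘ i (λ k → M k j)) ⟩
    x * M i j                          ∎

  ·-scalar : ∀ {m n} x (M : Fin m → Fin n → Carrier) i j → (M · scalar x) i j ≈ x * M i j
  ·-scalar {m} {n} x M i j = begin
    ∑[ k < n ] (M i k * (x * 1ₘ k j))
      ≈⟨ sum-cong-≋ (λ k → trans (*-congˡ (*-congˡ (reflexive (1ₘ-sym k j))))
           (solve 3 (λ m x d → m :* (x :* d) := x :* (d :* m)) refl (M i k) x (1ₘ j k))) ⟩
    ∑[ k < n ] (x * (1ₘ j k * M i k))  ≈⟨ *-distribˡ-sum x (λ k → 1ₘ j k * M i k) ⟨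
    x * ∑[ k < n ] (1ₘ j k * M i k)    ≈⟨ *-congˡ (∑-1ₘ j (M i)) ⟩
    x * M i j                          ∎

  1-· : ∀ {m n} (M : Fin m → Fin n → Carrier) i j → (1ₘ · M) i j ≈ M i j
  1-· M i j = ∑-1ₘ i (λ k → M k j)

  ·-1 : ∀ {m n} (M : Fin m → Fin n → Carrier) i j → (M · 1ₘ) i j ≈ M i j
  ·-1 M i j = trans (sum-cong-≋ λ k → trans (*-comm _ _) (*-congʳ (reflexive (1ₘ-sym k j)))) (∑-1ₘ j (M i))

  ·-zero : ∀ {l m n} (M : Fin l → Fin m → Carrier) i j → (M · (λ (_ : Fin m) (_ : Fin n) → 0#)) i j ≈ 0#
  ·-zero M i j = ∑-zero λ k → zeroʳ (M i k)

  ·-neg : ∀ {l m n} (M : Fin l → Fin m → Carrier) (N : Fin m → Fin n → Carrier) i j →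
          (M · (λ k l → - N k l)) i j ≈ - (M · N) i j
  ·-neg {m = m} M N i j = begin
    ∑[ k < m ] (M i k * - N k j)         ≈⟨ sum-cong-≋ (λ k → trans (sym (-‿distribʳ-* (M i k) (N k j))) (sym (-1*x≈-x _))) ⟩
    ∑[ k < m ] (- 1# * (M i k * N k j))  ≈⟨ *-distribˡ-sum (- 1#) (λ k → M i k * N k j) ⟨
    - 1# * (M · N) i j                   ≈⟨ -1*x≈-x _ ⟩
    - (M · N) i j                        ∎

  -- Both sides are the determinant of the product of [[1, V], [U, x]] and [[x, 0], [-U, 1]].
  sylvester : ∀ {m n} (U : Fin n → Fin m → Carrier) (V : Fin m → Fin n → Carrier) x →
    x ^ m * det (λ i j → scalar x i j - (U · V) i j) ≈
    x ^ n * det (λ i j → scalar x i j - (V · U) i j)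
  sylvester {m} {n} U V x = begin
    x ^ m * det x-UV                                ≈⟨ *-comm _ _ ⟩
    det x-UV * x ^ m                                ≈⟨ *-cong (sym detM) (sym detB) ⟩
    det M * det B                                   ≈⟨ det-* M B ⟨
    det (M · B)                                     ≈⟨ det-blockUpper m
      (λ i j → trans (block-·-ˡˡ i j)
        (+-cong (1-· (scalar x) i j) (·-neg V U i j)))
      (λ i j → trans (block-·-ʳˡ i j)
        (trans (+-cong (·-scalar x U i j) (trans (·-neg (scalar x) U i j) (-‿cong (scalar-· x U i j))))
               (-‿inverseʳ _)))
      (λ i j → trans (block-·-ʳʳ {m} {n} {D = scalar x} {D′ = 1ₘ} i j)
        (trans (+-cong (·-zero U i j) (·-1 (scalar x) i j)) (+-identityˡ _))) ⟩
    det x-VU * det {n} (scalar x)                   ≈⟨ *-congˡ (det-scalar n x) ⟩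
    det x-VU * x ^ n                                ≈⟨ *-comm _ _ ⟩
    x ^ n * det x-VU                                ∎
    where
    x-UV : Matrix Carrier n
    x-UV i j = scalar x i j - (U · V) i j

    x-VU : Matrix Carrier m
    x-VU i j = scalar x i j - (V · U) i j

    0ₘ : ∀ {k l} → Fin k → Fin l → Carrier
    0ₘ _ _ = 0#

    M A B : Matrix Carrier (m ℕ.+ n)
    M = block 1ₘ V U (scalar x)
    A = block 1ₘ (λ i j → - V i j) 0ₘ 1ₘ
    B = block (scalar x) 0ₘ (λ i j → - U i j) 1ₘ

    detA : det A ≈ 1#
    detA = trans
      (det-blockUpper m (λ i j → reflexive (block-ˡˡ i j)) (λ i j → reflexive (block-ʳˡ i j)) (λ i j → reflexive (block-ʳʳ {m = m} {n} {D = 1ₘ} i j)))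
      (trans (*-cong (det-1ₘ m) (det-1ₘ n)) (*-identityˡ 1#))

    detB : det B ≈ x ^ m
    detB = trans
      (det-blockLower m (λ i j → reflexive (block-ˡˡ i j)) (λ i j → reflexive (block-ˡʳ i j)) (λ i j → reflexive (block-ʳʳ {m = m} {n} {D = 1ₘ} i j)))
      (trans (*-cong (det-scalar m x) (det-1ₘ n)) (*-identityʳ _))

    detM : det M ≈ det x-UV
    detM = begin
      det M              ≈⟨ *-identityʳ _ ⟨
      det M * 1#         ≈⟨ *-congˡ detA ⟨
      det M * det A      ≈⟨ det-* M A ⟨
      det (M · A)        ≈⟨ det-blockLower m
        (λ i j → trans (block-·-ˡˡ i j) (trans (+-cong (1-· 1ₘ i j) (·-zero V i j)) (+-identityʳ _)))
        (λ i j → trans (block-·-ˡʳ i j)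
          (trans (+-cong (1-· (λ i j → - V i j) i j) (·-1 V i j)) (-‿inverseˡ _)))
        (λ i j → trans (block-·-ʳʳ {m} {n} {D = scalar x} {D′ = 1ₘ} i j)
          (trans (+-cong (·-neg U V i j) (·-1 (scalar x) i j)) (+-comm _ _))) ⟩
      det {m} 1ₘ * det x-UV  ≈⟨ *-congʳ (det-1ₘ m) ⟩
      1# * det x-UV          ≈⟨ *-identityˡ _ ⟩
      det x-UV               ∎

-- Functions on the subsets of a four-element set

-- With this the identities that tie the basis to its dual are settled by evaluation over all
-- subsets.
allSubsets? : ∀ {n p} {P : Pred (Subset n) p} → Decidable P → Dec (∀ T → P T)
allSubsets? {zero}  P? = map′ (λ { P[] [] → P[] }) (λ P → P []) (P? [])
allSubsets? {suc n} P? = map′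
  (λ { (P₀ , P₁) (false ∷ T) → P₀ T ; (P₀ , P₁) (true ∷ T) → P₁ T })
  (λ P → (λ T → P (false ∷ T)) , (λ T → P (true ∷ T)))
  (allSubsets? (λ T → P? (false ∷ T)) ×-dec allSubsets? (λ T → P? (true ∷ T)))

-- Only the raw operations are asked for, so that the same sum can be formed in ℤ, in ℕ, in a ring
-- and among the syntactic polynomials of a solver.
module SubsetSum {c ℓ : Level} (M : RawMonoid c ℓ) where
  open RawMonoid M renaming (_∙_ to _+_)

  ∑ₛ : ∀ {n} → (Subset n → Carrier) → Carrier
  ∑ₛ {zero}  φ = φ []
  ∑ₛ {suc n} φ = ∑ₛ (λ T → φ (false ∷ T)) + ∑ₛ (λ T → φ (true ∷ T))

disjoint : ∀ {n} → Subset n → Subset n → Bool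
disjoint []      []      = true
disjoint (a ∷ T) (b ∷ U) = not (a ∧ b) ∧ disjoint T U

proper : ∀ {n} → Subset n → Bool
proper {n} T = not (∣ T ∣ ≡ᵇ 0) ∧ not (∣ T ∣ ≡ᵇ n)

open MonoidSum ℤₚ.+-0-commutativeMonoid using () renaming (sum to ∑ℤ)
open SubsetSum ℤ.+-0-rawMonoid using () renaming (∑ₛ to ∑ₛℤ)

infix 8 ⟨_,_⟩
⟨_,_⟩ : ∀ {n} → Vec ℤ n → Subset n → ℤ
⟨ []    , []        ⟩ = + 0
⟨ x ∷ χ , true  ∷ T ⟩ = x ℤ.+ ⟨ χ , T ⟩
⟨ x ∷ χ , false ∷ T ⟩ = ⟨ χ , T ⟩

χ₀ χ₁ χ₂ χ₃ : Vec ℤ 4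
χ₀ = + 1 ∷ + 1 ∷ + 1 ∷ + 1 ∷ []
χ₁ = + 1 ∷ + 1 ∷ -[1+ 0 ] ∷ -[1+ 0 ] ∷ []
χ₂ = + 1 ∷ -[1+ 0 ] ∷ + 1 ∷ -[1+ 0 ] ∷ []
χ₃ = + 1 ∷ -[1+ 0 ] ∷ -[1+ 0 ] ∷ + 1 ∷ []

-- On pairs, `together 0F k` for k = 1, 2, 3 are the indicators of the three ways to split four
-- points into two pairs; they have disjoint supports and add up to 1.
together : Fin 4 → Fin 4 → Subset 4 → ℤ
together i j T = if does (lookup T i Boolₚ.≟ lookup T j) then + 1 else + 0

1-2-3 : Fin 3 → ℕ
1-2-3 j = suc (Fin.toℕ j)

2s : Fin 1 → ℕ
2s _ = 2

level₆ : Fin 6 → ℕ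
level₆ = 1-2-3 ⧺ 1-2-3

level₉ : Fin 9 → ℕ
level₉ = 1-2-3 ⧺ level₆

level₁₂ : Fin 12 → ℕ
level₁₂ = 1-2-3 ⧺ level₉

level₁₃ : Fin 13 → ℕ
level₁₃ = 2s ⧺ level₁₂

-- Appended in the same nesting as the blocks of `action`, so that one block after another can be
-- split off the determinant.
level : Fin 14 → ℕ
level = 2s ⧺ level₁₃

-- Each function is meant on the subsets of its level only, a cardinality.  The levels 1, 2, 3
-- each carry the trivial representation of S₄ (from χ₀) and the standard one (from χ₁, χ₂, χ₃,
-- the other characters of the Klein four-group); level 2 carries in addition the 2-dimensional
-- irreducible, spanned modulo the trivial part by the first two functions.
basis : Fin 14 → Subset 4 → ℤ
basis = lookup
  ( together 0F 1F ∷ together 0F 2F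
  ∷ ⟨ χ₀ ,_⟩ ∷ ⟨ χ₀ ,_⟩ ∷ ⟨ χ₀ ,_⟩ ∘ ∁
  ∷ ⟨ χ₁ ,_⟩ ∷ ⟨ χ₁ ,_⟩ ∷ ⟨ χ₁ ,_⟩ ∘ ∁
  ∷ ⟨ χ₂ ,_⟩ ∷ ⟨ χ₂ ,_⟩ ∷ ⟨ χ₂ ,_⟩ ∘ ∁
  ∷ ⟨ χ₃ ,_⟩ ∷ ⟨ χ₃ ,_⟩ ∷ ⟨ χ₃ ,_⟩ ∘ ∁
  ∷ [])

-- The dual basis, multiplied by 8 to make it integral.
dual : Fin 14 → Subset 4 → ℤ
dual = lookup
  ( (λ T → + 4 ℤ.* (together 0F 1F T ℤ.- together 0F 3F T))
  ∷ (λ T → + 4 ℤ.* (together 0F 2F T ℤ.- together 0F 3F T))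
  ∷ 2×⟨ χ₀ ⟩ ∷ (λ T → + 2 ℤ.* together 0F 3F T) ∷ 2×⟨ χ₀ ⟩ ∘ ∁
  ∷ 2×⟨ χ₁ ⟩ ∷ ⟨ χ₁ ,_⟩                         ∷ 2×⟨ χ₁ ⟩ ∘ ∁
  ∷ 2×⟨ χ₂ ⟩ ∷ ⟨ χ₂ ,_⟩                         ∷ 2×⟨ χ₂ ⟩ ∘ ∁
  ∷ 2×⟨ χ₃ ⟩ ∷ ⟨ χ₃ ,_⟩                         ∷ 2×⟨ χ₃ ⟩ ∘ ∁
  ∷ [])
  where
  2×⟨_⟩ : Vec ℤ 4 → Subset 4 → ℤ
  2×⟨ χ ⟩ T = + 2 ℤ.* ⟨ χ , T ⟩

basisAt : Subset 4 → Fin 14 → ℤ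
basisAt T s = if ∣ T ∣ ≡ᵇ level s then basis s T else + 0

-- Eight times the coordinates in `basis` of the indicator of the sets disjoint from `U`, which is
-- column `U` of the disjointness matrix.
coefficient : Fin 14 → Subset 4 → ℤ
coefficient s U = ∑ₛℤ λ T → if (∣ T ∣ ≡ᵇ level s) ∧ disjoint T U then dual s T else + 0

-- The matrix of f ↦ (S ↦ ∑ {f T | T disjoint from S}) in this basis.
pairBlock : Matrix ℤ 1
pairBlock _ _ = + 1

-- Rows and columns stand for the levels 1, 2, 3. The first row of `trivialBlock`: a singleton is
-- disjoint from 3 singletons, from 3 pairs, where `⟨ χ₀ ,_⟩` is 2, and from one triple. In
-- `standardBlock` the entries of the character sum to 0, so its sum over a complement is the
-- negative of the sum over the set. This gives the -1 entries, and -2 because each of the three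
-- other points lies in two of the pairs that avoid a given point.
trivialBlock standardBlock : Matrix ℤ 3
trivialBlock i j = lookup (lookup (
    (+ 3 ∷ + 6 ∷ + 1 ∷ [])
  ∷ (+ 1 ∷ + 1 ∷ + 0 ∷ [])
  ∷ (+ 1 ∷ + 0 ∷ + 0 ∷ []) ∷ []) i) j
standardBlock i j = lookup (lookup (
    (-[1+ 0 ] ∷ -[1+ 1 ] ∷ + 1 ∷ [])
  ∷ (-[1+ 0 ] ∷ -[1+ 0 ] ∷ + 0 ∷ [])
  ∷ (+ 1      ∷ + 0      ∷ + 0 ∷ []) ∷ []) i) j

0ₘ : ∀ {m n} → Fin m → Fin n → ℤ
0ₘ _ _ = + 0

action₆ : Matrix ℤ 6
action₆ = block standardBlock 0ₘ 0ₘ standardBlock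

action₉ : Matrix ℤ 9
action₉ = block standardBlock 0ₘ 0ₘ action₆

action₁₂ : Matrix ℤ 12
action₁₂ = block trivialBlock 0ₘ 0ₘ action₉

-- The lone 1 below the diagonal: each point is avoided by exactly one pair on which
-- `together 0F 2F` is 1, so the image of this function contains `⟨ χ₀ ,_⟩` on level 1 once. The
-- same happens for `together 0F 1F` in `action`, one row further down.
action₁₃ : Matrix ℤ 13
action₁₃ = block pairBlock 0ₘ (λ { 0F _ → + 1 ; (suc _) _ → + 0 }) action₁₂

action : Matrix ℤ 14
action = block pairBlock 0ₘ (λ { 1F _ → + 1 ; 0F _ → + 0 ; (suc (suc _)) _ → + 0 }) action₁₃

-- Expanding a column in the basis and evaluating it gives the column back, times 8. It is confined
-- to proper sets because the basis functions vanish off the levels 1, 2, 3, whereas the empty set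
-- is disjoint from everything.
basisAt·coefficient : ∀ T U → proper T ≡ true → proper U ≡ true →
      ∑ℤ (λ s → basisAt T s ℤ.* coefficient s U) ≡ (if disjoint T U then + 8 else + 0)
basisAt·coefficient = from-yes (allSubsets? λ T → allSubsets? λ U →
  (proper T Boolₚ.≟ true) →-dec (proper U Boolₚ.≟ true) →-dec
  (∑ℤ (λ s → basisAt T s ℤ.* coefficient s U) ℤₚ.≟ (if disjoint T U then + 8 else + 0)))

-- Each set is counted once here. The true multiplicity of a support is constant on the level of
-- `t`, so it comes in afterwards as a factor of the whole column.
coefficient·basisAt : ∀ s t → ∑ₛℤ (λ T → if proper T then coefficient s T ℤ.* basisAt T t else + 0) ≡ + 8 ℤ.* action s t
coefficient·basisAt = from-yes (Finₚ.all? λ s → Finₚ.all? λ t →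
  ∑ₛℤ (λ T → if proper T then coefficient s T ℤ.* basisAt T t else + 0) ℤₚ.≟ + 8 ℤ.* action s t)

-- Characteristic determinants of integer matrices with weighted columns.

module WeightedIntegerMatrix {c ℓ : Level} (S : CommutativeRing c ℓ) (x a : CommutativeRing.Carrier S) where
  open CommutativeRing S hiding (zero)
  open DeterminantProperties S
  open MultiplicativeDeterminant S
  open IntegerCoefficients S using (ι; module Solver)
  open Solver using (Polynomial; solve; _:=_; _:+_; _:*_; :-_; _:-_; _:^_; con)
  open SetoidReasoning setoid

  -- The weight `a ^ w j` is the number of ring elements with a given support of cardinality `w j`,
  -- for `a` = p - 1.
  pencil : ∀ {n} → Matrix ℤ n → (Fin n → ℕ) → Matrix Carrier n
  pencil M w i j = scalar x i j - a ^ w j * ι (M i j)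

  ↑ˡ≢↑ʳ : ∀ {m n} (i : Fin m) (j : Fin n) → i ↑ˡ n ≢ m ↑ʳ j
  ↑ˡ≢↑ʳ (suc i) j eq = ↑ˡ≢↑ʳ i j (Finₚ.suc-injective eq)

  -- Abstract, so that determinants of large concrete matrices are never unfolded.
  abstract
    pencilDet : ∀ {n} → Matrix ℤ n → (Fin n → ℕ) → Carrier
    pencilDet M w = det (pencil M w)

    pencilDet-def : ∀ {n} (M : Matrix ℤ n) w → pencilDet M w ≈ det (pencil M w)
    pencilDet-def M w = refl

  pencilDet-block : ∀ {m n} (A : Matrix ℤ m) B (D : Matrix ℤ n) u v →
    pencilDet (block A 0ₘ B D) (u ⧺ v) ≈ pencilDet A u * pencilDet D v
  pencilDet-block {m} {n} A B D u v = begin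
    pencilDet (block A 0ₘ B D) (u ⧺ v)      ≈⟨ pencilDet-def (block A 0ₘ B D) (u ⧺ v) ⟩
    det (pencil (block A 0ₘ B D) (u ⧺ v))   ≈⟨ det-blockLower m
      (λ i j → entry (1ₘ-injective (Finₚ.↑ˡ-injective n _ _) i j) (lookup-++ˡ u v j) (block-ˡˡ {B = 0ₘ} {B} {D} i j))
      (λ i j → trans (entry (1ₘ-off-diagonal (↑ˡ≢↑ʳ i j)) (lookup-++ʳ u v j) (block-ˡʳ {A = A} {0ₘ} {B} {D} i j))
        (solve 2 (λ x y → x :* con (+ 0) :- y :* con (+ 0) := con (+ 0)) refl x _))
      (λ i j → entry (1ₘ-injective (Finₚ.↑ʳ-injective m _ _) i j) (lookup-++ʳ u v j) (block-ʳʳ {A = A} {0ₘ} {B} i j)) ⟩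
    det (pencil A u) * det (pencil D v)      ≈⟨ *-cong (pencilDet-def A u) (pencilDet-def D v) ⟨
    pencilDet A u * pencilDet D v            ∎
    where
    entry : ∀ {d d′ k k′ z z′} → d ≡ d′ → k ≡ k′ → z ≡ z′ → x * d - a ^ k * ι z ≈ x * d′ - a ^ k′ * ι z′
    entry ≡.refl ≡.refl ≡.refl = refl

  -- Laplace expansion uses raw ring operations only, so it can be run on the syntax of the solver.
  -- The small determinants then become ordinary ring identities in two variables.
  polynomialRawRing : ℕ → RawRing 0ℓ 0ℓ
  polynomialRawRing n = record
    { Carrier = Polynomial n
    ; _≈_     = _≡_
    ; _+_     = _:+_
    ; _*_     = _:*_
    ; -_      = :-_
    ; 0#      = con (+ 0)
    ; 1#      = con (+ 1)
    }

  detₚ : ∀ {n} → Matrix ℤ n → (Fin n → ℕ) → Polynomial 2 → Polynomial 2 → Polynomial 2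
  detₚ M w x a = Determinant.det (polynomialRawRing 2) λ i j →
    x :* (if does (i Finₚ.≟ j) then con (+ 1) else con (+ 0)) :- a :^ w j :* con (M i j)

  -- For `a` = p - 1 the roots are λ₁ for `r`, λ₂ for `r₊`, λ₃ and λ₄ for `r₁`, λ₅ and λ₆ for `r₃`.
  r r₊ r₁ r₃ : Carrier
  r  = x - a * a
  r₊ = x + a * a
  r₁ = x * x + (a + (a * a + a * a)) * x + a * a * (a * a)
  r₃ = x * x - (a + a + a + (a * a + a * a)) * x + a * a * (a * a)

  det-pairBlock : pencilDet pairBlock 2s ≈ r
  det-pairBlock = trans (pencilDet-def pairBlock 2s) (solve 2 (λ x a → detₚ pairBlock 2s x a := x :- a :* a) refl x a)

  det-trivialBlock : pencilDet trivialBlock 1-2-3 ≈ r₊ * r₃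
  det-trivialBlock = trans (pencilDet-def trivialBlock 1-2-3) (solve 2 (λ x a → detₚ trivialBlock 1-2-3 x a :=
    (x :+ a :* a) :* (x :* x :- (a :+ a :+ a :+ (a :* a :+ a :* a)) :* x :+ a :* a :* (a :* a))) refl x a)

  det-standardBlock : pencilDet standardBlock 1-2-3 ≈ r * r₁
  det-standardBlock = trans (pencilDet-def standardBlock 1-2-3) (solve 2 (λ x a → detₚ standardBlock 1-2-3 x a :=
    (x :- a :* a) :* (x :* x :+ (a :+ (a :* a :+ a :* a)) :* x :+ a :* a :* (a :* a))) refl x a)

  -- The multiplicity 5 of λ₁ arises from two sources: the two functions `together` and the three
  -- copies of the standard block.
  det-action : pencilDet action level ≈ r * (r * (r₊ * r₃ * (r * r₁ * (r * r₁ * (r * r₁)))))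
  det-action =
    trans (pencilDet-block pairBlock _ action₁₃ 2s level₁₃) (*-cong det-pairBlock
      (trans (pencilDet-block pairBlock _ action₁₂ 2s level₁₂) (*-cong det-pairBlock
        (trans (pencilDet-block trivialBlock _ action₉ 1-2-3 level₉) (*-cong det-trivialBlock
          (trans (pencilDet-block standardBlock _ action₆ 1-2-3 level₆) (*-cong det-standardBlock
            (trans (pencilDet-block standardBlock _ standardBlock 1-2-3 1-2-3) (*-cong det-standardBlock det-standardBlock)))))))))

-- Sums over digit vectors, grouped by support.

nonzero : ∀ {n} → Fin (suc n) → Bool
nonzero zero    = false
nonzero (suc _) = true

support : ∀ {n a} → (Fin n → Fin (suc a)) → Subset n
support f = Vec.tabulate (nonzero ∘ f)

support-cong : ∀ {n a} {f g : Fin n → Fin (suc a)} → f ≗ g → support f ≡ support g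
support-cong f≗g = Vecₚ.tabulate-cong (≡.cong nonzero ∘ f≗g)

module SummationOverSupports {c ℓ : Level} (M : CommutativeMonoid c ℓ) where
  open CommutativeMonoid M renaming (_∙_ to _+_; ε to 0#; ∙-cong to +-cong; ∙-congˡ to +-congˡ; identityˡ to +-identityˡ)
  open MonoidSum M using (sum; sum-syntax; sum-cong-≋; sum-cong-≗; sum-replicate)
  open MonoidMult M renaming (_×_ to _×ₘ_)
  open FiniteSums M using (∑-combine)
  open SubsetSum rawMonoid
  open SetoidReasoning setoid

  ∑ₛ-cong : ∀ {n} {φ ψ : Subset n → Carrier} → (∀ T → φ T ≈ ψ T) → ∑ₛ φ ≈ ∑ₛ ψ
  ∑ₛ-cong {zero}  φ≈ψ = φ≈ψ []
  ∑ₛ-cong {suc n} φ≈ψ = +-cong (∑ₛ-cong λ T → φ≈ψ (false ∷ T)) (∑ₛ-cong λ T → φ≈ψ (true ∷ T))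

  ×-∑ₛ : ∀ {n} k (φ : Subset n → Carrier) → k ×ₘ ∑ₛ φ ≈ ∑ₛ λ T → k ×ₘ φ T
  ×-∑ₛ {zero}  k φ = refl
  ×-∑ₛ {suc n} k φ = trans (×-distrib-+ _ _ k) (+-cong (×-∑ₛ {n} k _) (×-∑ₛ {n} k _))

  -- Vertices are positions in a filtered list. Moving the test into the summand replaces them by
  -- the whole enumeration, which can be reindexed.
  ∑-filter : ∀ {a p} {A : Set a} {P : Pred A p} (P? : Decidable P) {n} (f : Fin n → A) (g : A → Carrier) →
             (let xs = filter P? (List.tabulate f)) →
             ∑[ i < List.length xs ] g (List.lookup xs i) ≈ ∑[ i < n ] (if does (P? (f i)) then g (f i) else 0#)
  ∑-filter P? {zero}  f g = refl
  ∑-filter P? {suc n} f g with does (P? (f zero))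
  ... | true  = +-congˡ (∑-filter P? (f ∘ suc) g)
  ... | false = trans (∑-filter P? (f ∘ suc) g) (sym (+-identityˡ _))

  -- The first digit is either 0 or one of `a` nonzero values that `φ` cannot tell apart; each
  -- member of the support thus contributes one factor `a`.
  ∑-support : ∀ {a} n (φ : Subset n → Carrier) →
              ∑[ k < suc a ℕ.^ n ] φ (support (finToFun {suc a} {n} k)) ≈ ∑ₛ λ T → (a ℕ.^ ∣ T ∣) ×ₘ φ T
  ∑-support     zero    φ = refl
  ∑-support {a} (suc n) φ = begin
    ∑[ k < suc a ℕ.^ suc n ] φ (support (finToFun {suc a} {suc n} k))
      ≈⟨ ∑-combine (suc a) (φ ∘ support ∘ finToFun {suc a} {suc n}) ⟩
    ∑[ i < suc a ] ∑[ k < suc a ℕ.^ n ] φ (support (finToFun {suc a} {suc n} (combine i k)))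
      ≡⟨ sum-cong-≗ (λ i → sum-cong-≗ (λ k → ≡.cong φ (≡.cong₂ _∷_
           (≡.cong (nonzero ∘ proj₁) (Finₚ.remQuot-combine i k))
           (≡.cong (support ∘ finToFun {suc a} {n} ∘ proj₂) (Finₚ.remQuot-combine i k))))) ⟩
    ∑[ i < suc a ] ∑[ k < suc a ℕ.^ n ] φ (nonzero i ∷ support (finToFun {suc a} {n} k))
      ≈⟨ sum-cong-≋ {suc a} (λ i → ∑-support {a} n (φ ∘ (nonzero i ∷_))) ⟩
    ∑ₛ (λ T → (a ℕ.^ ∣ T ∣) ×ₘ φ (false ∷ T)) + ∑[ i < a ] ∑ₛ (λ T → (a ℕ.^ ∣ T ∣) ×ₘ φ (true ∷ T))
      ≈⟨ +-congˡ (trans (sum-replicate a {∑ₛ ψ}) (trans (×-∑ₛ a ψ) (∑ₛ-cong λ T → ×-assocˡ (φ (true ∷ T)) a (a ℕ.^ ∣ T ∣)))) ⟩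
    ∑ₛ (λ T → (a ℕ.^ ∣ T ∣) ×ₘ φ T) ∎
    where
    ψ : Subset n → Carrier
    ψ T = (a ℕ.^ ∣ T ∣) ×ₘ φ (true ∷ T)

-- The polynomial ring

module PolynomialRing {c ℓ : Level} (K : CommutativeRing c ℓ) where
  open CommutativeRing K hiding (zero)
  open Polynomial rawRing
  open IntegerCoefficients K using (module Solver; -0≈0)
  open Solver using (solve; _:=_; _:+_; _:*_)
  open SetoidReasoning setoid

  -- Equality of polynomials ignores trailing zeros, so the ring laws are proved for coefficient
  -- sequences, where lengths do not exist, and carried back along `coeff`.
  convolution : (ℕ → Carrier) → (ℕ → Carrier) → ℕ → Carrier
  convolution u v zero    = u 0 * v 0
  convolution u v (suc k) = u 0 * v (suc k) + convolution (u ∘ suc) v k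

  convolution-cong : ∀ {u u′ v v′} → (∀ k → u k ≈ u′ k) → (∀ k → v k ≈ v′ k) →
                     ∀ k → convolution u v k ≈ convolution u′ v′ k
  convolution-cong u≈u′ v≈v′ zero    = *-cong (u≈u′ 0) (v≈v′ 0)
  convolution-cong u≈u′ v≈v′ (suc k) =
    +-cong (*-cong (u≈u′ 0) (v≈v′ (suc k))) (convolution-cong (u≈u′ ∘ suc) v≈v′ k)

  convolution-zeroˡ : ∀ v k → convolution (λ _ → 0#) v k ≈ 0#
  convolution-zeroˡ v zero    = zeroˡ (v 0)
  convolution-zeroˡ v (suc k) = trans (+-cong (zeroˡ _) (convolution-zeroˡ v k)) (+-identityˡ 0#)

  convolution-distribʳ : ∀ u u′ v k → convolution (λ i → u i + u′ i) v k ≈ convolution u v k + convolution u′ v k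
  convolution-distribʳ u u′ v zero    = distribʳ _ _ _
  convolution-distribʳ u u′ v (suc k) = trans (+-congˡ (convolution-distribʳ (u ∘ suc) (u′ ∘ suc) v k))
    (solve 5 (λ a b w x y → (a :+ b) :* w :+ (x :+ y) := (a :* w :+ x) :+ (b :* w :+ y)) refl (u 0) (u′ 0) (v (suc k)) _ _)

  convolution-scaleˡ : ∀ x u v k → convolution (λ i → x * u i) v k ≈ x * convolution u v k
  convolution-scaleˡ x u v zero    = *-assoc _ _ _
  convolution-scaleˡ x u v (suc k) = trans (+-congˡ (convolution-scaleˡ x (u ∘ suc) v k))
    (solve 4 (λ x a w y → x :* a :* w :+ x :* y := x :* (a :* w :+ y)) refl x (u 0) (v (suc k)) _)

  -- Peeling from the other end than the definition does; commutativity compares the two ends.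
  convolution-last : ∀ u v k → convolution u v (suc k) ≈ convolution u (v ∘ suc) k + u (suc k) * v 0
  convolution-last u v zero    = refl
  convolution-last u v (suc k) = trans (+-congˡ (convolution-last (u ∘ suc) v k)) (sym (+-assoc _ _ _))

  convolution-comm : ∀ u v k → convolution u v k ≈ convolution v u k
  convolution-comm u v zero    = *-comm _ _
  convolution-comm u v (suc k) = begin
    u 0 * v (suc k) + convolution (u ∘ suc) v k  ≈⟨ +-cong (*-comm _ _) (convolution-comm (u ∘ suc) v k) ⟩
    v (suc k) * u 0 + convolution v (u ∘ suc) k  ≈⟨ +-comm _ _ ⟩
    convolution v (u ∘ suc) k + v (suc k) * u 0  ≈⟨ convolution-last v u k ⟨
    convolution v u (suc k)                      ∎

  convolution-assoc : ∀ u v w k → convolution (convolution u v) w k ≈ convolution u (convolution v w) k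
  convolution-assoc u v w zero    = *-assoc _ _ _
  convolution-assoc u v w (suc k) = begin
    u 0 * v 0 * w (suc k) + convolution (λ i → u 0 * v (suc i) + convolution (u ∘ suc) v i) w k
      ≈⟨ +-congˡ (trans (convolution-distribʳ _ _ w k) (+-cong (convolution-scaleˡ (u 0) (v ∘ suc) w k) (convolution-assoc (u ∘ suc) v w k))) ⟩
    u 0 * v 0 * w (suc k) + (u 0 * convolution (v ∘ suc) w k + convolution (u ∘ suc) (convolution v w) k)
      ≈⟨ solve 5 (λ a b c y z → a :* b :* c :+ (a :* y :+ z) := a :* (b :* c :+ y) :+ z) refl (u 0) (v 0) (w (suc k)) _ _ ⟩
    u 0 * convolution v w (suc k) + convolution (u ∘ suc) (convolution v w) k ∎

  coeff-⊕ : ∀ f g k → coeff (f ⊕ g) k ≈ coeff f k + coeff g k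
  coeff-⊕ []      g       k       = sym (+-identityˡ _)
  coeff-⊕ (a ∷ f) []      k       = sym (+-identityʳ _)
  coeff-⊕ (a ∷ f) (b ∷ g) zero    = refl
  coeff-⊕ (a ∷ f) (b ∷ g) (suc k) = coeff-⊕ f g k

  coeff-scale : ∀ x f k → coeff (List.map (x *_) f) k ≈ x * coeff f k
  coeff-scale x []      k       = sym (zeroʳ x)
  coeff-scale x (a ∷ f) zero    = refl
  coeff-scale x (a ∷ f) (suc k) = coeff-scale x f k

  coeff-⊖ : ∀ f k → coeff (⊖ f) k ≈ - coeff f k
  coeff-⊖ []      k       = sym -0≈0
  coeff-⊖ (a ∷ f) zero    = refl
  coeff-⊖ (a ∷ f) (suc k) = coeff-⊖ f k

  coeff-⊛ : ∀ f g k → coeff (f ⊛ g) k ≈ convolution (coeff f) (coeff g) k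
  coeff-⊛ []      g k       = sym (convolution-zeroˡ (coeff g) k)
  coeff-⊛ (a ∷ f) g zero    = trans (coeff-⊕ (List.map (a *_) g) _ 0) (trans (+-identityʳ _) (coeff-scale a g 0))
  coeff-⊛ (a ∷ f) g (suc k) = trans (coeff-⊕ (List.map (a *_) g) _ (suc k)) (+-cong (coeff-scale a g (suc k)) (coeff-⊛ f g k))

  convolution-identityˡ : ∀ v k → convolution (coeff (constant 1#)) v k ≈ v k
  convolution-identityˡ v zero    = *-identityˡ _
  convolution-identityˡ v (suc k) = trans (+-cong (*-identityˡ _) (convolution-zeroˡ v k)) (+-identityʳ _)

  private
    via-⊕ : ∀ f g f′ g′ {k} → coeff f k + coeff g k ≈ coeff f′ k + coeff g′ k → coeff (f ⊕ g) k ≈ coeff (f′ ⊕ g′) k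
    via-⊕ f g f′ g′ eq = trans (coeff-⊕ f g _) (trans eq (sym (coeff-⊕ f′ g′ _)))

    via-⊛ : ∀ f g f′ g′ {k} → convolution (coeff f) (coeff g) k ≈ convolution (coeff f′) (coeff g′) k →
            coeff (f ⊛ g) k ≈ coeff (f′ ⊛ g′) k
    via-⊛ f g f′ g′ {k} eq = trans (coeff-⊛ f g k) (trans eq (sym (coeff-⊛ f′ g′ k)))

  ⊛-comm : ∀ f g → f ⊛ g ≋ g ⊛ f
  ⊛-comm f g k = via-⊛ f g g f (convolution-comm (coeff f) (coeff g) k)

  ⊛-identityˡ : ∀ f → constant 1# ⊛ f ≋ f
  ⊛-identityˡ f k = trans (coeff-⊛ (constant 1#) f k) (convolution-identityˡ (coeff f) k)

  ⊛-distribʳ : ∀ f g h → (g ⊕ h) ⊛ f ≋ g ⊛ f ⊕ h ⊛ f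
  ⊛-distribʳ f g h k = begin
    coeff ((g ⊕ h) ⊛ f) k                                             ≈⟨ coeff-⊛ (g ⊕ h) f k ⟩
    convolution (coeff (g ⊕ h)) (coeff f) k                           ≈⟨ convolution-cong (coeff-⊕ g h) (λ _ → refl) k ⟩
    convolution (λ i → coeff g i + coeff h i) (coeff f) k             ≈⟨ convolution-distribʳ (coeff g) (coeff h) (coeff f) k ⟩
    convolution (coeff g) (coeff f) k + convolution (coeff h) (coeff f) k ≈⟨ +-cong (coeff-⊛ g f k) (coeff-⊛ h f k) ⟨
    coeff (g ⊛ f) k + coeff (h ⊛ f) k                                 ≈⟨ coeff-⊕ (g ⊛ f) (h ⊛ f) k ⟨
    coeff (g ⊛ f ⊕ h ⊛ f) k                                           ∎

  ⊛-assoc : ∀ f g h → (f ⊛ g) ⊛ h ≋ f ⊛ (g ⊛ h)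
  ⊛-assoc f g h k = via-⊛ (f ⊛ g) h f (g ⊛ h) (begin
    convolution (coeff (f ⊛ g)) (coeff h) k                           ≈⟨ convolution-cong (coeff-⊛ f g) (λ _ → refl) k ⟩
    convolution (convolution (coeff f) (coeff g)) (coeff h) k         ≈⟨ convolution-assoc (coeff f) (coeff g) (coeff h) k ⟩
    convolution (coeff f) (convolution (coeff g) (coeff h)) k         ≈⟨ convolution-cong (λ _ → refl) (coeff-⊛ g h) k ⟨
    convolution (coeff f) (coeff (g ⊛ h)) k                           ∎)

  ⊕-comm : ∀ f g → f ⊕ g ≋ g ⊕ f
  ⊕-comm f g k = via-⊕ f g g f (+-comm _ _)

  ⊕-inverseˡ : ∀ f → (⊖ f) ⊕ f ≋ []
  ⊕-inverseˡ f k = trans (coeff-⊕ (⊖ f) f k) (trans (+-congʳ (coeff-⊖ f k)) (-‿inverseˡ _))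

  polynomialRing : CommutativeRing c ℓ
  polynomialRing = record
    { Carrier = Poly
    ; _≈_     = _≋_
    ; _+_     = _⊕_
    ; _*_     = _⊛_
    ; -_      = ⊖_
    ; 0#      = []
    ; 1#      = constant 1#
    ; isCommutativeRing = record
      { isRing = record
        { +-isAbelianGroup = record
          { isGroup = record
            { isMonoid = record
              { isSemigroup = record
                { isMagma = record
                  { isEquivalence = record
                    { refl  = λ _ → refl
                    ; sym   = λ f≋g k → sym (f≋g k)
                    ; trans = λ f≋g g≋h k → trans (f≋g k) (g≋h k)
                    }
                  ; ∙-cong = λ {f} {f′} {g} {g′} f≋f′ g≋g′ k → via-⊕ f g f′ g′ (+-cong (f≋f′ k) (g≋g′ k))
                  }
                ; assoc = λ f g h k → via-⊕ (f ⊕ g) h f (g ⊕ h)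
                    (trans (+-congʳ (coeff-⊕ f g k)) (trans (+-assoc _ _ _) (+-congˡ (sym (coeff-⊕ g h k)))))
                }
              ; identity = (λ f k → refl) , (λ f k → trans (coeff-⊕ f [] k) (+-identityʳ _))
              }
            ; inverse = ⊕-inverseˡ , (λ f k → trans (⊕-comm f (⊖ f) k) (⊕-inverseˡ f k))
            ; ⁻¹-cong = λ {f} {g} f≋g k → trans (coeff-⊖ f k) (trans (-‿cong (f≋g k)) (sym (coeff-⊖ g k)))
            }
          ; comm = ⊕-comm
          }
        ; *-cong     = λ {f} {f′} {g} {g′} f≋f′ g≋g′ k → via-⊛ f g f′ g′ (convolution-cong f≋f′ g≋g′ k)
        ; *-assoc    = ⊛-assoc
        ; *-identity = ⊛-identityˡ , (λ f k → trans (⊛-comm f (constant 1#) k) (⊛-identityˡ f k))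
        ; distrib    = (λ f g h k → trans (⊛-comm f (g ⊕ h) k) (trans (⊛-distribʳ f g h k)
                          (via-⊕ (g ⊛ f) (h ⊛ f) (f ⊛ g) (f ⊛ h) (+-cong (⊛-comm g f k) (⊛-comm h f k)))))
                     , ⊛-distribʳ
        }
      ; *-comm = ⊛-comm
      }
    }

  constant-* : ∀ x y → constant (x * y) ≋ constant x ⊛ constant y
  constant-* x y zero    = sym (+-identityʳ _)
  constant-* x y (suc k) = refl

  constant-0 : constant 0# ≋ []
  constant-0 zero    = refl
  constant-0 (suc k) = refl

  constant-cong : ∀ {x y} → x ≈ y → constant x ≋ constant y
  constant-cong x≈y zero    = x≈y
  constant-cong x≈y (suc k) = refl

  -- Multiplication by `X` shifts the coefficients by one place, so nothing about zero divisors
  -- among them is involved. This removes the power of `X` left over by Sylvester's identity.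
  X-cancelˡ : ∀ f g → X ⊛ f ≋ X ⊛ g → f ≋ g
  X-cancelˡ f g Xf≋Xg k = trans (sym (shift f)) (trans (Xf≋Xg (suc k)) (shift g))
    where
    shift : ∀ f → coeff (X ⊛ f) (suc k) ≈ coeff f k
    shift f = trans (coeff-⊛ X f (suc k)) (trans (+-congʳ (zeroˡ _)) (trans (+-identityˡ _) (convolution-identityˡ (coeff f) k)))

-- Supports of zero-divisors

-- Replaces tests that search the enumeration of the ring, for adjacency and for being a vertex, by
-- bits computed from supports.
does≡ : ∀ {p} {P : Set p} (P? : Dec P) {b} → (P → b ≡ true) → (b ≡ true → P) → does P? ≡ b
does≡ (yes p) f g = ≡.sym (f p)
does≡ (no ¬p) {true}  f g = contradiction (g ≡.refl) ¬p
does≡ (no ¬p) {false} f g = ≡.refl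

module _ {a : ℕ} where
  disjoint-support⁺ : ∀ {n} {f g : Fin n → Fin (suc a)} → (∀ i → f i ≡ zero ⊎ g i ≡ zero) →
                      disjoint (support f) (support g) ≡ true
  disjoint-support⁺ {zero}          f⊎g = ≡.refl
  disjoint-support⁺ {suc n} {f} {g} f⊎g with f zero | g zero | f⊎g zero
  ... | zero  | _    | _              = disjoint-support⁺ (f⊎g ∘ suc)
  ... | suc _ | zero | _              = disjoint-support⁺ (f⊎g ∘ suc)
  ... | suc _ | suc _ | inj₁ ()
  ... | suc _ | suc _ | inj₂ ()

  disjoint-support⁻ : ∀ {n} {f g : Fin n → Fin (suc a)} → disjoint (support f) (support g) ≡ true →
                      ∀ i → f i ≡ zero ⊎ g i ≡ zero
  disjoint-support⁻ {suc n} {f} {g} d i with f zero in f₀ | g zero in g₀ | i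
  ... | zero  | _    | zero  = inj₁ f₀
  ... | zero  | _    | suc i = disjoint-support⁻ d i
  ... | suc _ | zero | zero  = inj₂ g₀
  ... | suc _ | zero | suc i = disjoint-support⁻ d i

  ∣support∣≡0⁺ : ∀ {n} {f : Fin n → Fin (suc a)} → (∀ i → f i ≡ zero) → ∣ support f ∣ ≡ 0
  ∣support∣≡0⁺ {zero}      f≡0 = ≡.refl
  ∣support∣≡0⁺ {suc n} {f} f≡0 with f zero | f≡0 zero
  ... | zero | _ = ∣support∣≡0⁺ (f≡0 ∘ suc)

  ∣support∣≡0⁻ : ∀ {n} {f : Fin n → Fin (suc a)} → ∣ support f ∣ ≡ 0 → ∀ i → f i ≡ zero
  ∣support∣≡0⁻ {suc n} {f} eq i with f zero in f₀ | i
  ... | zero | zero  = f₀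
  ... | zero | suc i = ∣support∣≡0⁻ eq i

disjoint-full : ∀ {n} {T U : Subset n} → disjoint T U ≡ true → ∣ T ∣ ≡ n → ∣ U ∣ ≡ 0
disjoint-full {T = []}        {[]}        _ _    = ≡.refl
disjoint-full {T = true ∷ T}  {false ∷ U} d ∣T∣≡n = disjoint-full {T = T} {U} d (ℕₚ.suc-injective ∣T∣≡n)
disjoint-full {T = false ∷ T} {U}         _ ∣T∣≡n =
  contradiction ∣T∣≡n (ℕₚ.<⇒≢ (ℕ.s≤s (Subsetₚ.∣p∣≤n T)))

disjoint-∁ : ∀ {n} (T : Subset n) → disjoint T (∁ T) ≡ true
disjoint-∁ []          = ≡.refl
disjoint-∁ (true ∷ T)  = disjoint-∁ T
disjoint-∁ (false ∷ T) = disjoint-∁ T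

proper⁺ : ∀ {n} {T : Subset n} → ∣ T ∣ ≢ 0 → ∣ T ∣ ≢ n → proper T ≡ true
proper⁺ {n} {T} ≢0 ≢n = ≡.cong₂ _∧_ (≢⇒ ≢0) (≢⇒ ≢n)
  where
  ≢⇒ : ∀ {k} → ∣ T ∣ ≢ k → not (∣ T ∣ ≡ᵇ k) ≡ true
  ≢⇒ {k} ≢k with ∣ T ∣ ≡ᵇ k in eq
  ... | true  = contradiction (ℕₚ.≡ᵇ⇒≡ _ k (≡.subst Bool.T (≡.sym eq) _)) ≢k
  ... | false = ≡.refl

proper⁻ : ∀ {n} {T : Subset n} → proper T ≡ true → ∣ T ∣ ≢ 0 × ∣ T ∣ ≢ n
proper⁻ {n} {T} eq with ∣ T ∣ ≡ᵇ 0 in eq₀ | ∣ T ∣ ≡ᵇ n in eqₙ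
... | false | false = ≢⇐ eq₀ , ≢⇐ eqₙ
  where
  ≢⇐ : ∀ {k} → (∣ T ∣ ≡ᵇ k) ≡ false → ∣ T ∣ ≢ k
  ≢⇐ {k} eq ≡k = ≡.subst Bool.T eq (ℕₚ.≡⇒≡ᵇ _ k ≡k)

funToFin-cong : ∀ {m n} {f g : Fin m → Fin n} → f ≗ g → funToFin f ≡ funToFin g
funToFin-cong {zero}  f≗g = ≡.refl
funToFin-cong {suc m} f≗g = ≡.cong₂ combine (f≗g zero) (funToFin-cong (f≗g ∘ suc))

-- Canonical representatives modulo n.

module Residues (n : ℕ) .{{_ : ℕ.NonZero n}} where
  open CommutativeRing (ℤ/ n) using (_≈_; sym; trans)

  residue : ℤ → Fin n
  residue z = fromℕ< (n%ℕd<d z n)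

  toℕ-residue : ∀ z → + toℕ (residue z) ≈ z
  toℕ-residue z = sym {z} {+ toℕ (residue z)} (ℤ∣.divides q (begin
    z ℤ.- + toℕ (residue z)          ≡⟨ ≡.cong (λ k → z ℤ.- + k) (Finₚ.toℕ-fromℕ< _) ⟩
    z ℤ.- r                          ≡⟨ ≡.cong (ℤ._- r) (≡.trans (a≡a%ℕn+[a/ℕn]*n z n) (ℤₚ.+-comm r (q ℤ.* + n))) ⟩
    q ℤ.* + n ℤ.+ r ℤ.- r            ≡⟨ ℤₚ.+-assoc (q ℤ.* + n) r (ℤ.- r) ⟩
    q ℤ.* + n ℤ.+ (r ℤ.- r)          ≡⟨ ≡.cong (ℤ._+_ (q ℤ.* + n)) (ℤₚ.+-inverseʳ r) ⟩
    q ℤ.* + n ℤ.+ + 0                ≡⟨ ℤₚ.+-identityʳ _ ⟩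
    q ℤ.* + n                        ∎))
    where
    open ≡.≡-Reasoning
    q r : ℤ
    q = z /ℕ n
    r = + (z %ℕ n)

  private
    ≤∧≈⇒≡ : ∀ {i j : Fin n} → toℕ j ℕ.≤ toℕ i → + toℕ i ≈ + toℕ j → i ≡ j
    ≤∧≈⇒≡ {i} {j} j≤i i≈j = Finₚ.toℕ-injective (ℕₚ.≤-antisym (ℕₚ.m∸n≡0⇒m≤n (small _ i∸j<n n∣i∸j)) j≤i)
      where
      n∣i∸j : n ℕ∣.∣ toℕ i ℕ.∸ toℕ j
      n∣i∸j = ≡.subst (n ℕ∣.∣_) (≡.cong ℤ.∣_∣ (≡.trans (ℤₚ.m-n≡m⊖n (toℕ i) (toℕ j)) (ℤₚ.⊖-≥ j≤i))) (ℤ∣.∣⇒∣ᵤ i≈j)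
      i∸j<n : toℕ i ℕ.∸ toℕ j ℕ.< n
      i∸j<n = ℕₚ.≤-<-trans (ℕₚ.m∸n≤m (toℕ i) (toℕ j)) (Finₚ.toℕ<n i)
      small : ∀ d → d ℕ.< n → n ℕ∣.∣ d → d ≡ 0
      small zero    _   _   = ≡.refl
      small (suc d) d<n n∣d = contradiction n∣d (ℕ∣.>⇒∤ d<n)

  toℕ-injective-≈ : ∀ {i j : Fin n} → + toℕ i ≈ + toℕ j → i ≡ j
  toℕ-injective-≈ {i} {j} i≈j with ℕₚ.≤-total (toℕ j) (toℕ i)
  ... | inj₁ j≤i = ≤∧≈⇒≡ j≤i i≈j
  ... | inj₂ i≤j = ≡.sym (≤∧≈⇒≡ i≤j (sym {+ toℕ i} {+ toℕ j} i≈j))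

  residue-cong : ∀ {x y} → x ≈ y → residue x ≡ residue y
  residue-cong {x} {y} x≈y = toℕ-injective-≈
    (trans {+ toℕ (residue x)} {x} {+ toℕ (residue y)} (toℕ-residue x)
      (trans {x} {y} {+ toℕ (residue y)} x≈y (sym {+ toℕ (residue y)} {y} (toℕ-residue y))))

  residue-toℕ : ∀ i → residue (+ toℕ i) ≡ i
  residue-toℕ i = toℕ-injective-≈ (toℕ-residue (+ toℕ i))

-- Vertices and adjacency of the graph in terms of supports.

module ZeroDivisorsOfFourthPower {c ℓ : Level} (a : ℕ) (isPrime : Prime (suc a)) (R : FiniteCommutativeRing c ℓ)
  (iso : FiniteCommutativeRing.commutativeRing R ≅ ℤ/ (suc a) ×ᴿ ℤ/ (suc a) ×ᴿ ℤ/ (suc a) ×ᴿ ℤ/ (suc a)) where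

  private
    p : ℕ
    p = suc a
    module Z = CommutativeRing (ℤ/ p)
    Q : CommutativeRing _ _
    Q = ℤ/ p ×ᴿ ℤ/ p ×ᴿ ℤ/ p ×ᴿ ℤ/ p
    module Q = CommutativeRing Q

  open FiniteCommutativeRing R hiding (zero)
  open ZeroDivisorGraph R
  open RingMorphisms rawRing Q.rawRing using (module IsRingIsomorphism)
  open Residues p

  φ : Carrier → Q.Carrier
  φ = proj₁ iso
  open IsRingIsomorphism (proj₂ iso) using (injective; surjective; *-homo; 0#-homo) renaming (⟦⟧-cong to φ-cong)

  coordinate : Q.Carrier → Fin 4 → ℤ
  coordinate (x , _ , _ , _) 0F = x
  coordinate (_ , x , _ , _) 1F = x
  coordinate (_ , _ , x , _) 2F = x
  coordinate (_ , _ , _ , x) 3F = x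

  coordinate-cong : ∀ {x y} → x Q.≈ y → ∀ i → coordinate x i Z.≈ coordinate y i
  coordinate-cong (eq , _ , _ , _) 0F = eq
  coordinate-cong (_ , eq , _ , _) 1F = eq
  coordinate-cong (_ , _ , eq , _) 2F = eq
  coordinate-cong (_ , _ , _ , eq) 3F = eq

  coordinate-injective : ∀ {x y} → (∀ i → coordinate x i Z.≈ coordinate y i) → x Q.≈ y
  coordinate-injective eq = eq 0F , eq 1F , eq 2F , eq 3F

  coordinate-* : ∀ x y i → coordinate (x Q.* y) i ≡ coordinate x i ℤ.* coordinate y i
  coordinate-* x y 0F = ≡.refl
  coordinate-* x y 1F = ≡.refl
  coordinate-* x y 2F = ≡.refl
  coordinate-* x y 3F = ≡.refl

  coordinate-0 : ∀ i → coordinate Q.0# i ≡ + 0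
  coordinate-0 0F = ≡.refl
  coordinate-0 1F = ≡.refl
  coordinate-0 2F = ≡.refl
  coordinate-0 3F = ≡.refl

  digits : Carrier → Fin 4 → Fin p
  digits x i = residue (coordinate (φ x) i)

  digits-cong : ∀ {x y} → x ≈ y → digits x ≗ digits y
  digits-cong {x} {y} x≈y i = residue-cong {coordinate (φ x) i} {coordinate (φ y) i} (coordinate-cong (φ-cong x≈y) i)

  digits-injective : ∀ {x y} → digits x ≗ digits y → x ≈ y
  digits-injective {x} {y} eq = injective (coordinate-injective λ i →
    Z.trans {coordinate (φ x) i} {+ toℕ (digits x i)} {coordinate (φ y) i}
      (Z.sym {+ toℕ (digits x i)} {coordinate (φ x) i} (toℕ-residue (coordinate (φ x) i)))
      (≡.subst (λ k → + toℕ k Z.≈ coordinate (φ y) i) (≡.sym (eq i)) (toℕ-residue (coordinate (φ y) i))))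

  fromDigits : (Fin 4 → Fin p) → Carrier
  fromDigits f = proj₁ (surjective (+ toℕ (f 0F) , + toℕ (f 1F) , + toℕ (f 2F) , + toℕ (f 3F)))

  digits-fromDigits : ∀ f → digits (fromDigits f) ≗ f
  digits-fromDigits f i = ≡.trans
    (residue-cong {coordinate (φ (fromDigits f)) i} {coordinate y i} (coordinate-cong (proj₂ (surjective y) refl) i))
    (≡.trans (≡.cong residue (coordinate-y i)) (residue-toℕ (f i)))
    where
    y : Q.Carrier
    y = + toℕ (f 0F) , + toℕ (f 1F) , + toℕ (f 2F) , + toℕ (f 3F)
    coordinate-y : ∀ i → coordinate y i ≡ + toℕ (f i)
    coordinate-y 0F = ≡.refl
    coordinate-y 1F = ≡.refl
    coordinate-y 2F = ≡.refl
    coordinate-y 3F = ≡.refl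

  -- The given enumeration of the ring is arbitrary; this bijection lets a sum over it run over
  -- digit vectors in their standard order.
  code : Permutation size (p ℕ.^ 4)
  code = permutation
    (λ j → funToFin (digits (element j)))
    (λ k → index (fromDigits (finToFun {p} {4} k)))
    (λ k → ≡.trans
      (funToFin-cong λ i → ≡.trans (digits-cong (element-index (fromDigits (finToFun {p} {4} k))) i) (digits-fromDigits (finToFun {p} {4} k) i))
      (Finₚ.funToFin-finToFin {4} {p} k))
    (λ j → ≡.trans
      (index-cong (digits-injective λ i → ≡.trans (digits-fromDigits (finToFun {p} {4} (funToFin (digits (element j)))) i) (Finₚ.finToFun-funToFin (digits (element j)) i)))
      (index-element j))
    where open Function.Bundles.Inverse enumeration using () renaming (strictlyInverseʳ to index-element)

  support-of : Carrier → Subset 4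
  support-of x = support (digits x)

  residue≡zero⁺ : ∀ z → z Z.≈ + 0 → residue z ≡ zero
  residue≡zero⁺ z z≈0 = ≡.trans (residue-cong {z} {+ 0} z≈0) (residue-toℕ zero)

  residue≡zero⁻ : ∀ z → residue z ≡ zero → z Z.≈ + 0
  residue≡zero⁻ z eq = Z.sym {+ 0} {z} (≡.subst (λ k → + toℕ k Z.≈ z) eq (toℕ-residue z))

  coordinates≈0⁺ : ∀ {x} → x ≈ 0# → ∀ i → coordinate (φ x) i Z.≈ + 0
  coordinates≈0⁺ {x} x≈0 i = ≡.subst (coordinate (φ x) i Z.≈_) (coordinate-0 i)
    (coordinate-cong {φ x} {Q.0#} (Q.trans {φ x} {φ 0#} {Q.0#} (φ-cong x≈0) 0#-homo) i)

  coordinates≈0⁻ : ∀ {x} → (∀ i → coordinate (φ x) i Z.≈ + 0) → x ≈ 0#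
  coordinates≈0⁻ {x} eq = injective (Q.trans {φ x} {Q.0#} {φ 0#}
    (coordinate-injective λ i → ≡.subst (coordinate (φ x) i Z.≈_) (≡.sym (coordinate-0 i)) (eq i))
    (Q.sym {φ 0#} {Q.0#} 0#-homo))

  x≈0⇔∣support∣≡0 : ∀ x → (x ≈ 0# → ∣ support-of x ∣ ≡ 0) × (∣ support-of x ∣ ≡ 0 → x ≈ 0#)
  x≈0⇔∣support∣≡0 x =
    (λ x≈0 → ∣support∣≡0⁺ {f = digits x} λ i → residue≡zero⁺ (coordinate (φ x) i) (coordinates≈0⁺ x≈0 i)) ,
    (λ eq → coordinates≈0⁻ λ i → residue≡zero⁻ (coordinate (φ x) i) (∣support∣≡0⁻ {f = digits x} eq i))

  coordinate-φ-* : ∀ x y i → coordinate (φ (x * y)) i Z.≈ coordinate (φ x) i ℤ.* coordinate (φ y) i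
  coordinate-φ-* x y i = ≡.subst (coordinate (φ (x * y)) i Z.≈_) (coordinate-* (φ x) (φ y) i) (coordinate-cong (*-homo x y) i)

  -- Because of primality a product vanishes only if in each coordinate one factor does; adjacency
  -- thereby becomes disjointness of supports.
  euclid : ∀ x y → x ℤ.* y Z.≈ + 0 → x Z.≈ + 0 ⊎ y Z.≈ + 0
  euclid x y xy≈0 with euclidsLemma ℤ.∣ x ∣ ℤ.∣ y ∣ isPrime
    (≡.subst (p ℕ∣.∣_) (≡.trans (≡.cong ℤ.∣_∣ (ℤₚ.+-identityʳ (x ℤ.* y))) (ℤₚ.abs-* x y)) (ℤ∣.∣⇒∣ᵤ xy≈0))
  ... | inj₁ p∣x = inj₁ (ℤ∣.∣ᵤ⇒∣ (≡.subst (p ℕ∣.∣_) (≡.cong ℤ.∣_∣ (≡.sym (ℤₚ.+-identityʳ x))) p∣x))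
  ... | inj₂ p∣y = inj₂ (ℤ∣.∣ᵤ⇒∣ (≡.subst (p ℕ∣.∣_) (≡.cong ℤ.∣_∣ (≡.sym (ℤₚ.+-identityʳ y))) p∣y))

  xy≈0⇒disjoint : ∀ x y → x * y ≈ 0# → disjoint (support-of x) (support-of y) ≡ true
  xy≈0⇒disjoint x y xy≈0 = disjoint-support⁺ {f = digits x} {digits y} either
    where
    u v : Fin 4 → ℤ
    u = coordinate (φ x)
    v = coordinate (φ y)
    either : ∀ i → digits x i ≡ zero ⊎ digits y i ≡ zero
    either i = Sum.map (residue≡zero⁺ (u i)) (residue≡zero⁺ (v i)) (euclid (u i) (v i)
      (Z.trans {u i ℤ.* v i} {coordinate (φ (x * y)) i} {+ 0}
        (Z.sym {coordinate (φ (x * y)) i} {u i ℤ.* v i} (coordinate-φ-* x y i)) (coordinates≈0⁺ xy≈0 i)))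

  disjoint⇒xy≈0 : ∀ x y → disjoint (support-of x) (support-of y) ≡ true → x * y ≈ 0#
  disjoint⇒xy≈0 x y d = coordinates≈0⁻ λ i →
    Z.trans {coordinate (φ (x * y)) i} {u i ℤ.* v i} {+ 0} (coordinate-φ-* x y i) (product i)
    where
    u v : Fin 4 → ℤ
    u = coordinate (φ x)
    v = coordinate (φ y)
    product : ∀ i → u i ℤ.* v i Z.≈ + 0
    product i with disjoint-support⁻ {f = digits x} {digits y} d i
    ... | inj₁ x≡0 = Z.trans {u i ℤ.* v i} {+ 0 ℤ.* v i} {+ 0}
                       (Z.*-congʳ {v i} {u i} {+ 0} (residue≡zero⁻ (u i) x≡0)) (Z.zeroˡ (v i))
    ... | inj₂ y≡0 = Z.trans {u i ℤ.* v i} {u i ℤ.* + 0} {+ 0}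
                       (Z.*-congˡ {u i} {v i} {+ 0} (residue≡zero⁻ (v i) y≡0)) (Z.zeroʳ (u i))

  adjacent-does : ∀ x y → does (x * y ≈? 0#) ≡ disjoint (support-of x) (support-of y)
  adjacent-does x y = does≡ (x * y ≈? 0#) (xy≈0⇒disjoint x y) (disjoint⇒xy≈0 x y)

  support-surjective : ∀ (T : Subset 4) → ∃ λ y → support-of y ≡ T
  support-surjective T = fromDigits f , ≡.trans (support-cong (digits-fromDigits f)) support-f
    where
    -- The digits inside `T` must be nonzero. The digit 1, built as `suc` of this element, exists
    -- because 1 is not prime.
    0≢1 : ∀ {n} → Prime (suc n) → Fin n
    0≢1 {zero}  q = contradiction q ¬prime[1]
    0≢1 {suc n} _ = zero
    f : Fin 4 → Fin p
    f i = if lookup T i then suc (0≢1 isPrime) else zero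
    support-f : support f ≡ T
    support-f = ≡.trans (Vecₚ.tabulate-cong nz) (Vecₚ.tabulate∘lookup T)
      where
      nz : ∀ i → nonzero (f i) ≡ lookup T i
      nz i with lookup T i
      ... | true  = ≡.refl
      ... | false = ≡.refl

  -- A set disjoint from the full support is empty, so an element of full support is annihilated by
  -- 0 alone.
  isNonzeroZeroDivisor⇒proper : ∀ x → IsNonzeroZeroDivisor x → proper (support-of x) ≡ true
  isNonzeroZeroDivisor⇒proper x (x≉0 , y , y≉0 , xy≈0) = proper⁺ {T = support-of x}
    (x≉0 ∘ proj₂ (x≈0⇔∣support∣≡0 x))
    (λ full → y≉0 (proj₂ (x≈0⇔∣support∣≡0 y) (disjoint-full {T = support-of x} {support-of y} (xy≈0⇒disjoint x y xy≈0) full)))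

  -- The annihilating partner is any element supported exactly on the complement.
  proper⇒isNonzeroZeroDivisor : ∀ x → proper (support-of x) ≡ true → IsNonzeroZeroDivisor x
  proper⇒isNonzeroZeroDivisor x pr with ≢0 , ≢4 ← proper⁻ {T = support-of x} pr =
    ≢0 ∘ proj₁ (x≈0⇔∣support∣≡0 x) ,
    y ,
    (λ y≈0 → ∁≢0 (≡.trans (≡.cong ∣_∣ (≡.sym y∁)) (proj₁ (x≈0⇔∣support∣≡0 y) y≈0))) ,
    disjoint⇒xy≈0 x y (≡.trans (≡.cong (disjoint (support-of x)) y∁) (disjoint-∁ (support-of x)))
    where
    y : Carrier
    y = proj₁ (support-surjective (∁ (support-of x)))
    y∁ : support-of y ≡ ∁ (support-of x)
    y∁ = proj₂ (support-surjective (∁ (support-of x)))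
    ∁≢0 : ∣ ∁ (support-of x) ∣ ≢ 0
    ∁≢0 eq = proj₂ (proper⁻ {T = support-of x} pr) (ℕₚ.≤-antisym (Subsetₚ.∣p∣≤n (support-of x))
      (ℕₚ.m∸n≡0⇒m≤n (≡.trans (≡.sym (Subsetₚ.∣∁p∣≡n∸∣p∣ (support-of x))) eq)))

  vertex-does : ∀ x → does (isNonzeroZeroDivisor? x) ≡ proper (support-of x)
  vertex-does x = does≡ (isNonzeroZeroDivisor? x) (isNonzeroZeroDivisor⇒proper x) (proper⇒isNonzeroZeroDivisor x)

  module _ {m k : Level} (M : CommutativeMonoid m k) where
    private module M = CommutativeMonoid M
    open MonoidSum M using (sum; sum-syntax; sum-cong-≗; sum-permute)
    open MonoidMult M renaming (_×_ to _×ₘ_)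
    open SubsetSum M.rawMonoid
    open SummationOverSupports M
    open SetoidReasoning M.setoid

    -- Stated for every commutative monoid because it serves twice: in ℕ to count the vertices, and
    -- in the polynomial ring for the product `V · U`.
    ∑-vertices : ∀ (g : Subset 4 → M.Carrier) →
      ∑[ i < List.length vertices ] g (support-of (List.lookup vertices i)) M.≈
      ∑ₛ λ T → (a ℕ.^ ∣ T ∣) ×ₘ (if proper T then g T else M.ε)
    ∑-vertices g = begin
      ∑[ i < List.length vertices ] g (support-of (List.lookup vertices i))
        ≈⟨ ∑-filter isNonzeroZeroDivisor? element (g ∘ support-of) ⟩
      ∑[ j < size ] (if does (isNonzeroZeroDivisor? (element j)) then g (support-of (element j)) else M.ε)
        ≡⟨ sum-cong-≗ (λ j → ≡.cong (if_then g (support-of (element j)) else M.ε) (vertex-does (element j))) ⟩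
      ∑[ j < size ] ψ (support-of (element j))
        ≡⟨ sum-cong-≗ (λ j → ≡.cong ψ (support-cong (≡.sym ∘ Finₚ.finToFun-funToFin (digits (element j))))) ⟩
      ∑[ j < size ] ψ (support (finToFun {p} {4} (funToFin (digits (element j)))))
        ≈⟨ sum-permute (ψ ∘ support ∘ finToFun {p} {4}) code ⟨
      ∑[ k < p ℕ.^ 4 ] ψ (support (finToFun {p} {4} k))
        ≈⟨ ∑-support {a} 4 ψ ⟩
      ∑ₛ (λ T → (a ℕ.^ ∣ T ∣) ×ₘ ψ T) ∎
      where
      ψ : Subset 4 → M.Carrier
      ψ T = if proper T then g T else M.ε

-- The spectrum

module QuadraticFactors {c ℓ : Level} (S : CommutativeRing c ℓ) where
  open CommutativeRing S
  open IntegerCoefficients S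
  open Solver using (solve; _:=_; _:+_; _:*_; :-_; _:-_; con)
  open SetoidReasoning setoid

  factor : ∀ {b c l m} x → l + m ≈ - b → l * m ≈ c → x * x + b * x + c ≈ (x - l) * (x - m)
  factor {b} {c} {l} {m} x l+m≈-b l*m≈c = begin
    x * x + b * x + c                   ≈⟨ solve 3 (λ x b c → x :* x :+ b :* x :+ c := x :* x :- (:- b) :* x :+ c) refl x b c ⟩
    x * x - - b * x + c                 ≈⟨ +-cong (+-congˡ (-‿cong (*-congʳ l+m≈-b))) l*m≈c ⟨
    x * x - (l + m) * x + l * m         ≈⟨ solve 3 (λ x l m → x :* x :- (l :+ m) :* x :+ l :* m := (x :- l) :* (x :- m)) refl x l m ⟩
    (x - l) * (x - m)                   ∎

  module _ {½ : Carrier} (½*2≈1 : ½ * (1# + 1#) ≈ 1#) where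
    half-sum : ∀ u v → ½ * (u + v) + ½ * (u - v) ≈ u
    half-sum u v = begin
      ½ * (u + v) + ½ * (u - v)   ≈⟨ solve 3 (λ h u v → h :* (u :+ v) :+ h :* (u :- v) := h :* (con (+ 1) :+ con (+ 1)) :* u) refl ½ u v ⟩
      ½ * (1# + 1#) * u           ≈⟨ trans (*-congʳ ½*2≈1) (*-identityˡ u) ⟩
      u                           ∎

    -- Turns the product of two conjugate eigenvalues into a division-free identity, in which each
    -- square root appears squared.
    half-product : ∀ u v d → u * u - v * v ≈ (1# + 1#) * (1# + 1#) * d → ½ * (u + v) * (½ * (u - v)) ≈ d
    half-product u v d eq = begin
      ½ * (u + v) * (½ * (u - v))             ≈⟨ solve 3 (λ h u v → h :* (u :+ v) :* (h :* (u :- v)) := h :* h :* (u :* u :- v :* v)) refl ½ u v ⟩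
      ½ * ½ * (u * u - v * v)                 ≈⟨ *-congˡ eq ⟩
      ½ * ½ * ((1# + 1#) * (1# + 1#) * d)     ≈⟨ solve 2 (λ h d → h :* h :* ((con (+ 1) :+ con (+ 1)) :* (con (+ 1) :+ con (+ 1)) :* d) :=
                                                   h :* (con (+ 1) :+ con (+ 1)) :* (h :* (con (+ 1) :+ con (+ 1)) :* d)) refl ½ d ⟩
      ½ * (1# + 1#) * (½ * (1# + 1#) * d)     ≈⟨ *-cong ½*2≈1 (*-congʳ ½*2≈1) ⟩
      1# * (1# * d)                           ≈⟨ trans (*-identityˡ _) (*-identityˡ d) ⟩
      d                                       ∎

-- To be used with the polynomial ring for `S` and `X` for `x`. The element `h` is to be an inverse
-- of 8, which undoes the scaling of `dual`.
module DisjointnessMatrix {c ℓ : Level} (S : CommutativeRing c ℓ) (x : CommutativeRing.Carrier S) (a : ℕ)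
  (h : CommutativeRing.Carrier S) where
  open CommutativeRing S hiding (zero)
  open DeterminantProperties S
  open MultiplicativeDeterminant S
  open SylvesterIdentity S
  open IntegerCoefficients S
  open Solver using (solve; _:=_; _:+_; _:*_)
  open SemiringMult semiring renaming (_×_ to _×ₘ_)
  open SubsetSum (CommutativeMonoid.rawMonoid +-commutativeMonoid)
  open SummationOverSupports +-commutativeMonoid
  open SemiringExp semiring using (^-homo-*)
  open RingProperties ring
  open QuadraticFactors S using (factor)
  open SetoidReasoning setoid

  α : Carrier
  α = a ×ₘ 1#

  open WeightedIntegerMatrix S x α

  ι-sum : ∀ {n} (f : Fin n → ℤ) → ι (∑ℤ f) ≈ sum (ι ∘ f)
  ι-sum {zero}  f = refl
  ι-sum {suc n} f = trans (ι-+ (f zero) _) (+-congˡ (ι-sum (f ∘ suc)))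

  ι-∑ₛ : ∀ {n} (φ : Subset n → ℤ) → ι (∑ₛℤ φ) ≈ ∑ₛ (ι ∘ φ)
  ι-∑ₛ {zero}  φ = refl
  ι-∑ₛ {suc n} φ = trans (ι-+ (∑ₛℤ (λ T → φ (false ∷ T))) _) (+-cong (ι-∑ₛ {n} _) (ι-∑ₛ {n} _))

  *-distribˡ-∑ₛ : ∀ {n} y (φ : Subset n → Carrier) → y * ∑ₛ φ ≈ ∑ₛ (λ T → y * φ T)
  *-distribˡ-∑ₛ {zero}  y φ = refl
  *-distribˡ-∑ₛ {suc n} y φ = trans (distribˡ y _ _) (+-cong (*-distribˡ-∑ₛ {n} y _) (*-distribˡ-∑ₛ {n} y _))

  α^-* : ∀ m y → (a ℕ.^ m) ×ₘ y ≈ α ^ m * y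
  α^-* zero    y = trans (+-identityʳ y) (sym (*-identityˡ y))
  α^-* (suc m) y = begin
    (a ℕ.* a ℕ.^ m) ×ₘ y       ≈⟨ ×-assocˡ y a (a ℕ.^ m) ⟨
    a ×ₘ ((a ℕ.^ m) ×ₘ y)      ≈⟨ ×-congʳ a (trans (α^-* m y) (sym (*-identityˡ _))) ⟩
    a ×ₘ (1# * (α ^ m * y))    ≈⟨ ×-assoc-* a 1# (α ^ m * y) ⟨
    α * (α ^ m * y)            ≈⟨ *-assoc α (α ^ m) y ⟨
    α * α ^ m * y              ∎

  sylvester-pencil : ∀ {m n} (U : Fin n → Fin m → Carrier) (V : Fin m → Fin n → Carrier) (M : Matrix ℤ m) (w : Fin m → ℕ)
    (A : Matrix Carrier n) → (∀ i j → (U · V) i j ≈ A i j) → (∀ s t → (V · U) s t ≈ α ^ w t * ι (M s t)) →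
    x ^ m * det (λ i j → scalar x i j - A i j) ≈ x ^ n * pencilDet M w
  sylvester-pencil {m} {n} U V M w A UV≈A VU≈M = begin
    x ^ m * det (λ i j → scalar x i j - A i j)          ≈⟨ *-congˡ (det-cong {n} λ i j → +-congˡ (-‿cong (UV≈A i j))) ⟨
    x ^ m * det (λ i j → scalar x i j - (U · V) i j)    ≈⟨ sylvester U V x ⟩
    x ^ n * det (λ i j → scalar x i j - (V · U) i j)    ≈⟨ *-congˡ (det-cong {m} λ s t → +-congˡ (-‿cong (VU≈M s t))) ⟩
    x ^ n * det (pencil M w)                            ≈⟨ *-congˡ (pencilDet-def M w) ⟨
    x ^ n * pencilDet M w                               ∎

  disjointness : ∀ {n} → (Fin n → Subset 4) → Matrix Carrier n
  disjointness t i j = if disjoint (t i) (t j) then 1# else 0#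

  module _ (h*8≈1 : h * ι (+ 8) ≈ 1#) {n : ℕ} (t : Fin n → Subset 4) (t-proper : ∀ i → proper (t i) ≡ true)
    (∑-t : ∀ (g : Subset 4 → Carrier) → ∑[ i < n ] g (t i) ≈ ∑ₛ λ T → (a ℕ.^ ∣ T ∣) ×ₘ (if proper T then g T else 0#)) where

    private
      -- `U` evaluates a combination of basis functions at the support of a vertex, and `V` holds
      -- the coordinates of the columns of the matrix. So `U · V` is the matrix, and `V · U` is its
      -- action on functions of the support alone.
      U : Fin n → Fin 14 → Carrier
      U i s = ι (basisAt (t i) s)

      V : Fin 14 → Fin n → Carrier
      V s j = h * ι (coefficient s (t j))

      U·V : ∀ i j → (U · V) i j ≈ disjointness t i j
      U·V i j = begin
        ∑[ s < 14 ] (ι (basisAt (t i) s) * (h * ι (coefficient s (t j))))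
          ≈⟨ sum-cong-≋ {14} (λ s → trans (solve 3 (λ f h g → f :* (h :* g) := h :* (f :* g)) refl (ι (basisAt (t i) s)) h (ι (coefficient s (t j))))
               (*-congˡ (sym (ι-* (basisAt (t i) s) (coefficient s (t j)))))) ⟩
        ∑[ s < 14 ] (h * ι (basisAt (t i) s ℤ.* coefficient s (t j)))
          ≈⟨ *-distribˡ-sum h (λ s → ι (basisAt (t i) s ℤ.* coefficient s (t j))) ⟨
        h * ∑[ s < 14 ] ι (basisAt (t i) s ℤ.* coefficient s (t j))
          ≈⟨ *-congˡ (ι-sum (λ s → basisAt (t i) s ℤ.* coefficient s (t j))) ⟨
        h * ι (∑ℤ (λ s → basisAt (t i) s ℤ.* coefficient s (t j)))
          ≡⟨ ≡.cong (λ z → h * ι z) (basisAt·coefficient (t i) (t j) (t-proper i) (t-proper j)) ⟩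
        h * ι (if disjoint (t i) (t j) then + 8 else + 0)
          ≈⟨ eighth (disjoint (t i) (t j)) ⟩
        disjointness t i j ∎
        where
        eighth : ∀ b → h * ι (if b then + 8 else + 0) ≈ (if b then 1# else 0#)
        eighth true  = h*8≈1
        eighth false = zeroʳ h

      -- Column u of basisAt is supported on the subsets of cardinality level u.
      homogeneous : ∀ T s u → (a ℕ.^ ∣ T ∣) ×ₘ (if proper T then h * ι (coefficient s T ℤ.* basisAt T u) else 0#) ≈
                    α ^ level u * h * ι (if proper T then coefficient s T ℤ.* basisAt T u else + 0)
      homogeneous T s u with proper T
      ... | false = trans (α^-* ∣ T ∣ 0#) (trans (zeroʳ _) (sym (zeroʳ _)))
      ... | true with ∣ T ∣ ≡ᵇ level u in eq
      ...   | true  = begin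
        (a ℕ.^ ∣ T ∣) ×ₘ (h * y)     ≈⟨ α^-* ∣ T ∣ (h * y) ⟩
        α ^ ∣ T ∣ * (h * y)          ≡⟨ ≡.cong (λ k → α ^ k * (h * y)) (ℕₚ.≡ᵇ⇒≡ ∣ T ∣ (level u) (≡.subst Bool.T (≡.sym eq) _)) ⟩
        α ^ level u * (h * y)        ≈⟨ *-assoc _ _ _ ⟨
        α ^ level u * h * y          ∎
        where y = ι (coefficient s T ℤ.* basis u T)
      ...   | false = begin
        (a ℕ.^ ∣ T ∣) ×ₘ (h * y)     ≈⟨ α^-* ∣ T ∣ (h * y) ⟩
        α ^ ∣ T ∣ * (h * y)          ≈⟨ *-congˡ (trans (*-congˡ y≈0) (zeroʳ h)) ⟩
        α ^ ∣ T ∣ * 0#               ≈⟨ trans (zeroʳ _) (sym (zeroʳ _)) ⟩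
        α ^ level u * h * 0#         ≈⟨ *-congˡ y≈0 ⟨
        α ^ level u * h * y          ∎
        where
        y = ι (coefficient s T ℤ.* + 0)
        y≈0 : y ≈ 0#
        y≈0 = reflexive (≡.cong ι (ℤₚ.*-zeroʳ (coefficient s T)))

      V·U : ∀ s u → (V · U) s u ≈ α ^ level u * ι (action s u)
      V·U s u = begin
        ∑[ i < n ] (h * ι (coefficient s (t i)) * ι (basisAt (t i) u))
          ≈⟨ sum-cong-≋ (λ i → trans (*-assoc h _ _) (*-congˡ (sym (ι-* (coefficient s (t i)) (basisAt (t i) u))))) ⟩
        ∑[ i < n ] (h * ι (coefficient s (t i) ℤ.* basisAt (t i) u))
          ≈⟨ ∑-t (λ T → h * ι (coefficient s T ℤ.* basisAt T u)) ⟩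
        ∑ₛ (λ T → (a ℕ.^ ∣ T ∣) ×ₘ (if proper T then h * ι (coefficient s T ℤ.* basisAt T u) else 0#))
          ≈⟨ ∑ₛ-cong {4} (λ T → homogeneous T s u) ⟩
        ∑ₛ (λ T → α ^ level u * h * ι (ψ T))
          ≈⟨ *-distribˡ-∑ₛ (α ^ level u * h) (λ T → ι (ψ T)) ⟨
        α ^ level u * h * ∑ₛ (λ T → ι (ψ T))
          ≈⟨ *-congˡ (ι-∑ₛ ψ) ⟨
        α ^ level u * h * ι (∑ₛℤ ψ)
          ≡⟨ ≡.cong (λ z → α ^ level u * h * ι z) (coefficient·basisAt s u) ⟩
        α ^ level u * h * ι (+ 8 ℤ.* action s u)
          ≈⟨ *-congˡ (ι-* (+ 8) (action s u)) ⟩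
        α ^ level u * h * (ι (+ 8) * ι (action s u))
          ≈⟨ solve 4 (λ w h e c → w :* h :* (e :* c) := w :* (h :* e :* c)) refl (α ^ level u) h (ι (+ 8)) (ι (action s u)) ⟩
        α ^ level u * (h * ι (+ 8) * ι (action s u))
          ≈⟨ *-congˡ (trans (*-congʳ h*8≈1) (*-identityˡ _)) ⟩
        α ^ level u * ι (action s u) ∎
        where
        ψ : Subset 4 → ℤ
        ψ T = if proper T then coefficient s T ℤ.* basisAt T u else + 0

    det-disjointness : x ^ 14 * det (λ i j → scalar x i j - disjointness t i j) ≈
                       x ^ n * (r * (r * (r₊ * r₃ * (r * r₁ * (r * r₁ * (r * r₁))))))
    det-disjointness = trans (sylvester-pencil U V action level (disjointness t) U·V V·U) (*-congˡ det-action)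

    module _ (cancel : ∀ (y z : Carrier) → x * y ≈ x * z → y ≈ z) {k : ℕ} (n≡k+14 : n ≡ k ℕ.+ 14)
      {A : Matrix Carrier n} (A≈ : ∀ i j → A i j ≈ disjointness t i j) where

      private
        P : Carrier
        P = r * (r * (r₊ * r₃ * (r * r₁ * (r * r₁ * (r * r₁)))))

        cancel^ : ∀ m {y z} → x ^ m * y ≈ x ^ m * z → y ≈ z
        cancel^ zero    eq = trans (sym (*-identityˡ _)) (trans eq (*-identityˡ _))
        cancel^ (suc m) eq = cancel^ m (cancel _ _ (trans (sym (*-assoc _ _ _)) (trans eq (*-assoc _ _ _))))

      det-adjacency : det (λ i j → (if does (i Finₚ.≟ j) then x else 0#) - A i j) ≈ x ^ k * P
      det-adjacency = trans (det-cong {n} λ i j → +-cong (diagonal (does (i Finₚ.≟ j))) (-‿cong (A≈ i j)))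
        -- Sylvester's identity has the factor `x ^ 14` on one side and `x ^ n` on the other; with n
        -- = k + 14, cancelling leaves the k zero eigenvalues.
        (cancel^ 14 (begin
          x ^ 14 * det (λ i j → scalar x i j - disjointness t i j)  ≈⟨ det-disjointness ⟩
          x ^ n * P                 ≡⟨ ≡.cong (λ m → x ^ m * P) (≡.trans n≡k+14 (ℕₚ.+-comm k 14)) ⟩
          x ^ (14 ℕ.+ k) * P        ≈⟨ *-congʳ (^-homo-* x 14 k) ⟩
          x ^ 14 * x ^ k * P        ≈⟨ *-assoc _ _ _ ⟩
          x ^ 14 * (x ^ k * P)      ∎))
        where
        diagonal : ∀ d → (if d then x else 0#) ≈ x * (if d then 1# else 0#)
        diagonal true  = sym (*-identityʳ x)
        diagonal false = sym (zeroʳ x)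

      module _ {e : Level} {E : Set e} (η : E → Carrier) where
        -- The same fold as in `IsSpectrum`, with `η` in the place of `constant`.
        roots : List E → Carrier
        roots = foldr (λ μ y → (x - η μ) * y) 1#

        roots-replicate : ∀ {e₀} → η e₀ ≈ 0# → ∀ m → roots (replicate m e₀) ≈ x ^ m
        roots-replicate ηe₀≈0 zero    = refl
        roots-replicate ηe₀≈0 (suc m) = *-cong
          (trans (+-congˡ (trans (-‿cong ηe₀≈0) -0≈0)) (+-identityʳ x)) (roots-replicate ηe₀≈0 m)

        -- By Viète, sum and product of each conjugate pair determine the factors `r₁` and `r₃`, so
        -- that no square roots occur here.
        det-roots : ∀ {e₀ e₁ e₂ e₃ e₄ e₅ e₆} → η e₀ ≈ 0# →
          η e₁ ≈ α * α → η e₂ ≈ - (α * α) →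
          η e₃ + η e₄ ≈ - (α + (α * α + α * α)) → η e₃ * η e₄ ≈ α * α * (α * α) →
          η e₅ + η e₆ ≈ - - (α + α + α + (α * α + α * α)) → η e₅ * η e₆ ≈ α * α * (α * α) →
          ∀ {es} → es ≡ replicate 5 e₁ ++ replicate 1 e₂ ++ replicate 3 e₃ ++ replicate 3 e₄ ++
                        replicate 1 e₅ ++ replicate 1 e₆ ++ replicate k e₀ →
          det (λ i j → (if does (i Finₚ.≟ j) then x else 0#) - A i j) ≈ roots es
        det-roots {e₀} {e₁} {e₂} {e₃} {e₄} {e₅} {e₆} ηe₀≈0 η₁≈ η₂≈ η₃+η₄ η₃η₄ η₅+η₆ η₅η₆ ≡.refl = begin
          det (λ i j → (if does (i Finₚ.≟ j) then x else 0#) - A i j)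
            ≈⟨ det-adjacency ⟩
          x ^ k * P
            ≈⟨ *-cong (sym (roots-replicate ηe₀≈0 k))
                 (*-cong r≈ (*-cong r≈ (*-cong (*-cong r₊≈ r₃≈) (*-cong (*-cong r≈ r₁≈) (*-cong (*-cong r≈ r₁≈) (*-cong r≈ r₁≈)))))) ⟩
          z * (x₁ * (x₁ * (x₂ * (x₅ * x₆) * (x₁ * (x₃ * x₄) * (x₁ * (x₃ * x₄) * (x₁ * (x₃ * x₄)))))))
            ≈⟨ solve 7 (λ z x₁ x₂ x₃ x₄ x₅ x₆ →
                 z :* (x₁ :* (x₁ :* (x₂ :* (x₅ :* x₆) :* (x₁ :* (x₃ :* x₄) :* (x₁ :* (x₃ :* x₄) :* (x₁ :* (x₃ :* x₄)))))))
                 := x₁ :* (x₁ :* (x₁ :* (x₁ :* (x₁ :* (x₂ :* (x₃ :* (x₃ :* (x₃ :* (x₄ :* (x₄ :* (x₄ :* (x₅ :* (x₆ :* z))))))))))))))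
                 refl z x₁ x₂ x₃ x₄ x₅ x₆ ⟩
          x₁ * (x₁ * (x₁ * (x₁ * (x₁ * (x₂ * (x₃ * (x₃ * (x₃ * (x₄ * (x₄ * (x₄ * (x₅ * (x₆ * z))))))))))))) ∎
          where
          z x₁ x₂ x₃ x₄ x₅ x₆ : Carrier
          z  = roots (replicate k e₀)
          x₁ = x - η e₁
          x₂ = x - η e₂
          x₃ = x - η e₃
          x₄ = x - η e₄
          x₅ = x - η e₅
          x₆ = x - η e₆
          r≈ : r ≈ x₁
          r≈ = +-congˡ (-‿cong (sym η₁≈))
          r₊≈ : r₊ ≈ x₂
          r₊≈ = +-congˡ (trans (sym (-‿involutive _)) (-‿cong (sym η₂≈)))
          r₁≈ : r₁ ≈ x₃ * x₄
          r₁≈ = factor x η₃+η₄ η₃η₄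
          r₃≈ : r₃ ≈ x₅ * x₆
          r₃≈ = trans (+-congʳ (+-congˡ (-‿distribˡ-* _ x))) (factor x η₅+η₆ η₅η₆)

-- The number of vertices and the multiplicity of 0.

module _ where
  open +-*-Solver using (Polynomial; solve; _:=_; _:+_; _:*_; _:^_; con)
  open SubsetSum ℕ.+-0-rawMonoid using () renaming (∑ₛ to ∑ℕ)
  open SummationOverSupports ℕₚ.+-0-commutativeMonoid using (∑ₛ-cong)
  open MonoidMult ℕₚ.+-0-commutativeMonoid renaming (_×_ to _×ℕ_)
  open MonoidSum ℕₚ.+-0-commutativeMonoid using () renaming (sum to sumℕ)

  ×≡* : ∀ k m → k ×ℕ m ≡ k ℕ.* m
  ×≡* zero    m = ≡.refl
  ×≡* (suc k) m = ≡.cong (m ℕ.+_) (×≡* k m)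

  sum-1 : ∀ n → sumℕ {n} (λ _ → 1) ≡ n
  sum-1 zero    = ≡.refl
  sum-1 (suc n) = ≡.cong suc (sum-1 n)

  -- This is p⁴ - (p-1)⁴ - 15 in terms of b = p - 2, where all coefficients are nonnegative and no
  -- subtraction is left. It vanishes for p = 2, in which case the graph has just 14 vertices.
  excess : ℕ → ℕ
  excess b = b ℕ.* (28 ℕ.+ 18 ℕ.* b ℕ.+ 4 ℕ.* b ℕ.^ 2)

  ∑-proper : ∀ b → ∑ℕ {4} (λ T → (suc b ℕ.^ ∣ T ∣) ×ℕ (if proper T then 1 else 0)) ≡ excess b ℕ.+ 14
  ∑-proper b = ≡.trans
    (∑ₛ-cong {4} λ T → ×≡* (suc b ℕ.^ ∣ T ∣) (if proper T then 1 else 0))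
    (solve 1 (λ b → ∑ₚ {4} (λ T → (con 1 :+ b) :^ ∣ T ∣ :* con (if proper T then 1 else 0))
      := b :* (con 28 :+ con 18 :* b :+ con 4 :* b :^ 2) :+ con 14) ≡.refl b)
    where
    polynomialRawMonoid : RawMonoid 0ℓ 0ℓ
    polynomialRawMonoid = record { Carrier = Polynomial 1 ; _≈_ = _≡_ ; _∙_ = _:+_ ; ε = con 0 }
    open SubsetSum polynomialRawMonoid using () renaming (∑ₛ to ∑ₚ)

  -- The minuend is first written as the subtrahend plus `excess b`, so that the truncated
  -- subtraction is exact.
  m₀≡excess : ∀ b → let p = suc (suc b) in (p ℕ.^ 4 ℕ.+ 1) ℕ.∸ ((p ℕ.∸ 1) ℕ.^ 4 ℕ.+ 2 ℕ.^ 4) ≡ excess b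
  m₀≡excess b = ≡.trans
    (≡.cong (ℕ._∸ (suc b ℕ.^ 4 ℕ.+ 2 ℕ.^ 4))
      (solve 1 (λ b → (con 2 :+ b) :^ 4 :+ con 1 :=
        (con 1 :+ b) :^ 4 :+ con 16 :+ b :* (con 28 :+ con 18 :* b :+ con 4 :* b :^ 2)) ≡.refl b))
    (ℕₚ.m+n∸m≡n (suc b ℕ.^ 4 ℕ.+ 2 ℕ.^ 4) (excess b))

module Halves {c ℓ₁ ℓ₂ ℓ₃ : Level} (K : OrderedField c ℓ₁ ℓ₂ ℓ₃) where
  open OrderedField K
  open IntegerCoefficients commutativeRing
  open Solver using (Polynomial; solve; _:=_; _:+_; _:*_; :-_; _:-_; _:^_; con)
  open QuadraticFactors commutativeRing
  open SetoidReasoning setoid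

  private
    inverse : ∀ {x y} (x#y : x # y) → proj₁ (#⇒invertible x#y) * (x - y) ≈ 1#
    inverse x#y = proj₁ (proj₂ (#⇒invertible x#y))

    ½*[2-0]≈1 : ½ * (fromℕ 2 - 0#) ≈ 1#
    -- The omitted argument is the apartness proof inside the definition of `½`, recovered by
    -- unification.
    ½*[2-0]≈1 = inverse _

  -- Copies the unfolding of `fromℕ`, which ends in a summand `0#`. A literal `con (+ n)` would
  -- evaluate to the multiple without this summand.
  nat : ∀ {k} → ℕ → Polynomial k
  nat zero    = con (+ 0)
  nat (suc n) = con (+ 1) :+ nat n

  ½*2≈1 : ½ * (1# + 1#) ≈ 1#
  ½*2≈1 = trans (solve 1 (λ h → h :* (con (+ 1) :+ con (+ 1)) := h :* (nat 2 :- con (+ 0))) refl ½) ½*[2-0]≈1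

  ½³*8≈1 : ½ * ½ * ½ * ι (+ 8) ≈ 1#
  ½³*8≈1 = begin
    ½ * ½ * ½ * ι (+ 8)                                ≈⟨ solve 1 (λ h → h :* h :* h :* con (+ 8) :=
                                                            h :* (con (+ 1) :+ con (+ 1)) :* (h :* (con (+ 1) :+ con (+ 1))) :* (h :* (con (+ 1) :+ con (+ 1)))) refl ½ ⟩
    ½ * (1# + 1#) * (½ * (1# + 1#)) * (½ * (1# + 1#))  ≈⟨ *-cong (*-cong ½*2≈1 ½*2≈1) ½*2≈1 ⟩
    1# * 1# * 1#                                       ≈⟨ trans (*-identityʳ _) (*-identityʳ _) ⟩
    1#                                                 ∎

-- The characteristic polynomial of the graph over K.

module _ {c ℓ c′ ℓ₁ ℓ₂ ℓ₃ : Level} (K : OrderedField c′ ℓ₁ ℓ₂ ℓ₃) (b : ℕ) (isPrime : Prime (suc (suc b)))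
  (R : FiniteCommutativeRing c ℓ)
  (iso : FiniteCommutativeRing.commutativeRing R ≅
         ℤ/ (suc (suc b)) ×ᴿ ℤ/ (suc (suc b)) ×ᴿ ℤ/ (suc (suc b)) ×ᴿ ℤ/ (suc (suc b))) where

  private
    module K = OrderedField K

  open PolynomialRing K.commutativeRing
  open Polynomial K.rawRing
  open CommutativeRing polynomialRing hiding (zero)
  open SemiringExp semiring using (_^_)
  open SemiringMult semiring using () renaming (_×_ to _×ₛ_)
  open Halves K

  private
    a n : ℕ
    a = suc b
    n = Graph.order (Γ R)

    αₖ : K.Carrier
    αₖ = K.fromℕ a

    α h : Poly
    α = a ×ₛ 1#
    h = constant (K.½ K.* K.½ K.* K.½)

  open ZeroDivisorGraph R using (vertices)
  open ZeroDivisorsOfFourthPower a isPrime R iso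
  open DisjointnessMatrix polynomialRing X a h using (disjointness; det-roots)

  h*8≈1 : h * IntegerCoefficients.ι polynomialRing (+ 8) ≈ 1#
  h*8≈1 = trans {h * constant ι8} {constant (h₀ K.* ι8)} {1#}
    (sym {constant (h₀ K.* ι8)} {h * constant ι8} (constant-* h₀ ι8)) (constant-cong ½³*8≈1)
    where
    h₀ ι8 : K.Carrier
    h₀ = K.½ K.* K.½ K.* K.½
    ι8 = IntegerCoefficients.ι K.commutativeRing (+ 8)

  constant-fromℕ : ∀ k → k ×ₛ 1# ≈ constant (K.fromℕ k)
  constant-fromℕ zero    = sym {constant K.0#} {0#} constant-0
  constant-fromℕ (suc k) = +-cong {1#} {1#} {k ×ₛ 1#} {constant (K.fromℕ k)} (refl {1#}) (constant-fromℕ k)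

  α² : α * α ≈ constant (αₖ K.* αₖ)
  α² = trans {α * α} {constant αₖ * constant αₖ} {constant (αₖ K.* αₖ)}
    (*-cong {α} {constant αₖ} {α} {constant αₖ} (constant-fromℕ a) (constant-fromℕ a))
    (sym {constant (αₖ K.* αₖ)} {constant αₖ * constant αₖ} (constant-* αₖ αₖ))

  t : Fin n → Subset 4
  t i = support-of (List.lookup vertices i)

  t-proper : ∀ i → proper (t i) ≡ true
  t-proper i = isNonzeroZeroDivisor⇒proper (List.lookup vertices i)
    (All.lookup (all-filter (ZeroDivisorGraph.isNonzeroZeroDivisor? R) (List.tabulate (FiniteCommutativeRing.element R))) (∈-lookup i))

  -- Counting is the sum of 1 over the vertices, taken in ℕ.
  order≡ : n ≡ excess b ℕ.+ 14
  order≡ = ≡.trans (≡.sym (sum-1 n))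
    (≡.trans (∑-vertices ℕₚ.+-0-commutativeMonoid (λ _ → 1)) (∑-proper b))

  adjacency≈ : ∀ i j → constant (adjacencyMatrix K (Γ R) i j) ≈ disjointness t i j
  adjacency≈ i j = entry (adjacent-does (List.lookup vertices i) (List.lookup vertices j))
    where
    entry : ∀ {d e} → d ≡ e → constant (if d then K.1# else K.0#) ≈ (if e then 1# else 0#)
    entry {true}  ≡.refl = refl {1#}
    entry {false} ≡.refl = constant-0

  spectrum : ∀ {λ₁ λ₂ λ₃ λ₄ λ₅ λ₆ : K.Carrier} →
    λ₁ K.≈ αₖ K.* αₖ →
    λ₂ K.≈ K.- (αₖ K.* αₖ) →
    λ₃ K.+ λ₄ K.≈ K.- (αₖ K.+ (αₖ K.* αₖ K.+ αₖ K.* αₖ)) →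
    λ₃ K.* λ₄ K.≈ αₖ K.* αₖ K.* (αₖ K.* αₖ) →
    λ₅ K.+ λ₆ K.≈ K.- (K.- (αₖ K.+ αₖ K.+ αₖ K.+ (αₖ K.* αₖ K.+ αₖ K.* αₖ))) →
    λ₅ K.* λ₆ K.≈ αₖ K.* αₖ K.* (αₖ K.* αₖ) →
    ∀ {k} → k ≡ excess b →
    ∀ λs → λs ≡ replicate 5 λ₁ ++ replicate 1 λ₂ ++ replicate 3 λ₃ ++ replicate 3 λ₄ ++
                replicate 1 λ₅ ++ replicate 1 λ₆ ++ replicate k K.0# →
    IsGraphSpectrum K (Γ R) λs
  spectrum {λ₁} {λ₂} {λ₃} {λ₄} {λ₅} {λ₆} λ₁≈ λ₂≈ λ₃+λ₄≈ λ₃λ₄≈ λ₅+λ₆≈ λ₅λ₆≈ {k} k≡ λs λs≡ =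
    det-roots h*8≈1 t t-proper (∑-vertices +-commutativeMonoid)
        X-cancelˡ {k} (≡.trans order≡ (≡.cong (ℕ._+ 14) (≡.sym k≡)))
        {λ i j → constant (adjacencyMatrix K (Γ R) i j)} adjacency≈
        constant {K.0#} {λ₁} {λ₂} {λ₃} {λ₄} {λ₅} {λ₆} constant-0
        (transport {y = α * α} λ₁≈ α²)
        (transport {y = - (α * α)} λ₂≈ (-‿cong {α * α} {constant αₖ²} α²))
        (transport {y = - (α + 2α²)} λ₃+λ₄≈
          (-‿cong {α + 2α²} {constant αₖ + 2αₖ²} (+-cong {α} {constant αₖ} {2α²} {2αₖ²} α≈ 2α²≈)))
        (product λ₃ λ₄ λ₃λ₄≈)
        (transport {y = - - (α + α + α + 2α²)} λ₅+λ₆≈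
          (-‿cong { - (α + α + α + 2α²)} { - constant 3αₖ+2αₖ²}
          (-‿cong {α + α + α + 2α²} {constant 3αₖ+2αₖ²}
          (+-cong {α + α + α} {constant αₖ + constant αₖ + constant αₖ} {2α²} {2αₖ²}
            (+-cong {α + α} {constant αₖ + constant αₖ} {α} {constant αₖ} (+-cong {α} {constant αₖ} {α} {constant αₖ} α≈ α≈) α≈) 2α²≈))))
        (product λ₅ λ₆ λ₅λ₆≈) {λs} λs≡
    where
    αₖ² 3αₖ+2αₖ² : K.Carrier
    αₖ² = αₖ K.* αₖ
    3αₖ+2αₖ² = αₖ K.+ αₖ K.+ αₖ K.+ (αₖ² K.+ αₖ²)

    2α² 2αₖ² : Poly
    2α² = α * α + α * α
    2αₖ² = constant αₖ² + constant αₖ²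

    α≈ : α ≈ constant αₖ
    α≈ = constant-fromℕ a

    2α²≈ : 2α² ≈ 2αₖ²
    2α²≈ = +-cong {α * α} {constant αₖ²} {α * α} {constant αₖ²} α² α²

    transport : ∀ {x z y} → x K.≈ z → y ≈ constant z → constant x ≈ y
    transport {x} {z} {y} x≈z y≈z = trans {constant x} {constant z} {y} (constant-cong x≈z) (sym {y} {constant z} y≈z)

    product : ∀ x y → x K.* y K.≈ αₖ² K.* αₖ² → constant x * constant y ≈ α * α * (α * α)
    product x y xy≈ = trans {constant x * constant y} {constant (x K.* y)} {α * α * (α * α)}
      (sym {constant (x K.* y)} {constant x * constant y} (constant-* x y))
      (transport {y = α * α * (α * α)} xy≈
        (trans {α * α * (α * α)} {constant αₖ² * constant αₖ²} {constant (αₖ² K.* αₖ²)}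
          (*-cong {α * α} {constant αₖ²} {α * α} {constant αₖ²} α² α²)
          (sym {constant (αₖ² K.* αₖ²)} {constant αₖ² * constant αₖ²} (constant-* αₖ² αₖ²))))

-- The stated eigenvalues in terms of p - 1.

module Eigenvalues {c ℓ₁ ℓ₂ ℓ₃ : Level} (K : OrderedField c ℓ₁ ℓ₂ ℓ₃) (a : ℕ) where
  open OrderedField K
  open IntegerCoefficients commutativeRing using (module Solver)
  open Solver using (solve; _:=_; _:+_; _:*_; :-_; _:-_; _:^_; con)
  open QuadraticFactors commutativeRing using (half-sum; half-product)
  open Halves K using (½*2≈1; nat)
  open SetoidReasoning setoid

  α : Carrier
  α = fromℕ a

  λ₁≈ : let q = fromℕ (suc a) in (q - 1#) ^ 2 ≈ α * α
  λ₁≈ = solve 1 (λ α → (con (+ 1) :+ α :- con (+ 1)) :^ 2 := α :* α) refl α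

  λ₂≈ : let q = fromℕ (suc a) in - (q ^ 2) + fromℕ 2 * q - 1# ≈ - (α * α)
  λ₂≈ = solve 1 (λ α → :- ((con (+ 1) :+ α) :^ 2) :+ nat 2 :* (con (+ 1) :+ α) :- con (+ 1) := :- (α :* α)) refl α

  module _ (s : Carrier) where
    private
      q u v : Carrier
      q = fromℕ (suc a)
      u = - (fromℕ 2 * q ^ 2) + fromℕ 3 * q - 1#
      v = (q - 1#) * s

    λ₃+λ₄≈ : let q = fromℕ (suc a) in
      ½ * (- (fromℕ 2 * q ^ 2) + fromℕ 3 * q - 1# + (q - 1#) * s) +
      ½ * (- (fromℕ 2 * q ^ 2) + fromℕ 3 * q - 1# - (q - 1#) * s) ≈ - (α + (α * α + α * α))
    λ₃+λ₄≈ = trans (half-sum ½*2≈1 u v)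
      (solve 1 (λ α → :- (nat 2 :* (con (+ 1) :+ α) :^ 2) :+ nat 3 :* (con (+ 1) :+ α) :- con (+ 1)
        := :- (α :+ (α :* α :+ α :* α))) refl α)

    -- Both squares contain (q-1)², since 2q² - 3q + 1 = (q-1)(2q-1). What remains is (2q-1)² -
    -- (4q-3) = 4(q-1)².
    λ₃λ₄≈ : let q = fromℕ (suc a) in
      s * s ≈ fromℕ 4 * q - fromℕ 3 →
      ½ * (- (fromℕ 2 * q ^ 2) + fromℕ 3 * q - 1# + (q - 1#) * s) *
      (½ * (- (fromℕ 2 * q ^ 2) + fromℕ 3 * q - 1# - (q - 1#) * s)) ≈ α * α * (α * α)
    λ₃λ₄≈ s²≈ = half-product ½*2≈1 u v (α * α * (α * α)) (begin
      u * u - v * v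
        ≈⟨ +-congˡ (-‿cong (solve 2 (λ w s → w :* s :* (w :* s) := w :* w :* (s :* s)) refl (q - 1#) s)) ⟩
      u * u - (q - 1#) * (q - 1#) * (s * s)
        ≈⟨ +-congˡ (-‿cong (*-congˡ s²≈)) ⟩
      u * u - (q - 1#) * (q - 1#) * (fromℕ 4 * q - fromℕ 3)
        ≈⟨ solve 1 (λ α → let q = con (+ 1) :+ α ; u = :- (nat 2 :* q :^ 2) :+ nat 3 :* q :- con (+ 1) in
             u :* u :- (q :- con (+ 1)) :* (q :- con (+ 1)) :* (nat 4 :* q :- nat 3)
             := (con (+ 1) :+ con (+ 1)) :* (con (+ 1) :+ con (+ 1)) :* (α :* α :* (α :* α))) refl α ⟩
      (1# + 1#) * (1# + 1#) * (α * α * (α * α)) ∎)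

  module _ (s t : Carrier) where
    private
      q u v : Carrier
      q = fromℕ (suc a)
      u = fromℕ 2 * q ^ 2 - q - 1#
      v = s * t

    λ₅+λ₆≈ : let q = fromℕ (suc a) in
      ½ * (fromℕ 2 * q ^ 2 - q - 1# + s * t) +
      ½ * (fromℕ 2 * q ^ 2 - q - 1# - s * t) ≈ - (- (α + α + α + (α * α + α * α)))
    λ₅+λ₆≈ = trans (half-sum ½*2≈1 u v)
      (solve 1 (λ α → nat 2 :* (con (+ 1) :+ α) :^ 2 :- (con (+ 1) :+ α) :- con (+ 1)
        := :- (:- (α :+ α :+ α :+ (α :* α :+ α :* α)))) refl α)

    -- Here 2q² - q - 1 = (q-1)(2q+1) and 4q³ - 9q² + 6q - 1 = (q-1)²(4q-1), and (2q+1)² - 3(4q-1) =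
    -- 4(q-1)².
    λ₅λ₆≈ : let q = fromℕ (suc a) in
      s * s ≈ fromℕ 3 → t * t ≈ fromℕ 4 * q ^ 3 - fromℕ 9 * q ^ 2 + fromℕ 6 * q - 1# →
      ½ * (fromℕ 2 * q ^ 2 - q - 1# + s * t) *
      (½ * (fromℕ 2 * q ^ 2 - q - 1# - s * t)) ≈ α * α * (α * α)
    λ₅λ₆≈ s²≈ t²≈ = half-product ½*2≈1 u v (α * α * (α * α)) (begin
      u * u - v * v
        ≈⟨ +-congˡ (-‿cong (solve 2 (λ s t → s :* t :* (s :* t) := s :* s :* (t :* t)) refl s t)) ⟩
      u * u - s * s * (t * t)
        ≈⟨ +-congˡ (-‿cong (*-cong s²≈ t²≈)) ⟩
      u * u - fromℕ 3 * (fromℕ 4 * q ^ 3 - fromℕ 9 * q ^ 2 + fromℕ 6 * q - 1#)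
        ≈⟨ solve 1 (λ α → let q = con (+ 1) :+ α ; u = nat 2 :* q :^ 2 :- q :- con (+ 1) in
             u :* u :- nat 3 :* (nat 4 :* q :^ 3 :- nat 9 :* q :^ 2 :+ nat 6 :* q :- con (+ 1))
             := (con (+ 1) :+ con (+ 1)) :* (con (+ 1) :+ con (+ 1)) :* (α :* α :* (α :* α))) refl α ⟩
      (1# + 1#) * (1# + 1#) * (α * α * (α * α)) ∎)

module _ {c ℓ c′ ℓ₁ ℓ₂ ℓ₃ : Level} (K : OrderedField c′ ℓ₁ ℓ₂ ℓ₃) where
  open OrderedField K

  -- A second elaboration of the eigenvalues is equal to the first but not syntactically, and
  -- comparing the two inside IsGraphSpectrum would multiply out the products of linear factors.
  -- Matching on the equality of the lists avoids this.
  relabel : (G : Graph ℓ) (p : ℕ) →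
      let q = fromℕ p in
      (√3 √[4p-3] √[4p³-9p²+6p-1] : Carrier) →
      let λ₁ = (q - 1#) ^ 2
          λ₂ = - (q ^ 2) + fromℕ 2 * q - 1#
          λ₃ = ½ * (- (fromℕ 2 * q ^ 2) + fromℕ 3 * q - 1# + (q - 1#) * √[4p-3])
          λ₄ = ½ * (- (fromℕ 2 * q ^ 2) + fromℕ 3 * q - 1# - (q - 1#) * √[4p-3])
          λ₅ = ½ * (fromℕ 2 * q ^ 2 - q - 1# + √3 * √[4p³-9p²+6p-1])
          λ₆ = ½ * (fromℕ 2 * q ^ 2 - q - 1# - √3 * √[4p³-9p²+6p-1])
          m₀ = (p ℕ.^ 4 ℕ.+ 1) ℕ.∸ ((p ℕ.∸ 1) ℕ.^ 4 ℕ.+ 2 ℕ.^ 4)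
      in ∀ {λs} → (∀ μs → μs ≡ λs → IsGraphSpectrum K G μs) → λs ≡
           (replicate 5 λ₁ ++ replicate 1 λ₂ ++ replicate 3 λ₃ ++ replicate 3 λ₄ ++
            replicate 1 λ₅ ++ replicate 1 λ₆ ++ replicate m₀ 0#) →
         IsGraphSpectrum K G
           (replicate 5 λ₁ ++ replicate 1 λ₂ ++ replicate 3 λ₃ ++ replicate 3 λ₄ ++
            replicate 1 λ₅ ++ replicate 1 λ₆ ++ replicate m₀ 0#)
  relabel G p √3 s t {λs} spectrum-μs ≡.refl = spectrum-μs λs ≡.refl

  mainTheorem8 :
      (p : ℕ) → Prime p →
      (R : FiniteCommutativeRing c ℓ) →
      FiniteCommutativeRing.commutativeRing R ≅ ℤ/ p ×ᴿ ℤ/ p ×ᴿ ℤ/ p ×ᴿ ℤ/ p →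
      let q = fromℕ p in
      (√3 √[4p-3] √[4p³-9p²+6p-1] : Carrier) →
      IsSqrt (fromℕ 3) √3 →
      IsSqrt (fromℕ 4 * q - fromℕ 3) √[4p-3] →
      IsSqrt (fromℕ 4 * q ^ 3 - fromℕ 9 * q ^ 2 + fromℕ 6 * q - 1#) √[4p³-9p²+6p-1] →
      let λ₁ = (q - 1#) ^ 2
          λ₂ = - (q ^ 2) + fromℕ 2 * q - 1#
          λ₃ = ½ * (- (fromℕ 2 * q ^ 2) + fromℕ 3 * q - 1# + (q - 1#) * √[4p-3])
          λ₄ = ½ * (- (fromℕ 2 * q ^ 2) + fromℕ 3 * q - 1# - (q - 1#) * √[4p-3])
          λ₅ = ½ * (fromℕ 2 * q ^ 2 - q - 1# + √3 * √[4p³-9p²+6p-1])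
          λ₆ = ½ * (fromℕ 2 * q ^ 2 - q - 1# - √3 * √[4p³-9p²+6p-1])
          -- p⁴ - (p-1)⁴ - 2⁴ + 1, arranged so that ∸ does not truncate for p ≥ 2
          m₀ = (p ℕ.^ 4 ℕ.+ 1) ℕ.∸ ((p ℕ.∸ 1) ℕ.^ 4 ℕ.+ 2 ℕ.^ 4)
      in IsGraphSpectrum K (Γ R)
           (replicate 5 λ₁ ++ replicate 1 λ₂ ++ replicate 3 λ₃ ++ replicate 3 λ₄ ++
            replicate 1 λ₅ ++ replicate 1 λ₆ ++ replicate m₀ 0#)
  mainTheorem8 zero          p-prime R iso = contradiction p-prime ¬prime[0]
  mainTheorem8 (suc zero)    p-prime R iso = contradiction p-prime ¬prime[1]
  -- With p = b + 2 the number p - 1 is `suc b`, and the multiplicity of 0 becomes `excess b`.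
  mainTheorem8 (suc (suc b)) p-prime R iso √3 √[4p-3] √[4p³-9p²+6p-1] (_ , √3²≈) (_ , √²≈) (_ , √²≈′) =
    relabel (Γ R) (suc (suc b)) √3 √[4p-3] √[4p³-9p²+6p-1]
      (spectrum K b p-prime R iso λ₁≈ λ₂≈ (λ₃+λ₄≈ √[4p-3]) (λ₃λ₄≈ √[4p-3] √²≈)
        (λ₅+λ₆≈ √3 √[4p³-9p²+6p-1]) (λ₅λ₆≈ √3 √[4p³-9p²+6p-1] √3²≈ √²≈′) (m₀≡excess b))
      ≡.refl
    where open Eigenvalues K (suc b)
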